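{- Let $\mathcal F[\sigma]$ be a fragment of logic equivalent to a variety of finite monoids $\mathbf V$ of rank $k$. Let $L\subseteq A^*$ be a regular language and $s$ its stability index. Then the following statements are equivalent: (1) $L$ belongs to $\mathcal F[\sigma,\mathrm{MOD}]$; (2) $L$ belongs to $\mathcal F[\sigma,\mathrm{MOD}^{ks}]$. Furthermore, if $\mathcal F[\sigma,+1]$ is decidable, then so is $\mathcal F[\sigma,\mathrm{MOD}]$.
   Context: Logic. A word $u$ over a finite alphabet $A$ is a set of positions $0,\dots,|u|-1$ labelled by letters. Formulas are monadic second order formulas over words; a signature $\sigma$ is a set of numerical predicates, and letter predicates $\mathbf a(x)$ (position $x$ carries letter $a$) are always available, for letters of any finite alphabet. A fragment of logic $\mathcal F[\sigma]$ is a set of closed formulas of $\mathrm{MSO}[\sigma]$ that contains the quantifier-free formulas and is closed under conjunction, disjunction and quantifier-free substitution (if $\varphi\in\mathcal F[\sigma]$ and $\psi(x_1,\dots,x_n)$ is a quantifier-free subformula of $\varphi$, then replacing $\psi$ by another quantifier-free formula over $\sigma$ with the same set of free variables gives a formula of $\mathcal F[\sigma]$). For a class of predicates $\sigma'$, the enrichment $\mathcal F[\sigma,\sigma']$ is the closure of $\mathcal F[\sigma]$ under quantifier-free substitutions with predicates ranging over $\sigma\cup\sigma'$. $\mathcal F[\sigma]$ also denotes the class of languages defined by its formulas (over each finite alphabet). The symbol $+1$ denotes the class of descriptive local predicates $\mathbf a(x+k)$, $\mathbf a(\min+k)$, $\mathbf a(\max-k)$ for $k\ge0$, holding if the position $x+k$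 (resp. the $k$-th position after the first one, the $k$-th position before the last one) is labelled by $a$. For $d\ge 1$, $\mathrm{MOD}^d$ consists of, for $0\le i<d$, the unary predicates $\mathbf{MOD}_i^d(x)$ (position $x$ is congruent to $i$ mod $d$) and the constants $\mathbf D_i^d$ (the length of the word is congruent to $i$ mod $d$); $\mathrm{MOD}=\bigcup_{d\ge1}\mathrm{MOD}^d$. A fragment is decidable if, given a regular language, one can decide whether it is definable by a formula of the fragment. Algebra. A variety of monoids is a nonempty class of finite monoids closed under division (quotients of submonoids) and finite direct products. $\mathcal F[\sigma]$ is equivalent to $\mathbf V$ if the languages definable in $\mathcal F[\sigma]$ are exactly those recognized by a monoid of $\mathbf V$. The stability index of a regular language $L$ with syntactic morphism $\eta_L:A^*\to M_L$ is the least positive integer $s$ with $\eta_L(A^s)=\eta_L(A^{2s})$. Categories. A monoid is a one-object category. A division of (finite) categories $\tau:C\to D$ is a map on objects together with, for each pair of objects $e,f$ of $C$, a relation $\tau:C(e,f)\to D(\tau(e),\tau(f))$ such that $\tau(x)\tau(y)\subseteq\tau(xy)$ for consecutive arrows $x,y$; $\tau(x)\ne\emptyset$ for every arrow $x$; $1_{\tau(e)}\in\tau(1_e)$ for every object $e$; and $\tau(x)\cap\tau(y)=\emptyset$ for distinct coterminal arrows $x,y$. $\mathbf{gV}$ is the class of all finite categories dividing a monoid of $\mathbf V$. Path equations and rank. For a finite directed graph $X$, $X^*$ is the free category on $X$ (its arrows are the paths of $X$). For coterminal paths $u,v$ let $r(u,v)$ be the least $n$ such that some category morphism $\varphi:X^*\to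 C$ with $C$ a finite category of size $n$ satisfies $\varphi(u)\neq\varphi(v)$; $2^{ -r(u,v)}$ is an ultrametric distance, and the completion of $X^*$ is the profinite free category $\widehat{X^*}$. Each morphism $\varphi:X^*\to C$ to a finite category has a unique continuous extension $\widehat\varphi:\widehat{X^*}\to C$. For coterminal $u,v\in\widehat{X^*}$, a finite category $C$ satisfies the path equation $(X,u=v)$ if $\widehat\varphi(u)=\widehat\varphi(v)$ for every morphism $\varphi:X^*\to C$. The variety $\mathbf V$ has rank $k$ if $\mathbf{gV}$ is the class of finite categories satisfying some set of path equations $(X,u=v)$ in which every graph $X$ has at most $k$ vertices. -}

module Defs where

open import Algebra.Bundles using (Monoid)
open import Algebra.Construct.DirectProduct using () renaming (monoid to _×ᴹ_)
open import Algebra.Morphism.Structures using (IsMonoidHomomorphism)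
open import Data.Bool.Base using (Bool; T)
open import Data.Empty using (⊥)
open import Data.Fin.Base using (Fin; suc; toℕ)
open import Data.Fin.Properties using () renaming (_≟_ to _≟ᶠ_)
open import Data.Fin.Subset using (Subset) renaming (_∈_ to _∈ˢ_)
open import Data.List.Base using (List; []; _++_; length; map; lookup; foldl; head; drop; reverse; sum; allFin)
open import Data.List.Properties using (++-assoc; ++-identityʳ; ++-monoid)
open import Data.Maybe.Base using (Maybe; just)
open import Data.Maybe.Properties using () renaming (≡-dec to ≡-decᵐ)
open import Data.Nat.Base using (ℕ; suc; _+_; _*_; _≤_; _≥_; ∣_-_∣)
open import Data.Nat.Divisibility using (_∣?_)
open import Data.Nat.Properties using (≤-refl) renaming (_≟_ to _≟ⁿ_)
open import Data.Product.Base using (Σ; ∃; ∃-syntax; Σ-syntax; _×_; _,_; proj₁; proj₂)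
open import Data.Sum.Base using (_⊎_; inj₁; inj₂; [_,_]′)
open import Data.Unit.Base using (⊤; tt)
open import Data.Vec.Base as Vec using (Vec; []; _∷_)
open import Data.Vec.Membership.Propositional using () renaming (_∈_ to _∈ⱽ_)
open import Function.Base using (id; _∘_)
open import Function.Bundles using (Equivalence; Inverse; _⇔_; _↔_; mk⇔)
open import Function.Definitions using (Congruent; Injective; Surjective)
open import Function.Properties.Inverse using (Inverse⇒Injection)
open import Level using (Level; 0ℓ; _⊔_) renaming (suc to lsuc)
open import Relation.Binary.Bundles using (Setoid)
open import Relation.Binary.Construct.Closure.ReflexiveTransitive using (Star; ε; _◅_; _◅◅_)
open import Relation.Binary.Construct.Closure.ReflexiveTransitive.Properties using (◅◅-assoc)
open import Relation.Binary.PropositionalEquality.Core using (_≡_; refl; sym; trans; cong; cong₂)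
open import Relation.Binary.PropositionalEquality.Properties as ≡ using ()
open import Relation.Binary.Structures using (IsEquivalence)
open import Relation.Nullary.Decidable using (Dec; does; via-injection; decidable-stable)
open import Relation.Nullary.Negation using (¬_)
open import Relation.Unary using (Pred; _≐_)

------------------------------------------------------------------------
-- Words and languages

-- The alphabet with n letters is Fin n; all alphabets sit inside the common
-- pool ℕ of letters, so that a formula does not depend on an alphabet.

Language : ℕ → Set₁
Language n = Pred (List (Fin n)) 0ℓ

record DFA (n : ℕ) : Set where
  field
    states : ℕ
    start  : Fin states
    δ      : Fin states → Fin n → Fin states
    final  : Fin states → Bool

  Accepts : List (Fin n) → Set
  Accepts w = T (final (foldl δ start w))

Regular : ∀ {n} → Language n → Set
Regular {n} L = Σ[ D ∈ DFA n ] (∀ w → L w ⇔ DFA.Accepts D w)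

------------------------------------------------------------------------
-- Predicates

-- Predicates on the positions of a word (given over the pool of letters).

record Vocabulary : Set₁ where
  field
    Sym   : Set
    arity : Sym → ℕ
    holds : (P : Sym) (w : List ℕ) → Vec (Fin (length w)) (arity P) → Bool

-- Numerical predicates: they only see the length of the word.  Being
-- Bool-valued they are decidable, and hence so is satisfaction of formulas,
-- which therefore agrees with its classical reading.

record Signature : Set₁ where
  field
    Sym   : Set
    arity : Sym → ℕ
    holds : (P : Sym) (n : ℕ) → Vec (Fin n) (arity P) → Bool

numerical : Signature → Vocabulary
numerical σ = record
  { Sym   = Signature.Sym σ
  ; arity = Signature.arity σ
  ; holds = λ P w → Signature.holds σ P (length w)
  }

_∪ⱽ_ : Vocabulary → Vocabulary → Vocabulary
V ∪ⱽ W = record { Sym = V.Sym ⊎ W.Sym ; arity = [ V.arity , W.arity ]′ ; holds = both }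
  where
  module V = Vocabulary V
  module W = Vocabulary W
  both : (P : V.Sym ⊎ W.Sym) (w : List ℕ) → Vec (Fin (length w)) ([ V.arity , W.arity ]′ P) → Bool
  both (inj₁ P) = V.holds P
  both (inj₂ P) = W.holds P

letterAt : List ℕ → ℕ → Maybe ℕ
letterAt w i = head (drop i w)

-- 𝐚(x+k), 𝐚(min+k) and 𝐚(max−k); false when the position does not exist.

data LocalSym : Set where
  atPlus minPlus maxMinus : (a k : ℕ) → LocalSym

local : Vocabulary
local = record { Sym = LocalSym ; arity = ar ; holds = hold }
  where
  ar : LocalSym → ℕ
  ar (atPlus a k)   = 1
  ar (minPlus a k)  = 0
  ar (maxMinus a k) = 0

  hold : (P : LocalSym) (w : List ℕ) → Vec (Fin (length w)) (ar P) → Bool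
  hold (atPlus a k)   w (x ∷ []) = does (≡-decᵐ _≟ⁿ_ (letterAt w (toℕ x + k)) (just a))
  hold (minPlus a k)  w []       = does (≡-decᵐ _≟ⁿ_ (letterAt w k) (just a))
  hold (maxMinus a k) w []       = does (≡-decᵐ _≟ⁿ_ (letterAt (reverse w) k) (just a))

data ModSym (d : ℕ) : Set where
  mod : Fin d → ModSym d   -- 𝐌𝐎𝐃ᵢᵈ(x)
  len : Fin d → ModSym d   -- 𝐃ᵢᵈ

modArity : ∀ {d} → ModSym d → ℕ
modArity (mod i) = 1
modArity (len i) = 0

modHolds : ∀ {d} (P : ModSym d) (n : ℕ) → Vec (Fin n) (modArity P) → Bool
modHolds {d} (mod i) n (x ∷ []) = does (d ∣? ∣ toℕ x - toℕ i ∣)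
modHolds {d} (len i) n []       = does (d ∣? ∣ n - toℕ i ∣)

MOD^ : ℕ → Signature
MOD^ d = record { Sym = ModSym d ; arity = modArity ; holds = modHolds }

-- The index d = 0 contributes no predicate, since Fin 0 is empty.

MOD : Signature
MOD = record
  { Sym   = Σ ℕ ModSym
  ; arity = λ (d , P) → modArity P
  ; holds = λ (d , P) → modHolds P
  }

------------------------------------------------------------------------
-- Monadic second order formulas

-- Formula V m p has (de Bruijn) position variables in Fin m and set
-- variables in Fin p.  Equality of positions is not built in: it is a
-- numerical predicate which a signature may or may not contain.

data Formula (V : Vocabulary) (m p : ℕ) : Set where
  ⊤ᶠ ⊥ᶠ     : Formula V m p
  letter    : (a : ℕ) (x : Fin m) → Formula V m p
  pred      : (P : Vocabulary.Sym V) (xs : Vec (Fin m) (Vocabulary.arity V P)) → Formula V m p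
  member    : (x : Fin m) (X : Fin p) → Formula V m p
  ¬ᶠ_       : Formula V m p → Formula V m p
  _∧ᶠ_ _∨ᶠ_ : Formula V m p → Formula V m p → Formula V m p
  ∃¹ ∀¹     : Formula V (suc m) p → Formula V m p
  ∃² ∀²     : Formula V m (suc p) → Formula V m p

Sentence : Vocabulary → Set
Sentence V = Formula V 0 0

module _ (V : Vocabulary) (w : List ℕ) where

  Sat : ∀ {m p} → Formula V m p → Vec (Fin (length w)) m → Vec (Subset (length w)) p → Set
  Sat ⊤ᶠ           ρ S = ⊤
  Sat ⊥ᶠ           ρ S = ⊥
  Sat (letter a x) ρ S = lookup w (Vec.lookup ρ x) ≡ a
  Sat (pred P xs)  ρ S = T (Vocabulary.holds V P w (Vec.map (Vec.lookup ρ) xs))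
  Sat (member x X) ρ S = Vec.lookup ρ x ∈ˢ Vec.lookup S X
  Sat (¬ᶠ φ)       ρ S = ¬ Sat φ ρ S
  Sat (φ ∧ᶠ χ)     ρ S = Sat φ ρ S × Sat χ ρ S
  Sat (φ ∨ᶠ χ)     ρ S = Sat φ ρ S ⊎ Sat χ ρ S
  Sat (∃¹ φ)       ρ S = ∃[ x ] Sat φ (x ∷ ρ) S
  Sat (∀¹ φ)       ρ S = ∀ x → Sat φ (x ∷ ρ) S
  Sat (∃² φ)       ρ S = ∃[ X ] Sat φ ρ (X ∷ S)
  Sat (∀² φ)       ρ S = ∀ X → Sat φ ρ (X ∷ S)

_⊨_ : ∀ {V n} → List (Fin n) → Sentence V → Set
_⊨_ {V} w φ = Sat V (map toℕ w) φ [] []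

data QuantifierFree {V : Vocabulary} {m p : ℕ} : Formula V m p → Set where
  ⊤ᶠ     : QuantifierFree ⊤ᶠ
  ⊥ᶠ     : QuantifierFree ⊥ᶠ
  letter : ∀ a x → QuantifierFree (letter a x)
  pred   : ∀ P xs → QuantifierFree (pred P xs)
  member : ∀ x X → QuantifierFree (member x X)
  ¬ᶠ_    : ∀ {φ} → QuantifierFree φ → QuantifierFree (¬ᶠ φ)
  _∧ᶠ_   : ∀ {φ χ} → QuantifierFree φ → QuantifierFree χ → QuantifierFree (φ ∧ᶠ χ)
  _∨ᶠ_   : ∀ {φ χ} → QuantifierFree φ → QuantifierFree χ → QuantifierFree (φ ∨ᶠ χ)

Free¹ : ∀ {V m p} → Formula V m p → Pred (Fin m) 0ℓ
Free¹ ⊤ᶠ           x = ⊥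
Free¹ ⊥ᶠ           x = ⊥
Free¹ (letter a y) x = x ≡ y
Free¹ (pred P ys)  x = x ∈ⱽ ys
Free¹ (member y X) x = x ≡ y
Free¹ (¬ᶠ φ)       x = Free¹ φ x
Free¹ (φ ∧ᶠ χ)     x = Free¹ φ x ⊎ Free¹ χ x
Free¹ (φ ∨ᶠ χ)     x = Free¹ φ x ⊎ Free¹ χ x
Free¹ (∃¹ φ)       x = Free¹ φ (suc x)
Free¹ (∀¹ φ)       x = Free¹ φ (suc x)
Free¹ (∃² φ)       x = Free¹ φ x
Free¹ (∀² φ)       x = Free¹ φ x

Free² : ∀ {V m p} → Formula V m p → Pred (Fin p) 0ℓ
Free² ⊤ᶠ           X = ⊥
Free² ⊥ᶠ           X = ⊥
Free² (letter a y) X = ⊥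
Free² (pred P ys)  X = ⊥
Free² (member y Y) X = X ≡ Y
Free² (¬ᶠ φ)       X = Free² φ X
Free² (φ ∧ᶠ χ)     X = Free² φ X ⊎ Free² χ X
Free² (φ ∨ᶠ χ)     X = Free² φ X ⊎ Free² χ X
Free² (∃¹ φ)       X = Free² φ X
Free² (∀¹ φ)       X = Free² φ X
Free² (∃² φ)       X = Free² φ (suc X)
Free² (∀² φ)       X = Free² φ (suc X)

infix 4 _⇝_

-- φ ⇝ φ′ when φ′ is φ with one occurrence of a quantifier-free subformula
-- replaced by a quantifier-free formula with the same free variables.

data _⇝_ {V : Vocabulary} {m p : ℕ} : Formula V m p → Formula V m p → Set where
  here : ∀ {ψ ψ′} → QuantifierFree ψ → QuantifierFree ψ′ →
         Free¹ ψ ≐ Free¹ ψ′ → Free² ψ ≐ Free² ψ′ → ψ ⇝ ψ′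
  ¬ᶠ_  : ∀ {φ φ′} → φ ⇝ φ′ → ¬ᶠ φ ⇝ ¬ᶠ φ′
  ∧ˡ   : ∀ {φ φ′ χ} → φ ⇝ φ′ → φ ∧ᶠ χ ⇝ φ′ ∧ᶠ χ
  ∧ʳ   : ∀ {φ χ χ′} → χ ⇝ χ′ → φ ∧ᶠ χ ⇝ φ ∧ᶠ χ′
  ∨ˡ   : ∀ {φ φ′ χ} → φ ⇝ φ′ → φ ∨ᶠ χ ⇝ φ′ ∨ᶠ χ
  ∨ʳ   : ∀ {φ χ χ′} → χ ⇝ χ′ → φ ∨ᶠ χ ⇝ φ ∨ᶠ χ′
  ∃¹   : ∀ {φ φ′} → φ ⇝ φ′ → ∃¹ φ ⇝ ∃¹ φ′
  ∀¹   : ∀ {φ φ′} → φ ⇝ φ′ → ∀¹ φ ⇝ ∀¹ φ′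
  ∃²   : ∀ {φ φ′} → φ ⇝ φ′ → ∃² φ ⇝ ∃² φ′
  ∀²   : ∀ {φ φ′} → φ ⇝ φ′ → ∀² φ ⇝ ∀² φ′

embed : ∀ {V W m p} → Formula V m p → Formula (V ∪ⱽ W) m p
embed ⊤ᶠ           = ⊤ᶠ
embed ⊥ᶠ           = ⊥ᶠ
embed (letter a x) = letter a x
embed (pred P xs)  = pred (inj₁ P) xs
embed (member x X) = member x X
embed (¬ᶠ φ)       = ¬ᶠ embed φ
embed (φ ∧ᶠ χ)     = embed φ ∧ᶠ embed χ
embed (φ ∨ᶠ χ)     = embed φ ∨ᶠ embed χ
embed (∃¹ φ)       = ∃¹ (embed φ)
embed (∀¹ φ)       = ∀¹ (embed φ)
embed (∃² φ)       = ∃² (embed φ)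
embed (∀² φ)       = ∀² (embed φ)

------------------------------------------------------------------------
-- Fragments of logic

record IsFragment {ℓ : Level} (σ : Signature) (F : Pred (Sentence (numerical σ)) ℓ) : Set ℓ where
  field
    quantifierFree : ∀ {φ} → QuantifierFree φ → F φ
    conjunction    : ∀ {φ χ} → F φ → F χ → F (φ ∧ᶠ χ)
    disjunction    : ∀ {φ χ} → F φ → F χ → F (φ ∨ᶠ χ)
    substitution   : ∀ {φ φ′} → F φ → φ ⇝ φ′ → F φ′

infix 9 _[_]

data _[_] {ℓ : Level} {V : Vocabulary} (F : Pred (Sentence V) ℓ) (W : Vocabulary) : Pred (Sentence (V ∪ⱽ W)) ℓ where
  base : ∀ {φ} → F φ → (F [ W ]) (embed φ)
  step : ∀ {φ φ′} → (F [ W ]) φ → φ ⇝ φ′ → (F [ W ]) φ′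

Definable : ∀ {ℓ V n} → Pred (Sentence V) ℓ → Language n → Set ℓ
Definable {V = V} F L = Σ[ φ ∈ Sentence V ] F φ × (∀ w → L w ⇔ w ⊨ φ)

-- Dec is taken constructively, without excluded middle: an inhabitant is a
-- procedure which takes an automaton for L and decides definability.

DecidableFragment : ∀ {ℓ V} → Pred (Sentence V) ℓ → Set (lsuc 0ℓ ⊔ ℓ)
DecidableFragment F = ∀ {n} (L : Language n) → Regular L → Dec (Definable F L)

------------------------------------------------------------------------
-- Varieties of finite monoids

record FiniteSetoid (S : Setoid 0ℓ 0ℓ) : Set where
  field
    card : ℕ
    enum : Inverse S (≡.setoid (Fin card))

FiniteMonoid : Monoid 0ℓ 0ℓ → Set
FiniteMonoid M = FiniteSetoid (Monoid.setoid M)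

IsHom : (M N : Monoid 0ℓ 0ℓ) → (Monoid.Carrier M → Monoid.Carrier N) → Set
IsHom M N = IsMonoidHomomorphism (Monoid.rawMonoid M) (Monoid.rawMonoid N)

-- M ≼ N: M is a quotient (by π) of a submonoid of N (embedded by ι).

record _≼_ (M N : Monoid 0ℓ 0ℓ) : Set₁ where
  private
    module M = Monoid M
    module N = Monoid N
  field
    S            : Monoid 0ℓ 0ℓ
    ι            : Monoid.Carrier S → N.Carrier
    ι-hom        : IsHom S N ι
    ι-injective  : Injective (Monoid._≈_ S) N._≈_ ι
    π            : Monoid.Carrier S → M.Carrier
    π-hom        : IsHom S M π
    π-surjective : Surjective (Monoid._≈_ S) M._≈_ π

record IsVariety {ℓ : Level} (𝐕 : Pred (Monoid 0ℓ 0ℓ) ℓ) : Set (lsuc 0ℓ ⊔ ℓ) where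
  field
    finite   : ∀ {M} → 𝐕 M → FiniteMonoid M
    nonempty : ∃ 𝐕
    division : ∀ {M N} → FiniteMonoid M → M ≼ N → 𝐕 N → 𝐕 M
    product  : ∀ {M N} → 𝐕 M → 𝐕 N → 𝐕 (M ×ᴹ N)

record _Recognizes_ (M : Monoid 0ℓ 0ℓ) {n : ℕ} (L : Language n) : Set where
  open Monoid M using (Carrier; _≈_)
  field
    η           : List (Fin n) → Carrier
    η-hom       : IsHom (++-monoid (Fin n)) M η
    accept      : Carrier → Bool
    accept-cong : Congruent _≈_ _≡_ accept
    correct     : ∀ w → L w ⇔ T (accept (η w))

_EquivalentTo_ : ∀ {ℓ ℓ′ V} → Pred (Sentence V) ℓ → Pred (Monoid 0ℓ 0ℓ) ℓ′ → Set (lsuc 0ℓ ⊔ ℓ ⊔ ℓ′)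
F EquivalentTo 𝐕 = ∀ {n} (L : Language n) →
  Definable F L ⇔ (Σ[ M ∈ Monoid 0ℓ 0ℓ ] 𝐕 M × (M Recognizes L))

------------------------------------------------------------------------
-- Syntactic monoid and stability index

-- The quotient of the free monoid by the syntactic congruence of L, as a
-- setoid; the syntactic morphism is the identity on representatives.

module _ {n : ℕ} (L : Language n) where

  SyntacticCongruence : List (Fin n) → List (Fin n) → Set
  SyntacticCongruence u v = ∀ x y → L (x ++ u ++ y) ⇔ L (x ++ v ++ y)

  private
    _∘⇔_ : ∀ {A B C : Set} → B ⇔ C → A ⇔ B → A ⇔ C
    g ∘⇔ f = mk⇔ (Equivalence.to g ∘ Equivalence.to f) (Equivalence.from f ∘ Equivalence.from g)

    ≡⇒⇔ : ∀ {A B : Set} → A ≡ B → A ⇔ B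
    ≡⇒⇔ refl = mk⇔ id id

    ≡⇒syn : ∀ {u v} → u ≡ v → SyntacticCongruence u v
    ≡⇒syn refl x y = mk⇔ id id

    syn-cong : ∀ {u u′ v v′} → SyntacticCongruence u u′ → SyntacticCongruence v v′ →
               SyntacticCongruence (u ++ v) (u′ ++ v′)
    syn-cong {u} {u′} {v} {v′} p q x y =
      ≡⇒⇔ (cong L right) ∘⇔ (q (x ++ u′) y ∘⇔ (≡⇒⇔ (cong L middle) ∘⇔ (p x (v ++ y) ∘⇔ ≡⇒⇔ (cong L left))))
      where
      left : x ++ (u ++ v) ++ y ≡ x ++ u ++ v ++ y
      left = cong (x ++_) (++-assoc u v y)
      middle : x ++ u′ ++ v ++ y ≡ (x ++ u′) ++ v ++ y
      middle = sym (++-assoc x u′ (v ++ y))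
      right : (x ++ u′) ++ v′ ++ y ≡ x ++ (u′ ++ v′) ++ y
      right = trans (++-assoc x u′ (v′ ++ y)) (cong (x ++_) (sym (++-assoc u′ v′ y)))

  syntacticMonoid : Monoid 0ℓ 0ℓ
  syntacticMonoid = record
    { Carrier  = List (Fin n)
    ; _≈_      = SyntacticCongruence
    ; _∙_      = _++_
    ; ε        = []
    ; isMonoid = record
      { isSemigroup = record
        { isMagma = record
          { isEquivalence = record
            { refl  = λ x y → mk⇔ id id
            ; sym   = λ p x y → mk⇔ (Equivalence.from (p x y)) (Equivalence.to (p x y))
            ; trans = λ p q x y → q x y ∘⇔ p x y
            }
          ; ∙-cong = syn-cong
          }
        ; assoc = λ u v w → ≡⇒syn (++-assoc u v w)
        }
      ; identity = (λ u → ≡⇒syn refl) , (λ u → ≡⇒syn (++-identityʳ u))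
      }
    }

  syntacticMorphism : List (Fin n) → Monoid.Carrier syntacticMonoid
  syntacticMorphism = id

  -- η_L(Aˢ)
  imageOfLength : ℕ → Pred (Monoid.Carrier syntacticMonoid) 0ℓ
  imageOfLength s m = ∃[ w ] length w ≡ s × (syntacticMorphism w ≈ m)
    where open Monoid syntacticMonoid using (_≈_)

  IsStable : ℕ → Set
  IsStable s = s ≥ 1 × (imageOfLength s ≐ imageOfLength (2 * s))

  IsStabilityIndex : ℕ → Set
  IsStabilityIndex s = IsStable s × (∀ t → IsStable t → s ≤ t)

------------------------------------------------------------------------
-- Categories

-- Composition is written in diagrammatic order.

record Category : Set₁ where
  infix  4 _≈_ _⇒_
  infixl 7 _∙_
  field
    Obj           : Set
    _⇒_           : Obj → Obj → Set
    _≈_           : ∀ {e f} → e ⇒ f → e ⇒ f → Set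
    isEquivalence : ∀ {e f} → IsEquivalence (_≈_ {e} {f})
    1#            : ∀ e → e ⇒ e
    _∙_           : ∀ {e f g} → e ⇒ f → f ⇒ g → e ⇒ g
    ∙-cong        : ∀ {e f g} {x x′ : e ⇒ f} {y y′ : f ⇒ g} → x ≈ x′ → y ≈ y′ → x ∙ y ≈ x′ ∙ y′
    assoc         : ∀ {e f g h} (x : e ⇒ f) (y : f ⇒ g) (z : g ⇒ h) → (x ∙ y) ∙ z ≈ x ∙ (y ∙ z)
    identityˡ     : ∀ {e f} (x : e ⇒ f) → 1# e ∙ x ≈ x
    identityʳ     : ∀ {e f} (x : e ⇒ f) → x ∙ 1# f ≈ x

  hom : Obj → Obj → Setoid 0ℓ 0ℓ
  hom e f = record { Carrier = e ⇒ f ; _≈_ = _≈_ ; isEquivalence = isEquivalence }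

record FiniteCategory : Set₁ where
  field
    category   : Category
  open Category category public
  field
    objects    : ℕ
    enumObj    : Fin objects ↔ Obj
    finiteHom  : ∀ e f → FiniteSetoid (hom e f)

  -- the number of arrows
  size : ℕ
  size = sum (map (λ i → sum (map (λ j → FiniteSetoid.card (finiteHom (ob i) (ob j))) (allFin objects))) (allFin objects))
    where ob = Inverse.to enumObj

record Functor (C D : Category) : Set where
  private
    module C = Category C
    module D = Category D
  field
    F₀       : C.Obj → D.Obj
    F₁       : ∀ {e f} → e C.⇒ f → F₀ e D.⇒ F₀ f
    F-resp-≈ : ∀ {e f} {x y : e C.⇒ f} → x C.≈ y → F₁ x D.≈ F₁ y
    F-1      : ∀ e → F₁ (C.1# e) D.≈ D.1# (F₀ e)
    F-∙      : ∀ {e f g} (x : e C.⇒ f) (y : f C.⇒ g) → F₁ (x C.∙ y) D.≈ F₁ x D.∙ F₁ y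

oneObject : Monoid 0ℓ 0ℓ → Category
oneObject M = record
  { Obj           = ⊤
  ; _⇒_           = λ _ _ → Carrier
  ; _≈_           = _≈_
  ; isEquivalence = isEquivalence
  ; 1#            = λ _ → ε′
  ; _∙_           = _∙_
  ; ∙-cong        = ∙-cong
  ; assoc         = assoc
  ; identityˡ     = identityˡ
  ; identityʳ     = identityʳ
  }
  where open Monoid M renaming (ε to ε′)

record Division (C D : Category) : Set₁ where
  private
    module C = Category C
    module D = Category D
  field
    τ₀        : C.Obj → D.Obj
    τ         : ∀ {e f} → e C.⇒ f → Pred (τ₀ e D.⇒ τ₀ f) 0ℓ
    τ-resp-≈  : ∀ {e f} {x x′ : e C.⇒ f} {z z′} → x C.≈ x′ → z D.≈ z′ → τ x z → τ x′ z′
    product   : ∀ {e f g} {x : e C.⇒ f} {y : f C.⇒ g} {z t} → τ x z → τ y t → τ (x C.∙ y) (z D.∙ t)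
    nonempty  : ∀ {e f} (x : e C.⇒ f) → ∃ (τ x)
    unit      : ∀ e → τ (C.1# e) (D.1# (τ₀ e))
    disjoint  : ∀ {e f} {x y : e C.⇒ f} → ¬ (x C.≈ y) → ∀ {z} → ¬ (τ x z × τ y z)

𝐠 : ∀ {ℓ} → Pred (Monoid 0ℓ 0ℓ) ℓ → Pred FiniteCategory (lsuc 0ℓ ⊔ ℓ)
𝐠 𝐕 C = Σ[ M ∈ Monoid 0ℓ 0ℓ ] 𝐕 M × Division (FiniteCategory.category C) (oneObject M)

------------------------------------------------------------------------
-- Free and profinite free categories, path equations, rank

record Graph : Set where
  field
    vertices : ℕ
    edges    : Fin vertices → Fin vertices → ℕ

  Vertex : Set
  Vertex = Fin vertices

  Edge : Vertex → Vertex → Set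
  Edge e f = Fin (edges e f)

  Path : Vertex → Vertex → Set
  Path = Star Edge

  free : Category
  free = record
    { Obj           = Vertex
    ; _⇒_           = Path
    ; _≈_           = _≡_
    ; isEquivalence = ≡.isEquivalence
    ; 1#            = λ _ → ε
    ; _∙_           = _◅◅_
    ; ∙-cong        = cong₂ _◅◅_
    ; assoc         = ◅◅-assoc
    ; identityˡ     = λ _ → refl
    ; identityʳ     = right
    }
    where
    right : ∀ {e f} (p : Path e f) → p ◅◅ ε ≡ p
    right ε       = refl
    right (a ◅ p) = cong (a ◅_) (right p)

module _ (X : Graph) where
  open Graph X

  Separated : ∀ {e f} → ℕ → Path e f → Path e f → Set₁
  Separated n u v = Σ[ C ∈ FiniteCategory ] FiniteCategory.size C ≡ n ×
    Σ[ φ ∈ Functor free (FiniteCategory.category C) ]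
      ¬ (FiniteCategory._≈_ C (Functor.F₁ φ u) (Functor.F₁ φ v))

  -- r(u,v) > n, that is, the distance of u and v is less than 2⁻ⁿ
  Close : ∀ {e f} → ℕ → Path e f → Path e f → Set₁
  Close n u v = ∀ m → m ≤ n → ¬ Separated m u v

  -- An arrow of the completion, represented by a Cauchy sequence of paths.
  record ProfinitePath (e f : Vertex) : Set₁ where
    field
      path   : ℕ → Path e f
      cauchy : ∀ n → ∃[ N ] (∀ i j → i ≥ N → j ≥ N → Close n (path i) (path j))

  module _ (C : FiniteCategory) (φ : Functor free (FiniteCategory.category C)) where
    open FiniteCategory C using (_⇒_; _≈_; size; finiteHom)
    open Functor φ
    open ProfinitePath

    -- The continuous extension of φ: by extend-limit, the sequence
    -- of the φ(uᵢ) is eventually constant, with this value.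
    extend : ∀ {e f} → ProfinitePath e f → F₀ e ⇒ F₀ f
    extend u = F₁ (path u (proj₁ (cauchy u size)))

    extend-limit : ∀ {e f} (u : ProfinitePath e f) →
                   ∃[ N ] (∀ i → i ≥ N → F₁ (path u i) ≈ extend u)
    extend-limit {e} {f} u = N , λ i i≥N →
      decidable-stable (F₁ (path u i) ≟ extend u)
        (λ ≉ → close i N i≥N ≤-refl size ≤-refl (C , refl , φ , ≉))
      where
      N     = proj₁ (cauchy u size)
      close = proj₂ (cauchy u size)
      _≟_   = via-injection (Inverse⇒Injection (FiniteSetoid.enum (finiteHom (F₀ e) (F₀ f)))) _≟ᶠ_

record PathEquation : Set₁ where
  field
    graph         : Graph
    source target : Graph.Vertex graph
    lhs rhs       : ProfinitePath graph source target

_Satisfies_ : FiniteCategory → PathEquation → Set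
C Satisfies eq = (φ : Functor (Graph.free graph) category) → extend graph C φ lhs ≈ extend graph C φ rhs
  where
  open PathEquation eq
  open FiniteCategory C using (category; _≈_)

record HasRank {ℓ : Level} (ℓ′ : Level) (𝐕 : Pred (Monoid 0ℓ 0ℓ) ℓ) (k : ℕ) : Set (lsuc 0ℓ ⊔ ℓ ⊔ lsuc ℓ′) where
  field
    equations : Pred PathEquation ℓ′
    bounded   : ∀ eq → equations eq → Graph.vertices (PathEquation.graph eq) ≤ k
    defines   : ∀ C → 𝐠 𝐕 C ⇔ (∀ eq → equations eq → C Satisfies eq)

{-# OPTIONS --safe #-}
module Submission where

-- Write C_d for the category whose objects are the residues modulo d and whose
-- arrows i ⟶ j are the syntactic classes of the words of length j − i modulo d.
-- L is definable with MOD^ d iff 𝐕 recognizes L once every position is labelled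
-- by its residue modulo d and the length modulo d is known, and this holds iff
-- C_d divides a monoid of 𝐕.
--
-- Let k * s divide d.  A graph with at most k vertices, mapped to C_(k * s),
-- leaves s − 1 consecutive residues free up to a rotation.  Cutting the circle
-- of residues there lifts the map to C_d: an arrow shorter than s cannot cross
-- the gap, and a longer one has representatives of all lengths ≥ s which are
-- congruent modulo s, because s is stable.  So C_(k * s) inherits from C_d the
-- path equations which define 𝐠 𝐕.
--
-- For decidability, encode the arrows of C_d by a regular language of paths.  If
-- loops are inserted between the letters, then a local predicate of bounded
-- offset sees at most one letter, and so the language of paths is definable
-- with local predicates iff 𝐕 recognizes the labelled words of L.

open import Defs
open import Algebra.Bundles using (Monoid)
open import Algebra.Construct.DirectProduct using () renaming (monoid to _×ᴹ_)
open import Algebra.Morphism.Structures using (IsMonoidHomomorphism)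
open import Data.Bool.Base using (Bool; T; false; if_then_else_; true)
open import Data.Empty using (⊥; ⊥-elim)
open import Data.Fin.Base using (Fin; combine; finToFun; fromℕ<; funToFin; remQuot; suc; toℕ; zero)
open import Data.Fin.Properties using (
  combine-injective; combine-remQuot; finToFun-funToFin; funToFin-finToFin; pigeonhole
  ; remQuot-combine; toℕ-fromℕ<; toℕ-injective; toℕ<n; ¬∀⟶∃¬) renaming (_≟_ to _≟ᶠ_; all? to allᶠ?; any? to anyᶠ?)
open import Data.Fin.Subset using (Subset) renaming (_∈_ to _∈ˢ_)
open import Data.List.Base as List using (
  List; []; _++_; _∷_; allFin; cartesianProduct; cartesianProductWith; deduplicate; drop; filterᵇ
  ; foldl; foldr; head; length; lookup; map; replicate; reverse; tabulate; take)
open import Data.List.Membership.Propositional using (_∈_; find; lose)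
open import Data.List.Membership.Propositional.Properties using (
  ∈-++⁺ʳ; ∈-++⁺ˡ; ∈-allFin; ∈-cartesianProductWith⁺; ∈-cartesianProduct⁺; ∈-filter⁺; ∈-filter⁻
  ; ∈-lookup; ∈-map⁺)
import Data.List.Membership.Setoid as SetoidMembership
open import Data.List.Properties using (
  ++-assoc; ++-identityʳ; ++-monoid; drop-drop; foldl-++; length-++; length-drop; length-map
  ; length-replicate; length-take; reverse-++; reverse-involutive; reverse-map; take++drop≡id
  ; unfold-reverse)
open import Data.List.Relation.Unary.All as All using (All; []; _∷_)
import Data.List.Relation.Unary.All.Properties as All
open import Data.List.Relation.Unary.AllPairs.Core using ([]; _∷_)
open import Data.List.Relation.Unary.Any as Any using (Any; here; there)
import Data.List.Relation.Unary.Any.Properties as Any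
open import Data.List.Relation.Unary.Enumerates.Setoid using (IsEnumeration)
open import Data.List.Relation.Unary.Enumerates.Setoid.Properties using (deduplicate⁺)
open import Data.List.Relation.Unary.Unique.DecSetoid.Properties using (deduplicate-!)
import Data.List.Relation.Unary.Unique.Setoid as SetoidUnique
open import Data.Maybe.Base as Maybe using (Maybe; just; nothing)
open import Data.Maybe.Properties using (
  just-injective) renaming (≡-dec to ≡-decᵐ; map-injective to map-injectiveᵐ)
open import Data.Nat.Base using (
  >-nonZero; NonZero; _%_; _*_; _+_; _/_; _<_; _^_; _∸_; _≤_; _≥_; suc; s≤s; s≤s⁻¹; zero; z≤n; ℕ
  ; ∣_-_∣) renaming (pred to predⁿ)
open import Data.Nat.DivMod using (
  %-distribˡ-+; %-remove-+ʳ; [m+kn]%n≡m%n; [m+n]%n≡m%n; m%n%n≡m%n; m%n<n; m<n⇒m%n≡m; m∣n⇒o%n%m≡o%m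
  ; m≡m%n+[m/n]*n; n%n≡0) renaming (_mod_ to _modulo_)
open import Data.Nat.Divisibility using (_∣?_; _∣_; divides; m∣m*n; n∣m*n; n∣m⇒m%n≡0; ∣-refl; ∣-trans)
open import Data.Nat.Induction using (<-wellFounded; Acc; acc)
open import Data.Nat.Properties using (
  *-cancelʳ-≡; *-distribʳ-+; *-distribʳ-∣-∣; *-monoˡ-<; *-monoˡ-≤; *-suc; +-assoc; +-comm
  ; +-identityʳ; +-mono-≤-<; +-monoˡ-<; +-suc; <-irrefl; <⇒≤; _<?_; _≟_; _≤?_; m*n≢0; m+[n∸m]≡n
  ; m+n∸m≡n; m<n⇒0<n∸m; m∸[m∸n]≡n; m∸n+n≡m; m≤m*n; m≤m+n; m≤n*m; m≤n+m; m≤n⇒m⊓n≡m; m≤n⇒∣m-n∣≡n∸m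
  ; n<1+n; suc-pred; ∣-∣-comm; ∣m+n-m+o∣≡∣n-o∣; ∣m-n∣≡0⇒m≡n; ∸-monoʳ-≤; ∸-monoˡ-<; ∸-monoˡ-≤
  ; ≤-<-trans; ≤-reflexive; ≤-total; ≤-trans; ≮⇒≥; ≰⇒>)
open import Data.Product.Base using (_,_; _×_; proj₁; proj₂; Σ; Σ-syntax; ∃-syntax)
open import Data.Product.Function.NonDependent.Propositional using (_×-⇔_)
open import Data.Sum.Base as Sum using (inj₁; inj₂)
open import Data.Sum.Function.Propositional using (_⊎-⇔_)
open import Data.Unit.Base using (tt; ⊤)
open import Data.Vec.Base as Vec using (Vec; []; _∷_)
open import Data.Vec.Membership.Propositional using () renaming (_∈_ to _∈ⱽ_)
import Data.Vec.Relation.Unary.Any as AnyV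
open import Function.Base using (_∘_; id)
open import Function.Bundles using (Equivalence; Inverse; _⇔_; mk⇔)
open import Function.Construct.Composition using (_⇔-∘_)
open import Function.Construct.Identity using (↔-id; ⇔-id)
open import Function.Construct.Symmetry using (⇔-sym)
open import Function.Definitions using (Congruent)
open import Function.Properties.Inverse using (Inverse⇒Injection)
open import Function.Related.TypeIsomorphisms using (¬-cong-⇔)
open import Level using (0ℓ; Level; _⊔_) renaming (suc to lsuc)
open import Relation.Binary.Bundles using (DecSetoid; Setoid)
open import Relation.Binary.Construct.Closure.ReflexiveTransitive as Star using (Star; _◅_; _◅◅_; ε)
open import Relation.Binary.Definitions using () renaming (Decidable to Decidable₂)
open import Relation.Binary.PropositionalEquality.Core using (
  _≡_; cong; cong₂; refl; subst; subst₂; sym; trans)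
open import Relation.Binary.PropositionalEquality.Properties using (module ≡-Reasoning)
open import Relation.Nullary.Decidable using (
  Dec; T?; _because_; _×-dec_; _→-dec_; decidable-stable; does; does-⇔; map′; no; via-injection; yes)
open import Relation.Nullary.Negation using (contradiction; ¬_)
open import Relation.Nullary.Reflects using (ofʸ; ofⁿ)
open import Relation.Unary using (Decidable; Pred; _≐_)

open Equivalence using (to; from)

-- Substitution in a fragment need not preserve meaning: an atom may be exchanged for any
-- quantifier-free formula with the same free variables. So the atoms of a sentence of `F` can be
-- reinterpreted while its quantifiers stay fixed, and predicates are traded for letters: the word
-- is enriched until each predicate about x is a property of the single letter at x. Predicates
-- about the length or the ends of the word have no variable; they become constants, with one
-- sentence for each of finitely many cases, and a product monoid treats the cases together.
-- Conversely, a guard selects the case.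
--
-- The modulus d comes from the moduli in the sentence and is not bounded in terms of L. The labels
-- disappear in C_d, whose arrows are only syntactic classes with their ends, and this makes
-- different moduli comparable. The k rotations by multiples of s match the rank: a vertex can enter
-- the forbidden residues for at most one of them, and one vertex is kept out altogether, so at most
-- k - 1 rotations fail.

⇔-refl : ∀ {a} {A : Set a} → A ⇔ A
⇔-refl = ⇔-id _

infixr 4 _⇔∙_

_⇔∙_ : ∀ {a b c} {A : Set a} {B : Set b} {C : Set c} → A ⇔ B → B ⇔ C → A ⇔ C
f ⇔∙ g = g ⇔-∘ f

≡⇒⇔ : ∀ {A B : Set} → A ≡ B → A ⇔ B
≡⇒⇔ refl = ⇔-refl

T-does : ∀ {A : Set} (A? : Dec A) → T (does A?) ⇔ A
T-does (true  because ofʸ a)  = mk⇔ (λ _ → a) (λ _ → tt)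
T-does (false because ofⁿ ¬a) = mk⇔ (λ ()) ¬a

-- Letters at the positions of a word

at : ∀ {A : Set} → List A → ℕ → Maybe A
at w i = head (drop i w)

at-lookup : ∀ {A : Set} (w : List A) (x : Fin (length w)) → at w (toℕ x) ≡ just (lookup w x)
at-lookup (a ∷ w) zero    = refl
at-lookup (a ∷ w) (suc x) = at-lookup w x

at-map : ∀ {A B : Set} (f : A → B) (w : List A) i → at (map f w) i ≡ Maybe.map f (at w i)
at-map f []      zero    = refl
at-map f []      (suc i) = refl
at-map f (a ∷ w) zero    = refl
at-map f (a ∷ w) (suc i) = at-map f w i

lookup-map-toℕ : ∀ {n} (v : List (Fin n)) (x : Fin (length (map toℕ v))) →
                 ∃[ c ] at v (toℕ x) ≡ just c × lookup (map toℕ v) x ≡ toℕ c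
lookup-map-toℕ (c ∷ v) zero    = c , refl , refl
lookup-map-toℕ (c ∷ v) (suc x) = lookup-map-toℕ v x

-- Quantifier-free formulas with prescribed free variables

record Basic {V m p} (A : Pred (Fin m) 0ℓ) (φ : Formula V m p) : Set where
  field
    quantifierFree : QuantifierFree φ
    free¹          : Free¹ φ ≐ A
    free²          : ∀ X → ¬ Free² φ X

open Basic

module _ {V : Vocabulary} {m p : ℕ} where

  letter-basic : ∀ a x → Basic (_≡ x) (letter {V} {m} {p} a x)
  letter-basic a x = record
    { quantifierFree = letter a x ; free¹ = id , id ; free² = λ _ () }

  pred-basic : ∀ P xs → Basic (_∈ⱽ xs) (pred {V} {m} {p} P xs)
  pred-basic P xs = record
    { quantifierFree = pred P xs ; free¹ = id , id ; free² = λ _ () }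

  ⊤ᶠ-basic : Basic (λ _ → ⊥) (⊤ᶠ {V} {m} {p})
  ⊤ᶠ-basic = record { quantifierFree = ⊤ᶠ ; free¹ = id , id ; free² = λ _ () }

  ⊥ᶠ-basic : Basic (λ _ → ⊥) (⊥ᶠ {V} {m} {p})
  ⊥ᶠ-basic = record { quantifierFree = ⊥ᶠ ; free¹ = id , id ; free² = λ _ () }

  module _ {A : Pred (Fin m) 0ℓ} where

    ¬-basic : {φ : Formula V m p} → Basic A φ → Basic A (¬ᶠ φ)
    ¬-basic b = record
      { quantifierFree = ¬ᶠ quantifierFree b ; free¹ = free¹ b ; free² = free² b }

    ∧-basic : {φ ψ : Formula V m p} → Basic A φ → Basic A ψ → Basic A (φ ∧ᶠ ψ)
    ∧-basic b c = record
      { quantifierFree = quantifierFree b ∧ᶠ quantifierFree c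
      ; free¹ = Sum.[ proj₁ (free¹ b) , proj₁ (free¹ c) ] , inj₁ ∘ proj₂ (free¹ b)
      ; free² = λ X → Sum.[ free² b X , free² c X ]
      }

    ∨-basic : {φ ψ : Formula V m p} → Basic A φ → Basic A ψ → Basic A (φ ∨ᶠ ψ)
    ∨-basic b c = record
      { quantifierFree = quantifierFree b ∨ᶠ quantifierFree c
      ; free¹ = Sum.[ proj₁ (free¹ b) , proj₁ (free¹ c) ] , inj₁ ∘ proj₂ (free¹ b)
      ; free² = λ X → Sum.[ free² b X , free² c X ]
      }

  resp-basic : ∀ {A A′ : Pred (Fin m) 0ℓ} {φ : Formula V m p} → A ≐ A′ → Basic A φ → Basic A′ φ
  resp-basic (f , g) b = record
    { quantifierFree = quantifierFree b
    ; free¹ = f ∘ proj₁ (free¹ b) , proj₂ (free¹ b) ∘ g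
    ; free² = free² b
    }

  -- What φ and ψ say is irrelevant: substitution asks only for equal free variables, and `Basic`
  -- fixes these to `A` and excludes set variables.
  basic-⇝ : ∀ {A} {φ ψ : Formula V m p} → Basic A φ → Basic A ψ → φ ⇝ ψ
  basic-⇝ b c = here (quantifierFree b) (quantifierFree c)
    (proj₂ (free¹ c) ∘ proj₁ (free¹ b) , proj₂ (free¹ b) ∘ proj₁ (free¹ c))
    (⊥-elim ∘ free² b _ , ⊥-elim ∘ free² c _)

≡≐∈ : ∀ {m} {x : Fin m} → (_≡ x) ≐ (_∈ⱽ (x ∷ []))
≡≐∈ = AnyV.here , (λ { (AnyV.here e) → e })

⊥≐∈ : ∀ {m} → (λ (_ : Fin m) → ⊥) ≐ (_∈ⱽ [])
⊥≐∈ = (λ ()) , (λ ())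

module _ {V : Vocabulary} {m p : ℕ} (x : Fin m) where

  -- ⊥ᶠ does not have x as a free variable.
  false¹ : Formula V m p
  false¹ = letter 0 x ∧ᶠ (¬ᶠ letter 0 x)

  ⋁ ⋀ : List (Formula V m p) → Formula V m p
  ⋁ = foldr _∨ᶠ_ false¹
  ⋀ = foldr _∧ᶠ_ (¬ᶠ false¹)

  false¹-basic : Basic (_≡ x) false¹
  false¹-basic = ∧-basic (letter-basic 0 x) (¬-basic (letter-basic 0 x))

  ⋁-basic : ∀ {φs} → All (Basic (_≡ x)) φs → Basic (_≡ x) (⋁ φs)
  ⋁-basic []       = false¹-basic
  ⋁-basic (b ∷ bs) = ∨-basic b (⋁-basic bs)

  ⋀-basic : ∀ {φs} → All (Basic (_≡ x)) φs → Basic (_≡ x) (⋀ φs)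
  ⋀-basic []       = ¬-basic false¹-basic
  ⋀-basic (b ∷ bs) = ∧-basic b (⋀-basic bs)

  module _ (w : List ℕ) (ρ : Vec (Fin (length w)) m) (S : Vec (Subset (length w)) p) where

    ⋁-sat : ∀ φs → Sat V w (⋁ φs) ρ S ⇔ Any (λ φ → Sat V w φ ρ S) φs
    ⋁-sat []       = mk⇔ (λ (p , ¬p) → contradiction p ¬p) (λ ())
    ⋁-sat (φ ∷ φs) = mk⇔ (λ { (inj₁ s) → here s ; (inj₂ s) → there (to (⋁-sat φs) s) })
                         (λ { (here s) → inj₁ s ; (there s) → inj₂ (from (⋁-sat φs) s) })

    ⋀-sat : ∀ φs → Sat V w (⋀ φs) ρ S ⇔ All (λ φ → Sat V w φ ρ S) φs
    ⋀-sat []       = mk⇔ (λ _ → []) (λ _ (p , ¬p) → ¬p p)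
    ⋀-sat (φ ∷ φs) = mk⇔ (λ (s , t) → s ∷ to (⋀-sat φs) t)
                         (λ { (s ∷ t) → s , from (⋀-sat φs) t })

-- Translations between vocabularies

-- Translated atoms keep exactly the variables of the original atoms; this is what makes a
-- translation carry substitution steps to substitution steps.
record Translation (V W : Vocabulary) : Set where
  field
    letterᵗ       : ∀ {m p} → ℕ → Fin m → Formula W m p
    letterᵗ-basic : ∀ {m p} a x → Basic (_≡ x) (letterᵗ {m} {p} a x)
    predᵗ         : ∀ {m p} (P : Vocabulary.Sym V) → Vec (Fin m) (Vocabulary.arity V P) → Formula W m p
    predᵗ-basic   : ∀ {m p} P xs → Basic (_∈ⱽ xs) (predᵗ {m} {p} P xs)

module _ {V W : Vocabulary} (θ : Translation V W) where
  open Translation θ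

  translate : ∀ {m p} → Formula V m p → Formula W m p
  translate ⊤ᶠ           = ⊤ᶠ
  translate ⊥ᶠ           = ⊥ᶠ
  translate (letter a x) = letterᵗ a x
  translate (pred P xs)  = predᵗ P xs
  translate (member x X) = member x X
  translate (¬ᶠ φ)       = ¬ᶠ translate φ
  translate (φ ∧ᶠ χ)     = translate φ ∧ᶠ translate χ
  translate (φ ∨ᶠ χ)     = translate φ ∨ᶠ translate χ
  translate (∃¹ φ)       = ∃¹ (translate φ)
  translate (∀¹ φ)       = ∀¹ (translate φ)
  translate (∃² φ)       = ∃² (translate φ)
  translate (∀² φ)       = ∀² (translate φ)

  private variable m p : ℕ

  translate-quantifierFree : {φ : Formula V m p} → QuantifierFree φ → QuantifierFree (translate φ)
  translate-quantifierFree ⊤ᶠ           = ⊤ᶠ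
  translate-quantifierFree ⊥ᶠ           = ⊥ᶠ
  translate-quantifierFree (letter a x) = quantifierFree (letterᵗ-basic a x)
  translate-quantifierFree (pred P xs)  = quantifierFree (predᵗ-basic P xs)
  translate-quantifierFree (member x X) = member x X
  translate-quantifierFree (¬ᶠ q)       = ¬ᶠ translate-quantifierFree q
  translate-quantifierFree (q ∧ᶠ r)     = translate-quantifierFree q ∧ᶠ translate-quantifierFree r
  translate-quantifierFree (q ∨ᶠ r)     = translate-quantifierFree q ∨ᶠ translate-quantifierFree r

  translate-free¹ : {φ : Formula V m p} → QuantifierFree φ → Free¹ (translate φ) ≐ Free¹ φ
  translate-free¹ ⊤ᶠ           = id , id
  translate-free¹ ⊥ᶠ           = id , id
  translate-free¹ (letter a x) = free¹ (letterᵗ-basic a x)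
  translate-free¹ (pred P xs)  = free¹ (predᵗ-basic P xs)
  translate-free¹ (member x X) = id , id
  translate-free¹ (¬ᶠ q)       = translate-free¹ q
  translate-free¹ (q ∧ᶠ r)     = Sum.map (proj₁ (translate-free¹ q)) (proj₁ (translate-free¹ r))
                               , Sum.map (proj₂ (translate-free¹ q)) (proj₂ (translate-free¹ r))
  translate-free¹ (q ∨ᶠ r)     = Sum.map (proj₁ (translate-free¹ q)) (proj₁ (translate-free¹ r))
                               , Sum.map (proj₂ (translate-free¹ q)) (proj₂ (translate-free¹ r))

  translate-free² : {φ : Formula V m p} → QuantifierFree φ → Free² (translate φ) ≐ Free² φ
  translate-free² ⊤ᶠ           = id , id
  translate-free² ⊥ᶠ           = id , id
  translate-free² (letter a x) = ⊥-elim ∘ free² (letterᵗ-basic a x) _ , λ ()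
  translate-free² (pred P xs)  = ⊥-elim ∘ free² (predᵗ-basic P xs) _ , λ ()
  translate-free² (member x X) = id , id
  translate-free² (¬ᶠ q)       = translate-free² q
  translate-free² (q ∧ᶠ r)     = Sum.map (proj₁ (translate-free² q)) (proj₁ (translate-free² r))
                               , Sum.map (proj₂ (translate-free² q)) (proj₂ (translate-free² r))
  translate-free² (q ∨ᶠ r)     = Sum.map (proj₁ (translate-free² q)) (proj₁ (translate-free² r))
                               , Sum.map (proj₂ (translate-free² q)) (proj₂ (translate-free² r))

  translate-⇝ : {φ ψ : Formula V m p} → φ ⇝ ψ → translate φ ⇝ translate ψ
  translate-⇝ (here q r (f , g) (f′ , g′)) = here (translate-quantifierFree q) (translate-quantifierFree r)
    ( proj₂ (translate-free¹ r) ∘ f ∘ proj₁ (translate-free¹ q)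
    , proj₂ (translate-free¹ q) ∘ g ∘ proj₁ (translate-free¹ r))
    ( proj₂ (translate-free² r) ∘ f′ ∘ proj₁ (translate-free² q)
    , proj₂ (translate-free² q) ∘ g′ ∘ proj₁ (translate-free² r))
  translate-⇝ (¬ᶠ s) = ¬ᶠ translate-⇝ s
  translate-⇝ (∧ˡ s) = ∧ˡ (translate-⇝ s)
  translate-⇝ (∧ʳ s) = ∧ʳ (translate-⇝ s)
  translate-⇝ (∨ˡ s) = ∨ˡ (translate-⇝ s)
  translate-⇝ (∨ʳ s) = ∨ʳ (translate-⇝ s)
  translate-⇝ (∃¹ s) = ∃¹ (translate-⇝ s)
  translate-⇝ (∀¹ s) = ∀¹ (translate-⇝ s)
  translate-⇝ (∃² s) = ∃² (translate-⇝ s)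
  translate-⇝ (∀² s) = ∀² (translate-⇝ s)

_⇝*_ : ∀ {V m p} → Formula V m p → Formula V m p → Set
_⇝*_ = Star _⇝_

module _ {V : Vocabulary} {m p : ℕ} where

  ∧-⇝* : {φ φ′ χ χ′ : Formula V m p} → φ ⇝* φ′ → χ ⇝* χ′ → (φ ∧ᶠ χ) ⇝* (φ′ ∧ᶠ χ′)
  ∧-⇝* s t = Star.gmap (_∧ᶠ _) ∧ˡ s ◅◅ Star.gmap (_ ∧ᶠ_) ∧ʳ t

  ∨-⇝* : {φ φ′ χ χ′ : Formula V m p} → φ ⇝* φ′ → χ ⇝* χ′ → (φ ∨ᶠ χ) ⇝* (φ′ ∨ᶠ χ′)
  ∨-⇝* s t = Star.gmap (_∨ᶠ _) ∨ˡ s ◅◅ Star.gmap (_ ∨ᶠ_) ∨ʳ t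

-- The two results differ only at atoms, where both are `Basic` for the same variables. With `idᵗ`
-- on one side, this derives a translated sentence from the sentence itself.
translations-⇝* : ∀ {V W} (θ η : Translation V W) {m p} (φ : Formula V m p) → translate θ φ ⇝* translate η φ
translations-⇝* θ η ⊤ᶠ           = ε
translations-⇝* θ η ⊥ᶠ           = ε
translations-⇝* θ η (letter a x) = basic-⇝ (Translation.letterᵗ-basic θ a x) (Translation.letterᵗ-basic η a x) ◅ ε
translations-⇝* θ η (pred P xs)  = basic-⇝ (Translation.predᵗ-basic θ P xs) (Translation.predᵗ-basic η P xs) ◅ ε
translations-⇝* θ η (member x X) = ε
translations-⇝* θ η (¬ᶠ φ)       = Star.gmap ¬ᶠ_ ¬ᶠ_ (translations-⇝* θ η φ)
translations-⇝* θ η (φ ∧ᶠ χ)     = ∧-⇝* (translations-⇝* θ η φ) (translations-⇝* θ η χ)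
translations-⇝* θ η (φ ∨ᶠ χ)     = ∨-⇝* (translations-⇝* θ η φ) (translations-⇝* θ η χ)
translations-⇝* θ η (∃¹ φ)       = Star.gmap ∃¹ ∃¹ (translations-⇝* θ η φ)
translations-⇝* θ η (∀¹ φ)       = Star.gmap ∀¹ ∀¹ (translations-⇝* θ η φ)
translations-⇝* θ η (∃² φ)       = Star.gmap ∃² ∃² (translations-⇝* θ η φ)
translations-⇝* θ η (∀² φ)       = Star.gmap ∀² ∀² (translations-⇝* θ η φ)

idᵗ : ∀ {V} → Translation V V
idᵗ = record { letterᵗ = letter ; letterᵗ-basic = letter-basic ; predᵗ = pred ; predᵗ-basic = pred-basic }

embedᵗ : ∀ {V W} → Translation V (V ∪ⱽ W)
embedᵗ = record
  { letterᵗ = letter ; letterᵗ-basic = letter-basic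
  ; predᵗ = λ P → pred (inj₁ P) ; predᵗ-basic = λ P → pred-basic (inj₁ P)
  }

restrictᵗ : ∀ {V W U} → Translation (V ∪ⱽ W) U → Translation V U
restrictᵗ θ = record
  { letterᵗ = θ.letterᵗ ; letterᵗ-basic = θ.letterᵗ-basic
  ; predᵗ = λ P → θ.predᵗ (inj₁ P) ; predᵗ-basic = λ P → θ.predᵗ-basic (inj₁ P)
  }
  where module θ = Translation θ

translate-id : ∀ {V m p} (φ : Formula V m p) → translate idᵗ φ ≡ φ
translate-id ⊤ᶠ           = refl
translate-id ⊥ᶠ           = refl
translate-id (letter a x) = refl
translate-id (pred P xs)  = refl
translate-id (member x X) = refl
translate-id (¬ᶠ φ)       = cong ¬ᶠ_ (translate-id φ)
translate-id (φ ∧ᶠ χ)     = cong₂ _∧ᶠ_ (translate-id φ) (translate-id χ)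
translate-id (φ ∨ᶠ χ)     = cong₂ _∨ᶠ_ (translate-id φ) (translate-id χ)
translate-id (∃¹ φ)       = cong ∃¹ (translate-id φ)
translate-id (∀¹ φ)       = cong ∀¹ (translate-id φ)
translate-id (∃² φ)       = cong ∃² (translate-id φ)
translate-id (∀² φ)       = cong ∀² (translate-id φ)

translate-embed : ∀ {V W U m p} (θ : Translation (V ∪ⱽ W) U) (φ : Formula V m p) →
                  translate θ (embed φ) ≡ translate (restrictᵗ {V} {W} θ) φ
translate-embed θ ⊤ᶠ           = refl
translate-embed θ ⊥ᶠ           = refl
translate-embed θ (letter a x) = refl
translate-embed θ (pred P xs)  = refl
translate-embed θ (member x X) = refl
translate-embed θ (¬ᶠ φ)       = cong ¬ᶠ_ (translate-embed θ φ)
translate-embed θ (φ ∧ᶠ χ)     = cong₂ _∧ᶠ_ (translate-embed θ φ) (translate-embed θ χ)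
translate-embed θ (φ ∨ᶠ χ)     = cong₂ _∨ᶠ_ (translate-embed θ φ) (translate-embed θ χ)
translate-embed θ (∃¹ φ)       = cong ∃¹ (translate-embed θ φ)
translate-embed θ (∀¹ φ)       = cong ∀¹ (translate-embed θ φ)
translate-embed θ (∃² φ)       = cong ∃² (translate-embed θ φ)
translate-embed θ (∀² φ)       = cong ∀² (translate-embed θ φ)

embed≡translate : ∀ {V W m p} (φ : Formula V m p) → embed {V} {W} φ ≡ translate embedᵗ φ
embed≡translate {V} {W} φ = trans (sym (translate-id (embed φ))) (translate-embed {V} {W} idᵗ φ)

-- By induction on the derivation: every substitution step is carried over by `translate-⇝`, so only
-- the embedded sentences of `F` are left to the caller.
translate-enriched : ∀ {ℓ ℓ′ V W U} {F : Pred (Sentence V) ℓ} {G : Pred (Sentence U) ℓ′} →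
                     (∀ {φ ψ} → G φ → φ ⇝ ψ → G ψ) → (θ : Translation (V ∪ⱽ W) U) →
                     (∀ {φ} → F φ → G (translate θ (embed φ))) →
                     ∀ {φ} → (F [ W ]) φ → G (translate θ φ)
translate-enriched G-⇝ θ F⇒G (base f)   = F⇒G f
translate-enriched G-⇝ θ F⇒G (step f s) = G-⇝ (translate-enriched G-⇝ θ F⇒G f) (translate-⇝ θ s)

closed-⇝* : ∀ {ℓ V} {G : Pred (Sentence V) ℓ} → (∀ {φ ψ} → G φ → φ ⇝ ψ → G ψ) →
            ∀ {φ ψ} → G φ → φ ⇝* ψ → G ψ
closed-⇝* G-⇝ g ε       = g
closed-⇝* G-⇝ g (s ◅ t) = closed-⇝* G-⇝ (G-⇝ g s) t

-- A vocabulary may be infinite, but a formula uses finitely many symbols; a common modulus or a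
-- bound on the offsets is taken over this list.
symbols : ∀ {V m p} → Formula V m p → List (Vocabulary.Sym V)
symbols ⊤ᶠ           = []
symbols ⊥ᶠ           = []
symbols (letter a x) = []
symbols (pred P xs)  = P ∷ []
symbols (member x X) = []
symbols (¬ᶠ φ)       = symbols φ
symbols (φ ∧ᶠ χ)     = symbols φ ++ symbols χ
symbols (φ ∨ᶠ χ)     = symbols φ ++ symbols χ
symbols (∃¹ φ)       = symbols φ
symbols (∀¹ φ)       = symbols φ
symbols (∃² φ)       = symbols φ
symbols (∀² φ)       = symbols φ

-- Satisfaction along a translation between words of equal length

-- The two words have lengths which are equal only propositionally; comparing positions through
-- `toℕ` avoids transporting assignments.
record Same¹ {n n′ m} (ρ : Vec (Fin n) m) (ρ′ : Vec (Fin n′) m) : Set where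
  constructor same
  field
    value : ∀ i → toℕ (Vec.lookup ρ i) ≡ toℕ (Vec.lookup ρ′ i)

record Same² {n n′ p} (S : Vec (Subset n) p) (S′ : Vec (Subset n′) p) : Set where
  constructor same
  field
    value : ∀ X x y → toℕ x ≡ toℕ y → (x ∈ˢ Vec.lookup S X) ⇔ (y ∈ˢ Vec.lookup S′ X)

open Same¹
open Same²

module _ {n n′ : ℕ} (n≡n′ : n ≡ n′) where

  partner : (x : Fin n) → Σ[ y ∈ Fin n′ ] toℕ x ≡ toℕ y
  partner x = subst (λ k → Σ[ y ∈ Fin k ] toℕ x ≡ toℕ y) n≡n′ (x , refl)

  partner² : (X : Subset n) → Σ[ Y ∈ Subset n′ ] (∀ x y → toℕ x ≡ toℕ y → (x ∈ˢ X) ⇔ (y ∈ˢ Y))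
  partner² X = subst (λ k → Σ[ Y ∈ Subset k ] (∀ x y → toℕ x ≡ toℕ y → (x ∈ˢ X) ⇔ (y ∈ˢ Y))) n≡n′
    (X , λ x y e → subst (λ z → (x ∈ˢ X) ⇔ (z ∈ˢ X)) (toℕ-injective e) ⇔-refl)

same¹-∷ : ∀ {n n′ m} {ρ : Vec (Fin n) m} {ρ′ : Vec (Fin n′) m} {x y} →
          toℕ x ≡ toℕ y → Same¹ ρ ρ′ → Same¹ (x ∷ ρ) (y ∷ ρ′)
same¹-∷ e s .value zero    = e
same¹-∷ e s .value (suc i) = s .value i

same²-∷ : ∀ {n n′ m} {S : Vec (Subset n) m} {S′ : Vec (Subset n′) m} {X Y} →
          (∀ x y → toℕ x ≡ toℕ y → (x ∈ˢ X) ⇔ (y ∈ˢ Y)) → Same² S S′ → Same² (X ∷ S) (Y ∷ S′)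
same²-∷ e s .value zero    = e
same²-∷ e s .value (suc X) = s .value X

module _ {V W : Vocabulary} (θ : Translation V W) (w w′ : List ℕ) (eq : length w ≡ length w′)
         (Faithful : Pred (Vocabulary.Sym V) 0ℓ) where
  open Translation θ

  record Correct : Set where
    field
      letter-correct : ∀ {m p} a (x : Fin m) {ρ ρ′} (S : Vec (Subset (length w)) p) (S′ : Vec (Subset (length w′)) p) → Same¹ ρ ρ′ →
                       Sat V w (letter a x) ρ S ⇔ Sat W w′ (letterᵗ a x) ρ′ S′
      pred-correct   : ∀ {m p} P → Faithful P → (xs : Vec (Fin m) _) →
          ∀ {ρ ρ′} (S : Vec (Subset (length w)) p) (S′ : Vec (Subset (length w′)) p) →
                       Same¹ ρ ρ′ → Sat V w (pred P xs) ρ S ⇔ Sat W w′ (predᵗ P xs) ρ′ S′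

  module _ (correct : Correct) where
    open Correct correct

    -- Equal lengths let the quantifiers range over matching positions and sets, so everything
    -- reduces to the atoms, and for predicates to those which occur in φ.
    translate-sat : ∀ {m p} (φ : Formula V m p) → (∀ P → P ∈ symbols φ → Faithful P) →
                    ∀ {ρ ρ′} {S : Vec (Subset (length w)) p} {S′ : Vec (Subset (length w′)) p} → Same¹ ρ ρ′ →
                        Same² S S′ →
                    Sat V w φ ρ S ⇔ Sat W w′ (translate θ φ) ρ′ S′
    translate-sat ⊤ᶠ           good r s = ⇔-refl
    translate-sat ⊥ᶠ           good r s = ⇔-refl
    translate-sat (letter a x) good {S = S} {S′} r s = letter-correct a x S S′ r
    translate-sat (pred P xs)  good {S = S} {S′} r s = pred-correct P (good P (here refl)) xs S S′ r
    translate-sat (member x X) good r s = s .value X _ _ (r .value x)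
    translate-sat (¬ᶠ φ)       good r s = ¬-cong-⇔ (translate-sat φ good r s)
    translate-sat (φ ∧ᶠ χ)     good r s =
      translate-sat φ (λ P → good P ∘ ∈-++⁺ˡ) r s ×-⇔ translate-sat χ (λ P → good P ∘ ∈-++⁺ʳ (symbols φ)) r s
    translate-sat (φ ∨ᶠ χ)     good r s =
      translate-sat φ (λ P → good P ∘ ∈-++⁺ˡ) r s ⊎-⇔ translate-sat χ (λ P → good P ∘ ∈-++⁺ʳ (symbols φ)) r s
    translate-sat (∃¹ φ)       good r s = mk⇔
      (λ (x , t) → let y , e = partner eq x in y , to (translate-sat φ good (same¹-∷ e r) s) t)
      (λ (y , t) → let x , e = partner (sym eq) y in x , from (translate-sat φ good (same¹-∷ (sym e) r) s) t)
    translate-sat (∀¹ φ)       good r s = mk⇔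
      (λ t y → let x , e = partner (sym eq) y in to (translate-sat φ good (same¹-∷ (sym e) r) s) (t x))
      (λ t x → let y , e = partner eq x in from (translate-sat φ good (same¹-∷ e r) s) (t y))
    translate-sat (∃² φ)       good r s = mk⇔
      (λ (X , t) → let Y , e = partner² eq X in Y , to (translate-sat φ good r (same²-∷ e s)) t)
      (λ (Y , t) → let X , e = partner² (sym eq) Y in
         X , from (translate-sat φ good r (same²-∷ (λ x y q → ⇔-sym (e y x (sym q))) s)) t)
    translate-sat (∀² φ)       good r s = mk⇔
      (λ t Y → let X , e = partner² (sym eq) Y in
         to (translate-sat φ good r (same²-∷ (λ x y q → ⇔-sym (e y x (sym q))) s)) (t X))
      (λ t X → let Y , e = partner² eq X in from (translate-sat φ good r (same²-∷ e s)) (t Y))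

same-map-lookup : ∀ {n m k} {ρ ρ′ : Vec (Fin n) m} → Same¹ ρ ρ′ → (xs : Vec (Fin m) k) →
                  Vec.map (Vec.lookup ρ) xs ≡ Vec.map (Vec.lookup ρ′) xs
same-map-lookup s []       = refl
same-map-lookup s (x ∷ xs) = cong₂ _∷_ (toℕ-injective (s .value x)) (same-map-lookup s xs)

holds-same : (σ : Signature) (P : Signature.Sym σ) {n n′ m : ℕ} → n ≡ n′ →
             {ρ : Vec (Fin n) m} {ρ′ : Vec (Fin n′) m} → Same¹ ρ ρ′ → ∀ xs →
             T (Signature.holds σ P n (Vec.map (Vec.lookup ρ) xs)) ⇔
             T (Signature.holds σ P n′ (Vec.map (Vec.lookup ρ′) xs))
holds-same σ P refl s xs = ≡⇒⇔ (cong (T ∘ Signature.holds σ P _) (same-map-lookup s xs))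

open Correct

-- Residues modulo d

module _ {d : ℕ} .{{_ : NonZero d}} where

  -- Modular predicates are defined by divisibility of a distance, whereas labels are remainders;
  -- this passes between the two.
  ∣∣-∣⇔% : ∀ m n → d ∣ ∣ m - n ∣ ⇔ m % d ≡ n % d
  ∣∣-∣⇔% m n = mk⇔ ⇒ ⇐
    where
    le : ∀ {m n} → m ≤ n → d ∣ ∣ m - n ∣ → m % d ≡ n % d
    le {m} {n} m≤n d∣ = trans (sym (%-remove-+ʳ m (subst (d ∣_) (m≤n⇒∣m-n∣≡n∸m m≤n) d∣)))
                              (cong (_% d) (m+[n∸m]≡n m≤n))
    ⇒ : d ∣ ∣ m - n ∣ → m % d ≡ n % d
    ⇒ d∣ with ≤-total m n
    ... | inj₁ m≤n = le m≤n d∣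
    ... | inj₂ n≤m = sym (le n≤m (subst (d ∣_) (∣-∣-comm m n) d∣))
    ⇐ : m % d ≡ n % d → d ∣ ∣ m - n ∣
    ⇐ e = divides ∣ m / d - n / d ∣ (begin
      ∣ m - n ∣                                          ≡⟨ cong₂ ∣_-_∣ (m≡m%n+[m/n]*n m d) (m≡m%n+[m/n]*n n d) ⟩
      ∣ m % d + m / d * d - n % d + n / d * d ∣          ≡⟨ cong (λ r → ∣ m % d + m / d * d - r + n / d * d ∣)
          (sym e) ⟩
      ∣ m % d + m / d * d - m % d + n / d * d ∣          ≡⟨ ∣m+n-m+o∣≡∣n-o∣ (m % d) _ _ ⟩
      ∣ m / d * d - n / d * d ∣                          ≡⟨ sym (*-distribʳ-∣-∣ d (m / d) (n / d)) ⟩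
      ∣ m / d - n / d ∣ * d                              ∎)
      where open ≡-Reasoning

  %-+-cong : ∀ {m m′ n n′} → m % d ≡ m′ % d → n % d ≡ n′ % d → (m + n) % d ≡ (m′ + n′) % d
  %-+-cong {m} {m′} {n} {n′} p q =
    trans (%-distribˡ-+ m n d) (trans (cong₂ (λ a b → (a + b) % d) p q) (sym (%-distribˡ-+ m′ n′ d)))

  %-+-cancelˡ : ∀ a {m n} → (a + m) % d ≡ (a + n) % d → m % d ≡ n % d
  %-+-cancelˡ a {m} {n} e = to (∣∣-∣⇔% m n) (subst (d ∣_) (∣m+n-m+o∣≡∣n-o∣ a m n) (from (∣∣-∣⇔% (a + m) (a + n)) e))

  toℕ-mod : ∀ m → toℕ (m modulo d) ≡ m % d
  toℕ-mod m = toℕ-fromℕ< (m%n<n m d)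

  mod⇔% : ∀ m n → m modulo d ≡ n modulo d ⇔ m % d ≡ n % d
  mod⇔% m n = mk⇔ (λ e → trans (sym (toℕ-mod m)) (trans (cong toℕ e) (toℕ-mod n)))
                  (λ e → toℕ-injective (trans (toℕ-mod m) (trans e (sym (toℕ-mod n)))))

  toℕ-% : ∀ (i : Fin d) → toℕ i % d ≡ toℕ i
  toℕ-% i = m<n⇒m%n≡m (toℕ<n i)

  toℕ-mod-% : ∀ m → toℕ (m modulo d) % d ≡ m % d
  toℕ-mod-% m = trans (toℕ-% (m modulo d)) (toℕ-mod m)

  toℕ-mod-id : ∀ (i : Fin d) → toℕ i modulo d ≡ i
  toℕ-mod-id i = toℕ-injective (trans (toℕ-mod (toℕ i)) (toℕ-% i))

∣-∣-% : ∀ {d d′} .{{_ : NonZero d}} .{{_ : NonZero d′}} → d′ ∣ d → ∀ m n → d′ ∣ ∣ m - n ∣ ⇔ d′ ∣ ∣ m % d - n ∣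
∣-∣-% {d} {d′} d′∣d m n = ∣∣-∣⇔% m n ⇔∙ ≡⇒⇔ (cong (_≡ n % d′) (sym (m∣n⇒o%n%m≡o%m d′ d m d′∣d)))
                  ⇔∙ ⇔-sym (∣∣-∣⇔% (m % d) n)

module _ {V : Vocabulary} {N : ℕ} (S : Fin N → Bool) {m p : ℕ} (x : Fin m) where

  -- A disjunction of letters expresses any property of the letter at x. Built with `⋁`, it has x as
  -- its free variable even if no letter qualifies.
  letterIn : Formula V m p
  letterIn = ⋁ x (map (λ c → letter (toℕ c) x) (filterᵇ S (allFin N)))

  letterIn-basic : Basic (_≡ x) letterIn
  letterIn-basic = ⋁-basic x (All.map⁺ (All.tabulate {xs = filterᵇ S (allFin N)} (λ {c} _ → letter-basic (toℕ c) x)))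

  letterIn-sat : (v : List (Fin N)) {c : Fin N} → ∀ ρ X → at v (toℕ (Vec.lookup ρ x)) ≡ just c →
                 Sat V (map toℕ v) letterIn ρ X ⇔ T (S c)
  letterIn-sat v {c} ρ X e with lookup-map-toℕ v (Vec.lookup ρ x)
  ... | c′ , e′ , l with just-injective (trans (sym e) e′)
  ... | refl = mk⇔ ⇒ ⇐
    where
    ⇒ : Sat V (map toℕ v) letterIn ρ X → T (S c)
    ⇒ s with find (Any.map⁻ (to (⋁-sat x (map toℕ v) ρ X _) s))
    ... | b , b∈ , q with toℕ-injective {i = c′} {b} (trans (sym l) q)
    ... | refl = proj₂ (∈-filter⁻ (λ x → T? (S x)) {xs = allFin N} b∈)
    ⇐ : T (S c) → Sat V (map toℕ v) letterIn ρ X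
    ⇐ t = from (⋁-sat x (map toℕ v) ρ X _)
            (Any.map⁺ (lose (∈-filter⁺ (λ x → T? (S x)) (∈-allFin c) t) l))

constant : ∀ {V m p} → Bool → Formula V m p
constant b = if b then ⊤ᶠ else ⊥ᶠ

constant-basic : ∀ {V m p} b → Basic (_∈ⱽ []) (constant {V} {m} {p} b)
constant-basic true  = resp-basic ⊥≐∈ ⊤ᶠ-basic
constant-basic false = resp-basic ⊥≐∈ ⊥ᶠ-basic

constant-sat : ∀ {V w m p} b {ρ : Vec _ m} {S : Vec _ p} → Sat V w (constant b) ρ S ⇔ T b
constant-sat true  = ⇔-refl
constant-sat false = ⇔-refl

same-[] : ∀ {n n′} → Same¹ {n} {n′} [] []
same-[] = same λ ()

same²-[] : ∀ {n n′} → Same² {n} {n′} [] []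
same²-[] = same λ ()

-- Recognition by monoids of a variety

module _ (M : Monoid 0ℓ 0ℓ) where
  open Monoid M renaming (ε to 1ᴹ; refl to ≈-refl; trans to ≈-trans; sym to ≈-sym)

  extension : ∀ {N} → (Fin N → Carrier) → List (Fin N) → Carrier
  extension f []      = 1ᴹ
  extension f (a ∷ w) = f a ∙ extension f w

  extension-++ : ∀ {N} (f : Fin N → Carrier) u v → extension f (u ++ v) ≈ extension f u ∙ extension f v
  extension-++ f []      v = ≈-sym (identityˡ _)
  extension-++ f (a ∷ u) v = ≈-trans (∙-cong ≈-refl (extension-++ f u v)) (≈-sym (assoc _ _ _))

  extension-hom : ∀ {N} (f : Fin N → Carrier) → IsHom (++-monoid (Fin N)) M (extension f)
  extension-hom f = record
    { isMagmaHomomorphism = record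
      { isRelHomomorphism = record { cong = λ { refl → ≈-refl } }
      ; homo = extension-++ f
      }
    ; ε-homo = ≈-refl
    }

  module _ {d : ℕ} .{{_ : NonZero d}} {n : ℕ} (h : Fin d → Fin n → Carrier) where

    eval : ℕ → List (Fin n) → Carrier
    eval i []      = 1ᴹ
    eval i (a ∷ w) = h (i modulo d) a ∙ eval (suc i) w

    eval-++ : ∀ i u v → eval i (u ++ v) ≈ eval i u ∙ eval (i + length u) v
    eval-++ i []      v rewrite +-identityʳ i = ≈-sym (identityˡ _)
    eval-++ i (a ∷ u) v rewrite +-suc i (length u) =
      ≈-trans (∙-cong ≈-refl (eval-++ (suc i) u v)) (≈-sym (assoc _ _ _))

    eval-mod : ∀ {i j} → i % d ≡ j % d → ∀ u → eval i u ≡ eval j u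
    eval-mod e []      = refl
    eval-mod {i} {j} e (a ∷ u) = cong₂ (λ k m → h k a ∙ m) (from (mod⇔% i j) e)
      (eval-mod {suc i} {suc j} (%-+-cong {m = 1} {1} {i} {j} refl e) u)

module _ {ℓ : Level} (𝐕 : Pred (Monoid 0ℓ 0ℓ) ℓ) where

  -- The acceptance sets differ but the morphism is shared: the sentence will depend on a residue of
  -- the length, which is known only once the whole word has been read.
  record JointlyRecognized {N c : ℕ} (Ls : Fin c → Language N) : Set (lsuc 0ℓ ⊔ ℓ) where
    field
      M           : Monoid 0ℓ 0ℓ
      M∈𝐕         : 𝐕 M
      η           : List (Fin N) → Monoid.Carrier M
      η-hom       : IsHom (++-monoid (Fin N)) M η
      accept      : Fin c → Monoid.Carrier M → Bool
      accept-cong : ∀ e → Congruent (Monoid._≈_ M) _≡_ (accept e)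
      correct     : ∀ e w → Ls e w ⇔ T (accept e (η w))

  -- The algebraic form of definability with `MOD^ d`: the argument `Fin d` of `h` accounts for the
  -- predicates on positions, that of `accept` for those on the length.
  record ModRecognized (d : ℕ) .{{_ : NonZero d}} {n : ℕ} (L : Language n) : Set (lsuc 0ℓ ⊔ ℓ) where
    field
      M           : Monoid 0ℓ 0ℓ
      M∈𝐕         : 𝐕 M
      h           : Fin d → Fin n → Monoid.Carrier M
      accept      : Fin d → Monoid.Carrier M → Bool
      accept-cong : ∀ e → Congruent (Monoid._≈_ M) _≡_ (accept e)
      correct     : ∀ w → L w ⇔ T (accept (length w modulo d) (eval M h 0 w))

  jointlyRecognized : IsVariety 𝐕 → ∀ {N c} (Ls : Fin c → Language N) →
                      (∀ e → Σ[ M ∈ Monoid 0ℓ 0ℓ ] 𝐕 M × (M Recognizes Ls e)) → JointlyRecognized Ls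
  jointlyRecognized var {N} {zero} Ls rec = record
    { M = proj₁ nonempty ; M∈𝐕 = proj₂ nonempty
    ; η = extension (proj₁ nonempty) (λ _ → Monoid.ε (proj₁ nonempty)) ; η-hom = extension-hom (proj₁ nonempty) _
    ; accept = λ () ; accept-cong = λ () ; correct = λ ()
    }
    where open IsVariety var
  jointlyRecognized var {N} {suc c} Ls rec = record
    { M = M₀ ×ᴹ R.M ; M∈𝐕 = IsVariety.product var M₀∈𝐕 R.M∈𝐕
    ; η = λ w → R₀.η w , R.η w
    ; η-hom = record
      { isMagmaHomomorphism = record
        { isRelHomomorphism = record { cong = λ { refl → Monoid.refl (M₀ ×ᴹ R.M) } }
        ; homo = λ u v → H₀.homo u v , H.homo u v
        }
      ; ε-homo = H₀.ε-homo , H.ε-homo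
      }
    ; accept = λ { zero (m , _) → R₀.accept m ; (suc e) (_ , m) → R.accept e m }
    ; accept-cong = λ { zero (p , _) → R₀.accept-cong p ; (suc e) (_ , p) → R.accept-cong e p }
    ; correct = λ { zero → R₀.correct ; (suc e) → R.correct e }
    }
    where
    M₀ = proj₁ (rec zero)
    M₀∈𝐕 = proj₁ (proj₂ (rec zero))
    module R₀ = _Recognizes_ (proj₂ (proj₂ (rec zero)))
    module R  = JointlyRecognized (jointlyRecognized var (Ls ∘ suc) (rec ∘ suc))
    module H₀ = IsMonoidHomomorphism R₀.η-hom
    module H  = IsMonoidHomomorphism R.η-hom

-- Enrichments of a fragment

module Enrichment {ℓ₁ ℓ₂ : Level} {σ : Signature} {F : Pred (Sentence (numerical σ)) ℓ₁} (isFragment : IsFragment σ F)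
                  {𝐕 : Pred (Monoid 0ℓ 0ℓ) ℓ₂} (isVariety : IsVariety 𝐕) (equivalent : F EquivalentTo 𝐕) where

  private
    V = numerical σ
    module F = IsFragment isFragment

  -- A sentence φ of `F` yields its translation by replacing atoms inside `F`, and the later steps
  -- of a derivation translate to steps in `F` as well.
  eliminate : ∀ {W} (θ : Translation (V ∪ⱽ W) V) {φ} → (F [ W ]) φ → F (translate θ φ)
  eliminate {W} θ = translate-enriched F.substitution θ λ {φ} f → closed-⇝* F.substitution f
    (subst₂ _⇝*_ (translate-id φ) (sym (translate-embed {W = W} θ φ)) (translations-⇝* idᵗ (restrictᵗ {W = W} θ) φ))

  embed-definable : ∀ {W n} {L : Language n} → Definable F L → Definable (F [ W ]) L
  embed-definable {W} (φ , f , c) = embed φ , base f , λ w → c w ⇔∙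
    subst (λ ψ → (w ⊨ φ) ⇔ (w ⊨ ψ)) (sym (embed≡translate {W = W} φ))
      (translate-sat embedᵗ (map toℕ w) (map toℕ w) refl (λ _ → ⊤) (correct w) φ (λ _ _ → tt) same-[] same²-[])
    where
    correct : ∀ w → Correct (embedᵗ {W = W}) (map toℕ w) (map toℕ w) refl (λ _ → ⊤)
    correct w .letter-correct a x S S′ r = ≡⇒⇔ (cong (λ y → lookup (map toℕ w) y ≡ a) (toℕ-injective (r .value x)))
    correct w .pred-correct P _ xs S S′ r = holds-same σ P refl r xs

  module _ {W : Vocabulary} (letterᵗ : ∀ {m p} → ℕ → Fin m → Formula (V ∪ⱽ W) m p)
           (letterᵗ-basic : ∀ {m p} a x → Basic (_≡ x) (letterᵗ {m} {p} a x)) where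

    letterwise : Translation V (V ∪ⱽ W)
    letterwise = record
      { letterᵗ = letterᵗ ; letterᵗ-basic = letterᵗ-basic
      ; predᵗ = λ P → pred (inj₁ P) ; predᵗ-basic = λ P → pred-basic (inj₁ P)
      }

    private
      -- A sentence has no free variables at all, so any quantifier-free guard may take the place of
      -- `⊤ᶠ`.
      ⊤ᶠ-⇝ : {g : Sentence (V ∪ⱽ W)} → QuantifierFree g → ⊤ᶠ ⇝ g
      ⊤ᶠ-⇝ q = here ⊤ᶠ q ((λ { {()} }) , (λ { {()} })) ((λ { {()} }) , (λ { {()} }))

      embed-⇝* : (φ : Sentence V) → embed φ ⇝* translate letterwise φ
      embed-⇝* φ = subst (_⇝* translate letterwise φ) (sym (embed≡translate {W = W} φ))
          (translations-⇝* embedᵗ letterwise φ)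

    -- The derivation starts from the disjunction over i of ⊤ᶠ ∧ φ i, which
    -- belongs to F, and replaces each ⊤ᶠ by its guard.

    guarded-definable :
      ∀ {n N} {I : Set} (L : Language n) (K : I → Language N) → (∀ i → Definable F (K i)) →
      (is : List I) (guard : I → Sentence (V ∪ⱽ W)) → (∀ i → QuantifierFree (guard i)) →
      (enrich : List (Fin n) → List (Fin N)) → (∀ w → length (enrich w) ≡ length w) →
      (∀ w {m p} a (x : Fin m) {ρ ρ′} (S : Vec _ p) S′ → Same¹ ρ ρ′ →
         Sat V (map toℕ (enrich w)) (letter a x) ρ S ⇔ Sat (V ∪ⱽ W) (map toℕ w) (letterᵗ a x) ρ′ S′) →
      (∀ w i → w ⊨ guard i → L w ⇔ K i (enrich w)) →
      (∀ w → ∃[ i ] i ∈ is × w ⊨ guard i) →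
      Definable (F [ W ]) L
    guarded-definable {I = I} L K definable is guard guard-qf enrich enrich-length letters L⇔K some =
      result is , closed-⇝* step (base (original∈F is)) (original-⇝* is) , λ w → mk⇔ (⇒ w) (⇐ w is)
      where
      φ : I → Sentence V
      φ i = proj₁ (definable i)

      original : List I → Sentence V
      original = foldr (λ i χ → (⊤ᶠ ∧ᶠ φ i) ∨ᶠ χ) ⊥ᶠ

      result : List I → Sentence (V ∪ⱽ W)
      result = foldr (λ i χ → (guard i ∧ᶠ translate letterwise (φ i)) ∨ᶠ χ) ⊥ᶠ

      original∈F : ∀ is → F (original is)
      original∈F []       = F.quantifierFree ⊥ᶠ
      original∈F (i ∷ is) = F.disjunction (F.conjunction (F.quantifierFree ⊤ᶠ) (proj₁ (proj₂ (definable i)))) (original∈F is)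

      original-⇝* : ∀ is → embed (original is) ⇝* result is
      original-⇝* []       = ε
      original-⇝* (i ∷ is) = ∨-⇝* (∧-⇝* (⊤ᶠ-⇝ (guard-qf i) ◅ ε) (embed-⇝* (φ i))) (original-⇝* is)

      same-length : ∀ w → length (map toℕ (enrich w)) ≡ length (map toℕ w)
      same-length w = trans (length-map toℕ (enrich w)) (trans (enrich-length w) (sym (length-map toℕ w)))

      K⇔ : ∀ w i → K i (enrich w) ⇔ (w ⊨ translate letterwise (φ i))
      K⇔ w i = proj₂ (proj₂ (definable i)) (enrich w) ⇔∙
        translate-sat letterwise _ _ (same-length w) (λ _ → ⊤)
          (record { letter-correct = letters w ; pred-correct = λ P _ xs S S′ r →
              holds-same σ P (same-length w) r xs })
          (φ i) (λ _ _ → tt) same-[] same²-[]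

      ⇐ : ∀ w is → w ⊨ result is → L w
      ⇐ w (i ∷ is) (inj₁ (g , s)) = from (L⇔K w i g) (from (K⇔ w i) s)
      ⇐ w (i ∷ is) (inj₂ s)       = ⇐ w is s

      ⇒ : ∀ w → L w → w ⊨ result is
      ⇒ w l with some w
      ... | i , i∈is , g = go is i∈is
        where
        go : ∀ is → i ∈ is → w ⊨ result is
        go (_ ∷ is) (here refl) = inj₁ (g , to (K⇔ w i) (to (L⇔K w i g) l))
        go (_ ∷ is) (there i∈)  = inj₂ (go is i∈)

  recognized⇒definable : ∀ {N} {L : Language N} (M : Monoid 0ℓ 0ℓ) → 𝐕 M → (f : Fin N → Monoid.Carrier M)
                         (accept : Monoid.Carrier M → Bool) → Congruent (Monoid._≈_ M) _≡_ accept →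
                         (∀ w → L w ⇔ T (accept (extension M f w))) → Definable F L
  recognized⇒definable {L = L} M M∈𝐕 f accept accept-cong correct = from (equivalent L) (M , M∈𝐕 , record
    { η = extension M f ; η-hom = extension-hom M f ; accept = accept ; accept-cong = accept-cong ; correct = correct })

  definable⇒jointlyRecognized : ∀ {N c} (Ls : Fin c → Language N) → (∀ e → Definable F (Ls e)) →
      JointlyRecognized 𝐕 Ls
  definable⇒jointlyRecognized Ls def = jointlyRecognized 𝐕 isVariety Ls (λ e → to (equivalent (Ls e)) (def e))

-- Words labelled by residues

module _ {d : ℕ} .{{_ : NonZero d}} {n : ℕ} where

  label : ℕ → List (Fin n) → List (Fin (n * d))
  label i []      = []
  label i (a ∷ w) = combine a (i modulo d) ∷ label (suc i) w

  length-label : ∀ i w → length (label i w) ≡ length w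
  length-label i []      = refl
  length-label i (a ∷ w) = cong suc (length-label (suc i) w)

  at-label : ∀ i w x {a} → at w x ≡ just a → at (label i w) x ≡ just (combine a ((i + x) modulo d))
  at-label i []      zero    ()
  at-label i []      (suc x) ()
  at-label i (a ∷ w) zero    refl rewrite +-identityʳ i = refl
  at-label i (a ∷ w) (suc x) e    rewrite +-suc i x     = at-label (suc i) w x e

  module _ (M : Monoid 0ℓ 0ℓ) where
    open Monoid M using (Carrier; _≈_; ∙-cong)

    eval-label : (η : List (Fin (n * d)) → Carrier) → IsHom (++-monoid (Fin (n * d))) M η →
                 ∀ i w → eval M (λ i a → η (combine a i ∷ [])) i w ≈ η (label i w)
    eval-label η η-hom i []      = Monoid.sym M (IsMonoidHomomorphism.ε-homo η-hom)
    eval-label η η-hom i (a ∷ w) = Monoid.trans M (∙-cong (Monoid.refl M) (eval-label η η-hom (suc i) w))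
      (Monoid.sym M (IsMonoidHomomorphism.homo η-hom (combine a (i modulo d) ∷ []) (label (suc i) w)))

    extension-label : (h : Fin d → Fin n → Carrier) → ∀ i w →
                      extension M (λ c → h (proj₂ (remQuot {n} d c)) (proj₁ (remQuot {n} d c))) (label i w) ≡ eval M h i w
    extension-label h i []      = refl
    extension-label h i (a ∷ w) = cong₂ (Monoid._∙_ M)
      (cong (λ (a , i) → h i a) (remQuot-combine {n} a (i modulo d))) (extension-label h (suc i) w)

-- Modular predicates

module _ {ℓ₁ ℓ₂ : Level} {σ : Signature} {F : Pred (Sentence (numerical σ)) ℓ₁} (isFragment : IsFragment σ F)
         {𝐕 : Pred (Monoid 0ℓ 0ℓ) ℓ₂} (isVariety : IsVariety 𝐕) (equivalent : F EquivalentTo 𝐕) where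

  private
    V = numerical σ
  open Enrichment isFragment isVariety equivalent

  module _ {n : ℕ} {L : Language n} where

    private
      Divides : ℕ → Vocabulary.Sym (V ∪ⱽ numerical MOD) → Set
      Divides d (inj₁ P)        = ⊤
      Divides d (inj₂ (d′ , P)) = d′ ∣ d

      modSym-nonZero : ∀ {d} → ModSym d → NonZero d
      modSym-nonZero {suc d} P = _
      modSym-nonZero {zero} (mod ())
      modSym-nonZero {zero} (len ())

      divides-∣ : ∀ {d e} P → d ∣ e → Divides d P → Divides e P
      divides-∣ (inj₁ P) d∣e q = tt
      divides-∣ (inj₂ P) d∣e q = ∣-trans q d∣e

      -- Besides the moduli in the list, `d` is a multiple of `D`. This will be k * s, since arrows
      -- are lifted from modulus k * s to a multiple of it.
      commonModulus : ∀ D → NonZero D → (Ps : List (Vocabulary.Sym (V ∪ⱽ numerical MOD))) →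
                      ∃[ d ] NonZero d × D ∣ d × (∀ P → P ∈ Ps → Divides d P)
      commonModulus D D≢0 []              = D , D≢0 , ∣-refl , λ _ ()
      commonModulus D D≢0 (inj₁ P ∷ Ps) with commonModulus D D≢0 Ps
      ... | d , d≢0 , D∣d , all = d , d≢0 , D∣d , λ { _ (here refl) → tt ; P (there P∈) → all P P∈ }
      commonModulus D D≢0 (inj₂ (d′ , P) ∷ Ps) with commonModulus D D≢0 Ps
      ... | d , d≢0 , D∣d , all =
        d * d′ , m*n≢0 d d′ {{d≢0}} {{modSym-nonZero P}} , ∣-trans D∣d (m∣m*n d′) ,
        λ { _ (here refl) → n∣m*n d ; P (there P∈) → divides-∣ P (m∣m*n d′) (all P P∈) }

    module _ {d : ℕ} .{{_ : NonZero d}} (e : Fin d) where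

      private
        pair : Fin (n * d) → Fin n × Fin d
        pair = remQuot d

        letters : ℕ → Fin (n * d) → Bool
        letters a c = does (toℕ (proj₁ (pair c)) ≟ a)

        residues : (d′ : ℕ) → Fin d′ → Fin (n * d) → Bool
        residues d′ i c = does (d′ ∣? ∣ toℕ (proj₂ (pair c)) - toℕ i ∣)

        predᵗ : ∀ {m p} (P : Vocabulary.Sym (V ∪ⱽ numerical MOD)) →
                Vec (Fin m) (Vocabulary.arity (V ∪ⱽ numerical MOD) P) → Formula V m p
        predᵗ (inj₁ P)            xs       = pred P xs
        predᵗ (inj₂ (d′ , mod i)) (x ∷ []) = letterIn (residues d′ i) x
        predᵗ (inj₂ (d′ , len i)) []       = constant (does (d′ ∣? ∣ toℕ e - toℕ i ∣))

        predᵗ-basic : ∀ {m p} P xs → Basic (_∈ⱽ xs) (predᵗ {m} {p} P xs)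
        predᵗ-basic (inj₁ P)            xs       = pred-basic P xs
        predᵗ-basic (inj₂ (d′ , mod i)) (x ∷ []) = resp-basic ≡≐∈ (letterIn-basic (residues d′ i) x)
        predᵗ-basic (inj₂ (d′ , len i)) []       = constant-basic _

      -- Once the residue `e` of the length is fixed, a length predicate is a constant. A modulus
      -- dividing d makes a position predicate a property of the label at x.
      withoutMod : Translation (V ∪ⱽ numerical MOD) V
      withoutMod = record
        { letterᵗ = λ a → letterIn (letters a) ; letterᵗ-basic = λ a → letterIn-basic (letters a)
        ; predᵗ = predᵗ ; predᵗ-basic = predᵗ-basic
        }

      module _ (w : List (Fin n)) (e≡ : length w modulo d ≡ e) where

        same-length : length (map toℕ w) ≡ length (map toℕ (label {d} 0 w))
        same-length = trans (length-map toℕ w) (sym (trans (length-map toℕ (label {d} 0 w)) (length-label 0 w)))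

        private
          letterIn⇔ : (S : Fin (n * d) → Bool) → ∀ {m p} (x : Fin m) {ρ : Vec (Fin (length (map toℕ w))) m}
                      {ρ′ : Vec (Fin (length (map toℕ (label {d} 0 w)))) m} (X′ : Vec _ p) → Same¹ ρ ρ′ →
                      ∀ {c} → at w (toℕ (Vec.lookup ρ x)) ≡ just c →
                      T (S (combine c (toℕ (Vec.lookup ρ x) modulo d))) ⇔
                      Sat V (map toℕ (label {d} 0 w)) (letterIn S x) ρ′ X′
          letterIn⇔ S x {ρ} {ρ′} X′ r {c} e = ⇔-sym (letterIn-sat S x (label {d} 0 w) ρ′ X′
            (subst (λ y → at (label 0 w) y ≡ just (combine c (toℕ (Vec.lookup ρ x) modulo d))) (r .value x)
              (at-label 0 w _ e)))

          residues⇔ : ∀ {d′} → d′ ∣ d → (i : Fin d′) → ∀ {y : Fin d} m → toℕ y ≡ m % d →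
                      T (does (d′ ∣? ∣ m - toℕ i ∣)) ⇔ T (does (d′ ∣? ∣ toℕ y - toℕ i ∣))
          residues⇔ {d′} d′∣d i {y} m y≡ = T-does (d′ ∣? ∣ m - toℕ i ∣) ⇔∙
            ∣-∣-% {{_}} {{modSym-nonZero (mod i)}} d′∣d m (toℕ i) ⇔∙
            ≡⇒⇔ (cong (λ k → d′ ∣ ∣ k - toℕ i ∣) (sym y≡)) ⇔∙ ⇔-sym (T-does (d′ ∣? ∣ toℕ y - toℕ i ∣))

        withoutMod-correct : Correct withoutMod (map toℕ w) (map toℕ (label {d} 0 w)) same-length (Divides d)
        withoutMod-correct .letter-correct a x {ρ} S S′ r with lookup-map-toℕ w (Vec.lookup ρ x)
        ... | c , at≡ , l = ≡⇒⇔ (cong (_≡ a) l) ⇔∙ ⇔-sym (T-does (toℕ c ≟ a)) ⇔∙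
          ≡⇒⇔ (cong (λ z → T (does (toℕ (proj₁ z) ≟ a))) (sym (remQuot-combine {n} {d} c _))) ⇔∙
          letterIn⇔ (letters a) x S′ r at≡
        withoutMod-correct .pred-correct (inj₁ P) _ xs S S′ r = holds-same σ P same-length r xs
        withoutMod-correct .pred-correct (inj₂ (d′ , mod i)) d′∣d (x ∷ []) {ρ} S S′ r
          with lookup-map-toℕ w (Vec.lookup ρ x)
        ... | c , at≡ , l = residues⇔ d′∣d i {toℕ (Vec.lookup ρ x) modulo d} (toℕ (Vec.lookup ρ x)) (toℕ-mod _) ⇔∙
          ≡⇒⇔ (cong (λ z → T (does (d′ ∣? ∣ toℕ (proj₂ z) - toℕ i ∣))) (sym (remQuot-combine {n} {d} c _))) ⇔∙
          letterIn⇔ (residues d′ i) x S′ r at≡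
        withoutMod-correct .pred-correct (inj₂ (d′ , len i)) d′∣d [] S S′ r =
          residues⇔ d′∣d i {e} (length (map toℕ w))
            (trans (cong toℕ (sym e≡)) (trans (toℕ-mod (length w)) (cong (_% d) (sym (length-map toℕ w))))) ⇔∙
          ⇔-sym (constant-sat {V} (does (d′ ∣? ∣ toℕ e - toℕ i ∣)) {S = S′})

    -- Each residue of the length gives a sentence of `F` over labelled words. One monoid recognizes
    -- all of these languages, and the residue selects the acceptance set.
    mod-definable⇒recognized : ∀ D → NonZero D → Definable (F [ numerical MOD ]) L →
                               ∃[ d ] D ∣ d × Σ[ d≢0 ∈ NonZero d ] ModRecognized 𝐕 d {{d≢0}} L
    mod-definable⇒recognized D D≢0 (φ , f , correct) with commonModulus D D≢0 (symbols φ)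
    ... | d , d≢0 , D∣d , moduli∣d = d , D∣d , d≢0 , record
      { M = J.M ; M∈𝐕 = J.M∈𝐕 ; h = λ i a → J.η (combine a i ∷ []) ; accept = J.accept ; accept-cong = J.accept-cong
      ; correct = λ w → correct w ⇔∙
          translate-sat (withoutMod (length w modulo d)) _ _ (same-length _ w refl) (Divides d) (withoutMod-correct _ w refl) φ moduli∣d same-[] same²-[] ⇔∙
          J.correct (length w modulo d) (label 0 w) ⇔∙
          ≡⇒⇔ (cong T (J.accept-cong _ (Monoid.sym J.M (eval-label J.M J.η J.η-hom 0 w))))
      }
      where
      instance _ = d≢0
      module J = JointlyRecognized (definable⇒jointlyRecognized (λ (e : Fin d) v → v ⊨ translate (withoutMod e) φ)
                   (λ e → translate (withoutMod e) φ , eliminate (withoutMod e) f , λ _ → ⇔-refl))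

  private
    toMOD : ∀ d → Translation (V ∪ⱽ numerical (MOD^ d)) (V ∪ⱽ numerical MOD)
    toMOD d = record
      { letterᵗ = letter ; letterᵗ-basic = letter-basic
      ; predᵗ = λ { (inj₁ P) → pred (inj₁ P) ; (inj₂ P) → pred (inj₂ (d , P)) }
      ; predᵗ-basic = λ { (inj₁ P) → pred-basic (inj₁ P) ; (inj₂ P) → pred-basic (inj₂ (d , P)) }
      }

    toMOD-correct : ∀ d w → Correct (toMOD d) w w refl (λ _ → ⊤)
    toMOD-correct d w .letter-correct a x S S′ r = ≡⇒⇔ (cong (λ y → lookup w y ≡ a) (toℕ-injective (r .value x)))
    toMOD-correct d w .pred-correct (inj₁ P) _ xs S S′ r = holds-same σ P refl r xs
    toMOD-correct d w .pred-correct (inj₂ P) _ xs S S′ r = holds-same (MOD^ d) P refl r xs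

  MOD^-definable⇒MOD-definable : ∀ d {n} {L : Language n} →
    Definable (F [ numerical (MOD^ d) ]) L → Definable (F [ numerical MOD ]) L
  MOD^-definable⇒MOD-definable d (φ , f , correct) =
    translate (toMOD d) φ ,
    translate-enriched step (toMOD d) (λ {φ} g → closed-⇝* step (base g) (subst₂ _⇝*_
      (sym (embed≡translate {W = numerical MOD} φ)) (sym (translate-embed {W = numerical (MOD^ d)} (toMOD d) φ))
      (translations-⇝* embedᵗ (restrictᵗ {W = numerical (MOD^ d)} (toMOD d)) φ))) f ,
    λ w → correct w ⇔∙ translate-sat (toMOD d) _ _ refl (λ _ → ⊤) (toMOD-correct d (map toℕ w)) φ (λ _ _ →
        tt) same-[] same²-[]

  -- The guards distinguish the residues of the length. A labelled letter is expressed by its letter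
  -- together with the modular predicate for its label.
  recognized⇒MOD^-definable : ∀ d .{{_ : NonZero d}} {n} {L : Language n} → ModRecognized 𝐕 d L →
                              Definable (F [ numerical (MOD^ d) ]) L
  recognized⇒MOD^-definable d {n} {L} R = guarded-definable letterᵗ letterᵗ-basic
    L (λ e v → T (R.accept e (extension R.M f v)))
    (λ e → recognized⇒definable R.M R.M∈𝐕 f (R.accept e) (R.accept-cong e) (λ _ → ⇔-refl))
    (allFin d) (λ e → pred (inj₂ (len e)) []) (λ e → pred _ _)
    (label 0) (length-label 0) letters
    (λ w e g → R.correct w ⇔∙ ≡⇒⇔ (cong₂ (λ e m → T (R.accept e m)) (guard⇒ w e g)
        (sym (extension-label R.M R.h 0 w))))
    (λ w → length w modulo d , ∈-allFin _ , guard⇐ w)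
    where
    module R = ModRecognized R
    f : Fin (n * d) → Monoid.Carrier R.M
    f c = R.h (proj₂ (remQuot {n} d c)) (proj₁ (remQuot {n} d c))

    W = numerical (MOD^ d)

    guard⇔ : ∀ w (e : Fin d) → T (modHolds (len e) (length (map toℕ w)) []) ⇔ (length w % d ≡ toℕ e % d)
    guard⇔ w e rewrite length-map (toℕ {n}) w = T-does (d ∣? ∣ length w - toℕ e ∣) ⇔∙ ∣∣-∣⇔% (length w) (toℕ e)

    guard⇒ : ∀ w (e : Fin d) → T (modHolds (len e) (length (map (toℕ {n}) w)) []) → length w modulo d ≡ e
    guard⇒ w e g = toℕ-injective (trans (toℕ-mod (length w)) (trans (to (guard⇔ w e) g) (toℕ-% e)))

    guard⇐ : ∀ w → T (modHolds (len (length w modulo d)) (length (map (toℕ {n}) w)) [])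
    guard⇐ w = from (guard⇔ w (length w modulo d)) (sym (toℕ-mod-% (length w)))

    letterᵗ : ∀ {m p} → ℕ → Fin m → Formula (V ∪ⱽ W) m p
    letterᵗ c x with c <? n * d
    ... | yes c< = let a , i = remQuot {n} d (fromℕ< c<) in letter (toℕ a) x ∧ᶠ pred (inj₂ (mod i)) (x ∷ [])
    -- Numbers from n * d on code no labelled letter.
    ... | no _   = false¹ x

    letterᵗ-basic : ∀ {m p} c x → Basic (_≡ x) (letterᵗ {m} {p} c x)
    letterᵗ-basic c x with c <? n * d
    ... | yes c< = ∧-basic (letter-basic _ x) (resp-basic (proj₂ ≡≐∈ , proj₁ ≡≐∈) (pred-basic _ _))
    ... | no _   = false¹-basic x

    letters : ∀ w {m p} a (x : Fin m) {ρ ρ′} (S : Vec _ p) S′ → Same¹ ρ ρ′ →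
      Sat V (map toℕ (label {d} 0 w)) (letter a x) ρ S ⇔ Sat (V ∪ⱽ W) (map toℕ w) (letterᵗ a x) ρ′ S′
    letters w c x {ρ} {ρ′} S S′ r with lookup-map-toℕ w (Vec.lookup ρ′ x) | lookup-map-toℕ (label {d} 0 w) (Vec.lookup ρ x)
    ... | a , at≡ , l | b , at≡′ , l₀ with just-injective (trans (sym at≡′)
            (trans (cong (at (label 0 w)) (r .value x)) (at-label 0 w _ at≡)))
    ... | b≡ with c <? n * d
    ... | no c≮ = mk⇔ (λ e → contradiction (subst (_< n * d) (trans (sym l₀) e) (toℕ<n b)) c≮)
                      (λ (p , ¬p) → contradiction p ¬p)
    ... | yes c< = mk⇔ ⇒ ⇐
      where
      y = toℕ (Vec.lookup ρ′ x)
      l′ = trans l₀ (cong toℕ b≡)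
      a′ = proj₁ (remQuot {n} d (fromℕ< c<))
      i′ = proj₂ (remQuot {n} d (fromℕ< c<))

      ⇒ : lookup (map toℕ (label {d} 0 w)) (Vec.lookup ρ x) ≡ c →
          (lookup (map toℕ w) (Vec.lookup ρ′ x) ≡ toℕ a′) × T (does (d ∣? ∣ y - toℕ i′ ∣))
      ⇒ e with trans (cong (remQuot {n} d) (toℕ-injective (trans (toℕ-fromℕ< c<) (trans
          (sym e) l′)))) (remQuot-combine {n} a _)
      ... | q = trans l (cong (toℕ ∘ proj₁) (sym q))
              , from (T-does (d ∣? _)) (from (∣∣-∣⇔% y (toℕ i′))
                  (sym (trans (cong (λ z → toℕ (proj₂ z) % d) q) (toℕ-mod-% y))))

      ⇐ : (lookup (map toℕ w) (Vec.lookup ρ′ x) ≡ toℕ a′) × T (does (d ∣? ∣ y - toℕ i′ ∣)) →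
          lookup (map toℕ (label {d} 0 w)) (Vec.lookup ρ x) ≡ c
      ⇐ (e , t) = trans l′ (trans (cong toℕ (trans (cong₂ combine a≡ i≡) (combine-remQuot {n} d (fromℕ< c<))))
          (toℕ-fromℕ< c<))
        where
        open import Data.Fin.Properties using (combine-remQuot)
        a≡ : a ≡ a′
        a≡ = toℕ-injective (trans (sym l) e)
        i≡ : y modulo d ≡ i′
        i≡ = toℕ-injective (trans (toℕ-mod y) (trans (to (∣∣-∣⇔% y (toℕ i′)) (to (T-does (d ∣? _)) t)) (toℕ-% i′)))

-- Finiteness by enumeration and by short representatives

module _ (S : Setoid 0ℓ 0ℓ) where
  open Setoid S using (Carrier; _≈_)
    renaming (refl to ≈-refl; sym to ≈-sym; trans to ≈-trans; isEquivalence to ≈-isEquivalence)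
  open SetoidMembership S using () renaming (_∈_ to _∈ₛ_)
  open SetoidUnique S using (Unique)

  private
    unique-index : ∀ {x xs} → Unique xs → (p : x ∈ₛ xs) (i : Fin (length xs)) → x ≈ lookup xs i → Any.index p ≡ i
    unique-index (y≉ ∷ u) (here p)  zero    e = refl
    unique-index (y≉ ∷ u) (there p) (suc i) e = cong suc (unique-index u p i e)
    unique-index (y≉ ∷ u) (here p)  (suc i) e = contradiction (≈-trans (≈-sym p) e) (All.lookup y≉ (∈-lookup i))
    unique-index (y≉ ∷ u) (there p) zero    e =
      let (y≉z , x≈z) = All.lookupAny y≉ p in contradiction (≈-trans (≈-sym e) x≈z) y≉z

  -- After removal of duplicates, the index of the entry equivalent to x is unique and serves as the
  -- bijection.
  enumerated⇒finite : Decidable₂ _≈_ → ∀ {xs} → IsEnumeration S xs → FiniteSetoid S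
  enumerated⇒finite _≟ₛ_ {xs} enumerates = record
    { card = length ys
    ; enum = record
      { to        = λ x → Any.index (ys-enumerates x)
      ; from      = lookup ys
      ; to-cong   = λ {x} {y} x≈y → unique-index ys-unique _ _ (≈-trans x≈y (Any.lookup-index (ys-enumerates y)))
      ; from-cong = λ { refl → ≈-refl }
      ; inverse   = (λ {i} {x} e → unique-index ys-unique _ i e)
                  , (λ { {x} refl → ≈-sym (Any.lookup-index (ys-enumerates x)) })
      }
    }
    where
    S? : DecSetoid 0ℓ 0ℓ
    S? = record { isDecEquivalence = record { isEquivalence = ≈-isEquivalence ; _≟_ = _≟ₛ_ } }
    ys = deduplicate _≟ₛ_ xs
    ys-enumerates = deduplicate⁺ S? enumerates
    ys-unique = deduplicate-! S? xs

module _ {A : Set} {P : A → Set} (P? : Decidable P) where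

  witnesses : List A → List (Σ A P)
  witnesses []       = []
  witnesses (x ∷ xs) with P? x
  ... | yes p = (x , p) ∷ witnesses xs
  ... | no _  = witnesses xs

  ∈-witnesses : ∀ {x xs} → x ∈ xs → P x → ∃[ p ] (x , p) ∈ witnesses xs
  ∈-witnesses {x} {y ∷ ys} x∈ p with P? y
  ∈-witnesses (here refl) p | yes p′ = p′ , here refl
  ∈-witnesses (there x∈)  p | yes _  = let q , i = ∈-witnesses x∈ p in q , there i
  ∈-witnesses (here refl) p | no ¬p  = contradiction p ¬p
  ∈-witnesses (there x∈)  p | no _   = ∈-witnesses x∈ p

module _ {n : ℕ} where

  words≤ : ℕ → List (List (Fin n))
  words≤ zero    = [] ∷ []
  words≤ (suc m) = [] ∷ cartesianProductWith _∷_ (allFin n) (words≤ m)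

  ∈-words≤ : ∀ {m} w → length w ≤ m → w ∈ words≤ m
  ∈-words≤ {zero}  []      _       = here refl
  ∈-words≤ {suc m} []      _       = here refl
  ∈-words≤ {suc m} (a ∷ w) (s≤s l) = there (∈-cartesianProductWith⁺ _∷_ (∈-allFin a) (∈-words≤ w l))

  RightInvariant : ∀ {N} → (List (Fin n) → Fin N) → Set
  RightInvariant f = ∀ u v → f u ≡ f v → ∀ w → f (u ++ w) ≡ f (v ++ w)

  module _ {N : ℕ} (f : List (Fin n) → Fin N) (f-right : RightInvariant f) where

    -- A longer word has two prefixes with the same value; cut out what is between them.
    short : ∀ u → ∃[ v ] v ∈ words≤ N × f v ≡ f u
    short u = go u (<-wellFounded (length u))
      where
      go : ∀ u → Acc _<_ (length u) → ∃[ v ] v ∈ words≤ N × f v ≡ f u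
      go u (acc rec) with length u ≤? N
      ... | yes l = u , ∈-words≤ u l , refl
      ... | no ¬l with pigeonhole (n<1+n N) (λ i → f (take (toℕ i) u))
      ... | i , j , i<j , e = let v , v∈ , q = go u′ (rec shorter) in v , v∈ , trans q same-value
        where
        u′ = take (toℕ i) u ++ drop (toℕ j) u
        j≤ : toℕ j ≤ length u
        j≤ = ≤-trans (s≤s⁻¹ (toℕ<n j)) (<⇒≤ (≰⇒> ¬l))
        same-value : f u′ ≡ f u
        same-value = trans (f-right (take (toℕ i) u) (take (toℕ j) u) e (drop (toℕ j) u)) (cong f (take++drop≡id
            (toℕ j) u))
        shorter : length u′ < length u
        shorter = subst₂ _<_
          (sym (trans (length-++ (take (toℕ i) u)) (cong₂ _+_
            (trans (length-take (toℕ i) u) (m≤n⇒m⊓n≡m (≤-trans (<⇒≤ i<j) j≤))) (length-drop (toℕ j) u))))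
          (m+[n∸m]≡n j≤)
          (+-monoˡ-< (length u ∸ toℕ j) i<j)

funToFin-cong : ∀ {m n} {f g : Fin m → Fin n} → (∀ i → f i ≡ g i) → funToFin f ≡ funToFin g
funToFin-cong {zero}  e = refl
funToFin-cong {suc m} e = cong₂ combine (e zero) (funToFin-cong (e ∘ suc))

funToFin-injective : ∀ {m n} {f g : Fin m → Fin n} → funToFin f ≡ funToFin g → ∀ i → f i ≡ g i
funToFin-injective {f = f} {g} e i =
  trans (sym (finToFun-funToFin f i)) (trans (cong (λ c → finToFun c i) e) (finToFun-funToFin g i))

-- The transition monoid of an automaton

module Automaton {n : ℕ} {L : Language n} (D : DFA n) (L⇔D : ∀ w → L w ⇔ DFA.Accepts D w) where
  open DFA D

  tables : ℕ
  tables = states ^ states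

  table : List (Fin n) → Fin tables
  table u = funToFin (λ q → foldl δ q u)

  table-++ : ∀ u u′ v v′ → table u ≡ table u′ → table v ≡ table v′ → table (u ++ v) ≡ table (u′ ++ v′)
  table-++ u u′ v v′ p q = funToFin-cong λ i → trans (foldl-++ δ i u v)
    (trans (cong (λ j → foldl δ j v) (funToFin-injective p i))
    (trans (funToFin-injective q (foldl δ i u′)) (sym (foldl-++ δ i u′ v′))))

  table-right : RightInvariant table
  table-right u v e w = table-++ u v w w e refl

  table⇒L : ∀ {u v} → table u ≡ table v → L u ⇔ L v
  table⇒L {u} {v} e = L⇔D u ⇔∙ ≡⇒⇔ (cong (T ∘ final) (funToFin-injective e start)) ⇔∙ ⇔-sym (L⇔D v)

  table⇒syntactic : ∀ {u v} → table u ≡ table v → SyntacticCongruence L u v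
  table⇒syntactic {u} {v} e x y = table⇒L (table-++ x x _ _ refl (table-++ u v y y e refl))

  L? : Decidable L
  L? w = map′ (from (L⇔D w)) (to (L⇔D w)) (T? _)

  -- A context acts only through the tables of its two halves, so contexts made of short words
  -- suffice.
  syntactic? : Decidable₂ (SyntacticCongruence L)
  syntactic? u v = map′ ⇒ ⇐ (All.all? (λ x → All.all? (λ y → dec x y) shortWords) shortWords)
    where
    shortWords = words≤ tables
    Same : List (Fin n) → List (Fin n) → Set
    Same x y = (L (x ++ u ++ y) → L (x ++ v ++ y)) × (L (x ++ v ++ y) → L (x ++ u ++ y))
    dec : ∀ x y → Dec (Same x y)
    dec x y = (L? _ →-dec L? _) ×-dec (L? _ →-dec L? _)
    ⇐ : SyntacticCongruence L u v → All (λ x → All (Same x) shortWords) shortWords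
    ⇐ s = All.tabulate (λ {x} _ → All.tabulate (λ {y} _ → to (s x y) , from (s x y)))
    ⇒ : All (λ x → All (Same x) shortWords) shortWords → SyntacticCongruence L u v
    ⇒ a x y with short table table-right x | short table table-right y
    ... | x′ , x∈ , p | y′ , y∈ , q =
      move u ⇔∙ mk⇔ (proj₁ s) (proj₂ s) ⇔∙ ⇔-sym (move v)
      where
      s = All.lookup (All.lookup a x∈) y∈
      move : ∀ w → L (x ++ w ++ y) ⇔ L (x′ ++ w ++ y′)
      move w = table⇒L (table-++ x x′ _ _ (sym p) (table-++ w w y y′ refl (sym q)))

  private
    _⊑_ : ℕ → ℕ → Set
    i ⊑ j = ∀ u → length u ≡ i → ∃[ v ] length v ≡ j × table v ≡ table u

    occurs? : ∀ i c → Dec (∃[ u ] length u ≡ i × table u ≡ c)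
    occurs? i c = map′ (λ p → let u , _ , q = find p in u , q)
      (λ (u , l , e) → lose (∈-words≤ u (≤-reflexive l)) (l , e))
      (Any.any? (λ u → (length u ≟ i) ×-dec (table u ≟ᶠ c)) (words≤ i))

    bit : ∀ {A : Set} → Dec A → Fin 2
    bit (yes _) = suc zero
    bit (no _)  = zero

    bit⇒ : ∀ {A B : Set} (a : Dec A) (b : Dec B) → bit a ≡ bit b → A → B
    bit⇒ (yes _) (yes b) e a = b
    bit⇒ (no ¬a) b       e a = contradiction a ¬a

    -- The set of tables of the words of length i, coded by its characteristic function so that the
    -- pigeonhole principle applies to it.
    values : ℕ → Fin (2 ^ tables)
    values i = funToFin (λ c → bit (occurs? i c))

    values⇒⊑ : ∀ {i j} → values i ≡ values j → i ⊑ j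
    values⇒⊑ {i} {j} e u l = bit⇒ (occurs? i (table u)) (occurs? j (table u)) (funToFin-injective e (table u)) (u , l , refl)

    ⊑-trans : ∀ {i j k} → i ⊑ j → j ⊑ k → i ⊑ k
    ⊑-trans p q u l with p u l
    ... | v , l′ , e with q v l′
    ... | w , l″ , e′ = w , l″ , trans e′ e

    ⊑-+ : ∀ {i j} m → i ⊑ j → (i + m) ⊑ (j + m)
    ⊑-+ {i} {j} m p u l with p (take i u) (trans (length-take i u) (m≤n⇒m⊓n≡m (subst (i ≤_) (sym l) (m≤m+n i m))))
    ... | v , l′ , e = v ++ drop i u
        , trans (length-++ v) (cong₂ _+_ l′ (trans (length-drop i u) (trans (cong (_∸ i) l) (m+n∸m≡n i m))))
        , trans (table-right v (take i u) e (drop i u)) (cong table (take++drop≡id i u))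

    ⊑-period : ∀ i p → i ⊑ (i + p) → ∀ m → i ≤ m → m ⊑ (m + p)
    ⊑-period i p r m i≤m = subst₂ _⊑_ (m+[n∸m]≡n i≤m)
      (trans (+-assoc i p _) (trans (cong (i +_) (+-comm p _)) (trans (sym (+-assoc i _ p))
          (cong (_+ p) (m+[n∸m]≡n i≤m)))))
      (⊑-+ (m ∸ i) r)

    ⊒-period : ∀ i p → (i + p) ⊑ i → ∀ m → i ≤ m → (m + p) ⊑ m
    ⊒-period i p r m i≤m = subst₂ _⊑_
      (trans (+-assoc i p _) (trans (cong (i +_) (+-comm p _)) (trans (sym (+-assoc i _ p))
          (cong (_+ p) (m+[n∸m]≡n i≤m)))))
      (m+[n∸m]≡n i≤m)
      (⊑-+ (m ∸ i) r)

    ⊑-multiple : ∀ i p → i ⊑ (i + p) → ∀ q m → i ≤ m → m ⊑ (m + q * p)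
    ⊑-multiple i p r zero    m i≤m u l = u , trans l (sym (+-identityʳ m)) , refl
    ⊑-multiple i p r (suc q) m i≤m = subst (m ⊑_) (+-assoc m p (q * p))
      (⊑-trans (⊑-period i p r m i≤m) (⊑-multiple i p r q (m + p) (≤-trans i≤m (m≤m+n m p))))

    ⊒-multiple : ∀ i p → (i + p) ⊑ i → ∀ q m → i ≤ m → (m + q * p) ⊑ m
    ⊒-multiple i p r zero    m i≤m u l = u , trans l (+-identityʳ m) , refl
    ⊒-multiple i p r (suc q) m i≤m = subst (_⊑ m) (+-assoc m p (q * p))
      (⊑-trans (⊒-multiple i p r q (m + p) (≤-trans i≤m (m≤m+n m p))) (⊒-period i p r m i≤m))

  -- Two lengths i < j realize the same set of tables. Appending letters propagates this, so these
  -- sets have period p = j - i from i on. As s is a multiple of p and at least i, the lengths s and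
  -- 2s realize the same tables, hence the same syntactic classes.
  stable : ∃[ s ] IsStable L s
  stable with pigeonhole (n<1+n (2 ^ tables)) (λ i → values (toℕ i))
  ... | i , j , i<j , e = s , s≥1 ,
        (λ (u , l , u~) → transfer up (u , l , u~)) , (λ (u , l , u~) → transfer down (u , l , u~))
    where
    p = toℕ j ∸ toℕ i
    1≤p : 1 ≤ p
    1≤p = m<n⇒0<n∸m i<j
    -- The factor i + 1 instead of i keeps s positive when i is 0.
    s = suc (toℕ i) * p
    i+p : toℕ i + p ≡ toℕ j
    i+p = m+[n∸m]≡n (<⇒≤ i<j)
    suc-i≤s : suc (toℕ i) ≤ s
    suc-i≤s = m≤m*n (suc (toℕ i)) p {{>-nonZero 1≤p}}
    s≥1 : 1 ≤ s
    s≥1 = ≤-trans (s≤s z≤n) suc-i≤s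
    s+s : s + s ≡ 2 * s
    s+s = cong (s +_) (sym (+-identityʳ s))
    up : s ⊑ (2 * s)
    up = subst (s ⊑_) s+s (⊑-multiple (toℕ i) p (subst (toℕ i ⊑_) (sym i+p) (values⇒⊑ e)) (suc
        (toℕ i)) s (≤-trans (<⇒≤ (n<1+n _)) suc-i≤s))
    down : (2 * s) ⊑ s
    down = subst (_⊑ s) s+s (⊒-multiple (toℕ i) p (subst (_⊑ toℕ i) (sym i+p) (values⇒⊑ (sym e))) (suc
        (toℕ i)) s (≤-trans (<⇒≤ (n<1+n _)) suc-i≤s))
    open Monoid (syntacticMonoid L) using () renaming (trans to ≈-trans)
    transfer : ∀ {a b m} → a ⊑ b → imageOfLength L a m → imageOfLength L b m
    transfer {m = m} r (u , l , u~m) with r u l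
    ... | v , l′ , e′ = v , l′ , ≈-trans {v} {u} {m} (table⇒syntactic {v} {u} e′) u~m

-- The category of words between residues modulo d, and its division

%-shift : ∀ {d} .{{_ : NonZero d}} a b → (toℕ (a modulo d) + b) % d ≡ (a + b) % d
%-shift {d} a b = %-+-cong {d} {toℕ (a modulo d)} {a} {b} {b} (toℕ-mod-% a) refl

modulo-shift : ∀ {d} .{{_ : NonZero d}} a b → (toℕ (a modulo d) + b) modulo d ≡ (a + b) modulo d
modulo-shift {d} a b = from (mod⇔% (toℕ (a modulo d) + b) (a + b)) (%-shift {d} a b)

module _ {n : ℕ} (L : Language n) (d : ℕ) .{{_ : NonZero d}} where

  private module L = Monoid (syntacticMonoid L)

  _⟶_ : Fin d → Fin d → Set
  i ⟶ j = Σ[ u ∈ List (Fin n) ] (toℕ i + length u) modulo d ≡ j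

  compose : ∀ {i j k} → i ⟶ j → j ⟶ k → i ⟶ k
  compose {i} (u , p) (v , q) = u ++ v , trans
    (cong (_modulo d) (trans (cong (toℕ i +_) (length-++ u)) (sym (+-assoc (toℕ i) (length u) (length v)))))
    (trans (sym (modulo-shift (toℕ i + length u) (length v)))
    (trans (cong (λ j → (toℕ j + length v) modulo d) p) q))

  wordCategory : Category
  wordCategory = record
    { Obj           = Fin d
    ; _⇒_           = _⟶_
    ; _≈_           = λ (u , _) (v , _) → u L.≈ v
    ; isEquivalence = record
      { refl  = λ {x} → L.refl {proj₁ x}
      ; sym   = λ {x} {y} → L.sym {proj₁ x} {proj₁ y}
      ; trans = λ {x} {y} {z} → L.trans {proj₁ x} {proj₁ y} {proj₁ z}
      }
    ; 1#            = λ i → [] , trans (cong (_modulo d) (+-identityʳ (toℕ i))) (toℕ-mod-id i)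
    ; _∙_           = compose
    ; ∙-cong        = λ { {x = u , _} {u′ , _} {v , _} {v′ , _} → L.∙-cong {u} {u′} {v} {v′} }
    ; assoc         = λ (u , _) (v , _) (w , _) → L.assoc u v w
    ; identityˡ     = λ (u , _) → L.identityˡ u
    ; identityʳ     = λ (u , _) → L.identityʳ u
    }

  module _ (D : DFA n) (L⇔D : ∀ w → L w ⇔ DFA.Accepts D w) where
    open Automaton D L⇔D

    tableMod : List (Fin n) → Fin (tables * d)
    tableMod u = combine (table u) (length u modulo d)

    tableMod⇒ : ∀ {u v} → tableMod u ≡ tableMod v → table u ≡ table v × length u modulo d ≡ length v modulo d
    tableMod⇒ {u} {v} e = combine-injective (table u) (length u modulo d) (table v) (length v modulo d) e

    modulo-length-++ : ∀ (u v w : List (Fin n)) → length u modulo d ≡ length v modulo d →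
        length (u ++ w) modulo d ≡ length (v ++ w) modulo d
    modulo-length-++ u v w e = begin
      length (u ++ w) modulo d                         ≡⟨ cong (_modulo d) (length-++ u) ⟩
      (length u + length w) modulo d                   ≡⟨ sym (modulo-shift (length u) (length w)) ⟩
      (toℕ (length u modulo d) + length w) modulo d    ≡⟨ cong (λ i → (toℕ i + length w) modulo d) e ⟩
      (toℕ (length v modulo d) + length w) modulo d    ≡⟨ modulo-shift (length v) (length w) ⟩
      (length v + length w) modulo d                   ≡⟨ cong (_modulo d) (sym (length-++ v)) ⟩
      length (v ++ w) modulo d                         ∎
      where open ≡-Reasoning

    tableMod-right : RightInvariant tableMod
    tableMod-right u v e w with tableMod⇒ {u} {v} e
    ... | p , q = cong₂ combine (table-right u v p w) (modulo-length-++ u v w q)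

    -- A short word with the same `tableMod` has the same syntactic class and the same length modulo
    -- d, so it represents the arrow between the same residues.
    wordFiniteCategory : FiniteCategory
    wordFiniteCategory = record
      { category = wordCategory ; objects = d ; enumObj = ↔-id (Fin d)
      ; finiteHom = λ i j → enumerated⇒finite (Category.hom wordCategory i j)
          (λ x y → syntactic? (proj₁ x) (proj₁ y)) (enumerates i j)
      }
      where
      between? : ∀ i j u → Dec ((toℕ i + length u) modulo d ≡ j)
      between? i j u = (toℕ i + length u) modulo d ≟ᶠ j
      enumerates : ∀ i j → IsEnumeration (Category.hom wordCategory i j) (witnesses (between? i j) (words≤ (tables * d)))
      enumerates i j (u , p) with short tableMod tableMod-right u
      ... | v , v∈ , e with tableMod⇒ {v} {u} e
      ... | table≡ , length≡ with ∈-witnesses (between? i j) v∈ (trans (shift v) (trans (cong (λ l →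
          (toℕ l + toℕ i) modulo d) length≡) (trans (sym (shift u)) p)))
        where
        shift : ∀ w → (toℕ i + length w) modulo d ≡ (toℕ (length w modulo d) + toℕ i) modulo d
        shift w = trans (cong (_modulo d) (+-comm (toℕ i) (length w))) (sym (modulo-shift (length w) (toℕ i)))
      ... | q , vq∈ = lose vq∈ (table⇒syntactic {u} {v} (sym table≡))

-- Finite products of monoids

module _ (N : Monoid 0ℓ 0ℓ) where

  -- The empty product is `N` instead of the trivial monoid, so that closure of 𝐕 under binary
  -- products is enough for membership.
  ⨅ : ∀ c → (Fin c → Monoid 0ℓ 0ℓ) → Monoid 0ℓ 0ℓ
  ⨅ zero    Ms = N
  ⨅ (suc c) Ms = Ms zero ×ᴹ ⨅ c (Ms ∘ suc)

  tuple : ∀ {c} Ms → (∀ e → Monoid.Carrier (Ms e)) → Monoid.Carrier (⨅ c Ms)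
  tuple {zero}  Ms g = Monoid.ε N
  tuple {suc c} Ms g = g zero , tuple (Ms ∘ suc) (g ∘ suc)

  tuple-cong : ∀ {c} Ms {g h : ∀ e → Monoid.Carrier (Ms e)} → (∀ e → Monoid._≈_ (Ms e) (g e) (h e)) →
               Monoid._≈_ (⨅ c Ms) (tuple Ms g) (tuple Ms h)
  tuple-cong {zero}  Ms e = Monoid.refl N
  tuple-cong {suc c} Ms e = e zero , tuple-cong (Ms ∘ suc) (e ∘ suc)

  tuple-injective : ∀ {c} Ms {g h : ∀ e → Monoid.Carrier (Ms e)} → Monoid._≈_ (⨅ c Ms) (tuple Ms g) (tuple Ms h) →
                    ∀ e → Monoid._≈_ (Ms e) (g e) (h e)
  tuple-injective {suc c} Ms (p , q) zero    = p
  tuple-injective {suc c} Ms (p , q) (suc e) = tuple-injective (Ms ∘ suc) q e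

  tuple-∙ : ∀ {c} Ms {g h : ∀ e → Monoid.Carrier (Ms e)} → Monoid._≈_ (⨅ c Ms)
            (tuple Ms (λ e → Monoid._∙_ (Ms e) (g e) (h e))) (Monoid._∙_ (⨅ c Ms) (tuple Ms g) (tuple Ms h))
  tuple-∙ {zero}  Ms = Monoid.sym N (Monoid.identityˡ N _)
  tuple-∙ {suc c} Ms = Monoid.refl (Ms zero) , tuple-∙ (Ms ∘ suc)

  tuple-ε : ∀ {c} Ms → Monoid._≈_ (⨅ c Ms) (tuple Ms (λ e → Monoid.ε (Ms e))) (Monoid.ε (⨅ c Ms))
  tuple-ε {zero}  Ms = Monoid.refl N
  tuple-ε {suc c} Ms = Monoid.refl (Ms zero) , tuple-ε (Ms ∘ suc)

  ⨅∈ : ∀ {ℓ} {𝐕 : Pred (Monoid 0ℓ 0ℓ) ℓ} → IsVariety 𝐕 → 𝐕 N → ∀ {c} Ms → (∀ e → 𝐕 (Ms e)) → 𝐕 (⨅ c Ms)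
  ⨅∈ var N∈ {zero}  Ms Ms∈ = N∈
  ⨅∈ var N∈ {suc c} Ms Ms∈ = IsVariety.product var (Ms∈ zero) (⨅∈ var N∈ (Ms ∘ suc) (Ms∈ ∘ suc))

-- Recognition of labelled words as division of the word category

module _ {ℓ : Level} {𝐕 : Pred (Monoid 0ℓ 0ℓ) ℓ} (isVariety : IsVariety 𝐕)
         {n : ℕ} {L : Language n} (D : DFA n) (L⇔D : ∀ w → L w ⇔ DFA.Accepts D w)
         (d : ℕ) .{{_ : NonZero d}} where

  open Automaton D L⇔D
  private module L = Monoid (syntacticMonoid L)

  -- An arrow i ⟶ j is related to the tuple of the values of its words for all
  -- labellings: the labels i + c for every c ∈ Fin d, since a context of the
  -- word may have any length.

  recognized⇒divides : ModRecognized 𝐕 d L → 𝐠 𝐕 (wordFiniteCategory L d D L⇔D)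
  recognized⇒divides R = P , ⨅∈ R.M isVariety R.M∈𝐕 {d} Ms (λ _ → R.M∈𝐕) , record
    { τ₀       = λ _ → tt
    ; τ        = τ
    ; τ-resp-≈ = λ { {x = u , _} {v , _} u~v z≈t (w , p , w~u , z≈) →
        w , p , L.trans {w} {u} {v} w~u u~v , P.trans (P.sym z≈t) z≈ }
    ; product  = λ {_} {_} {_} {x} {y} → product {x = x} {y}
    ; nonempty = λ (u , p) → _ , u , p , L.refl {u} , P.refl
    ; unit     = λ i → [] , trans (cong (_modulo d) (+-identityʳ (toℕ i)))
        (toℕ-mod-id i) , L.refl {[]} , P.sym (tuple-ε R.M {d} Ms)
    ; disjoint = λ { {x = u , _} {v , _} u≁v ((u′ , p , u′~u , z≈) , (v′ , q , v′~v , z≈′)) →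
        u≁v (L.trans {u} {u′} {v} (L.sym {u′} {u} u′~u) (L.trans {u′} {v′} {v} (separate p q (P.trans (P.sym z≈) z≈′)) v′~v)) }
    }
    where
    module R = ModRecognized R
    module M = Monoid R.M
    Ms : Fin d → Monoid 0ℓ 0ℓ
    Ms _ = R.M
    P = ⨅ R.M d Ms
    module P = Monoid P

    ev : ℕ → List (Fin n) → M.Carrier
    ev = eval R.M R.h

    values : Fin d → List (Fin n) → P.Carrier
    values i u = tuple R.M Ms (λ c → ev (toℕ c + toℕ i) u)

    -- An arrow is a syntactic class, and congruent words may have different values; τ therefore
    -- collects the values of all representatives with the same ends.
    τ : ∀ {i j} → _⟶_ L d i j → P.Carrier → Set
    τ {i} {j} (u , _) z = Σ[ v ∈ List (Fin n) ] (toℕ i + length v) modulo d ≡ j × v L.≈ u × z P.≈ values i v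

    product : ∀ {i j k} {x : _⟶_ L d i j} {y : _⟶_ L d j k} {z t} → τ x z → τ y t → τ (compose L d x y) (z P.∙ t)
    product {i} {x = u , refl} {v , _} (u′ , p , u′~u , z≈) (v′ , q , v′~v , t≈) =
      u′ ++ v′ , proj₂ (compose L d {i} (u′ , p) (v′ , q)) , L.∙-cong {u′} {u} {v′} {v} u′~u v′~v ,
      P.trans (P.∙-cong z≈ t≈) (P.trans (P.sym (tuple-∙ R.M Ms)) (tuple-cong R.M Ms λ c → M.sym
        (M.trans (eval-++ R.M R.h (toℕ c + toℕ i) u′ v′) (M.∙-cong M.refl (M.reflexive
            (eval-mod R.M R.h (same-label c) v′))))))
      where
      same-label : ∀ (c : Fin d) → (toℕ c + toℕ i + length u′) % d ≡ (toℕ c + toℕ ((toℕ i + length u) modulo d)) % d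
      same-label c = trans (cong (_% d) (+-assoc (toℕ c) (toℕ i) (length u′)))
        (%-+-cong {m = toℕ c} {toℕ c} refl (trans (to (mod⇔% (toℕ i + length u′) (toℕ i + length u)) p) (sym
            (toℕ-mod-% (toℕ i + length u)))))

    -- In a context x, y the word starts at label |x|, and some component of the tuple starts there
    -- too. As u and v also agree in length modulo d, y is evaluated from the same label after both,
    -- and the two words in context are accepted alike.
    separate : ∀ {i j u v} → (toℕ i + length u) modulo d ≡ j → (toℕ i + length v) modulo d ≡ j →
               values i u P.≈ values i v → u L.≈ v
    separate {i} {j} {u} {v} p q e x y =
      R.correct (x ++ u ++ y) ⇔∙ ≡⇒⇔ (cong T (trans (cong (λ l → R.accept l (ev 0 (x ++ u ++ y))) lengths)
        (R.accept-cong _ same-value))) ⇔∙ ⇔-sym (R.correct (x ++ v ++ y))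
      where
      |u|≡|v| : length u % d ≡ length v % d
      |u|≡|v| = %-+-cancelˡ (toℕ i) (to (mod⇔% (toℕ i + length u) (toℕ i + length v)) (trans p (sym q)))
      length≡ : ∀ w → length (x ++ w ++ y) ≡ length x + (length w + length y)
      length≡ w = trans (length-++ x) (cong (length x +_) (length-++ w))
      lengths : length (x ++ u ++ y) modulo d ≡ length (x ++ v ++ y) modulo d
      lengths = from (mod⇔% _ _) (trans (cong (_% d) (length≡ u)) (trans
        (%-+-cong {m = length x} {length x} refl (%-+-cong {m = length u} {length v} {length y} {length y} |u|≡|v| refl))
        (cong (_% d) (sym (length≡ v)))))
      -- the shift which turns the label i of the arrow into the length of x
      c : Fin d
      c = (length x + (d ∸ toℕ i)) modulo d
      c+i : (toℕ c + toℕ i) % d ≡ length x % d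
      c+i = trans (%-shift {d} (length x + (d ∸ toℕ i)) (toℕ i)) (trans (cong (_% d) (trans (+-assoc (length x) _ _)
        (cong (length x +_) (m∸n+n≡m (<⇒≤ (toℕ<n i)))))) (%-remove-+ʳ (length x) ∣-refl))
      middle : ev (length x) u M.≈ ev (length x) v
      middle = M.trans (M.reflexive (eval-mod R.M R.h (sym c+i) u))
        (M.trans (tuple-injective R.M Ms e c) (M.reflexive (eval-mod R.M R.h c+i v)))
      split : ∀ w → ev 0 (x ++ w ++ y) M.≈ ev 0 x M.∙ (ev (length x) w M.∙ ev (length x + length w) y)
      split w = M.trans (eval-++ R.M R.h 0 x (w ++ y)) (M.∙-cong M.refl (eval-++ R.M R.h (length x) w y))
      same-value : ev 0 (x ++ u ++ y) M.≈ ev 0 (x ++ v ++ y)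
      same-value = M.trans (split u) (M.trans (M.∙-cong M.refl (M.∙-cong middle
        (M.reflexive (eval-mod R.M R.h (%-+-cong {m = length x} {length x} refl |u|≡|v|) y)))) (M.sym (split v)))

  -- A choice of related elements for the one-letter arrows makes the value of w an element related
  -- to the arrow of w from 0. By disjointness, this value and the end of the arrow determine the
  -- syntactic class, so acceptance can ask whether some word of L has them.
  divides⇒recognized : 𝐠 𝐕 (wordFiniteCategory L d D L⇔D) → ModRecognized 𝐕 d L
  divides⇒recognized (M , M∈𝐕 , division) = record
    { M = M ; M∈𝐕 = M∈𝐕 ; h = h ; accept = λ e m → does (occurs? e m)
    ; accept-cong = λ e {m} {m′} m≈m′ → does-⇔ (mk⇔ (λ (u , l , e , p) → u , l , M.trans e m≈m′ , p)
        (λ (u , l , e , p) → u , l , M.trans e (M.sym m≈m′) , p)) (occurs? e m) (occurs? e m′)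
    ; correct = λ w → mk⇔ (λ p → w , refl , M.refl , p) (unique w) ⇔∙ ⇔-sym (T-does (occurs? _ _))
    }
    where
    open Division division
    module M = Monoid M
    module Enum = Inverse (FiniteSetoid.enum (IsVariety.finite isVariety M∈𝐕))
    card = FiniteSetoid.card (IsVariety.finite isVariety M∈𝐕)
    _⇒_ = _⟶_ L d

    edge : ∀ (i : Fin d) a → i ⇒ (suc (toℕ i) modulo d)
    edge i a = (a ∷ []) , cong (_modulo d) (+-comm (toℕ i) 1)

    h : Fin d → Fin n → M.Carrier
    h i a = proj₁ (nonempty (edge i a))

    -- The end of the arrow is only propositionally equal to that of the composite. The transports
    -- quantify over the proof component, which `τ-resp-≈` allows to be changed.
    ev∈τ : ∀ i u (p : (toℕ (i modulo d) + length u) modulo d ≡ (i + length u) modulo d) →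
           τ {i modulo d} {(i + length u) modulo d} (u , p) (eval M h i u)
    ev∈τ i [] p = subst (λ k → (p : (toℕ (i modulo d) + 0) modulo d ≡ k) → τ {i modulo d} {k} ([] , p) M.ε)
      (cong (_modulo d) (sym (+-identityʳ i))) (λ p → τ-resp-≈ (L.refl {[]}) M.refl (unit (i modulo d))) p
    ev∈τ i (a ∷ u) p = τ-resp-≈ (L.refl {a ∷ u}) M.refl (Division.product division
        (subst (λ k → (q : (toℕ (i modulo d) + 1) modulo d ≡ k) →
            τ {i modulo d} {k} ((a ∷ []) , q) (h (i modulo d) a))
          next (λ q → τ-resp-≈ (L.refl {a ∷ []}) M.refl (proj₂ (nonempty (edge (i modulo d) a)))) (modulo-shift i 1 ∙≡ cong (_modulo d) (+-comm i 1)))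
        (subst (λ k → (q : (toℕ (suc i modulo d) + length u) modulo d ≡ k) → τ {suc i modulo d} {k} (u , q)
            (eval M h (suc i) u))
          (cong (_modulo d) (sym (+-suc i (length u)))) (ev∈τ (suc i) u) (trans (modulo-shift (suc i) (length u))
              (cong (_modulo d) (sym (+-suc i (length u)))))))
      where
      _∙≡_ : ∀ {x y z : Fin d} → x ≡ y → y ≡ z → x ≡ z
      _∙≡_ = trans
      next : suc (toℕ (i modulo d)) modulo d ≡ suc i modulo d
      next = trans (cong (_modulo d) (+-comm 1 (toℕ (i modulo d)))) (trans (modulo-shift i 1)
          (cong (_modulo d) (+-comm i 1)))

    Occurs : Fin d → M.Carrier → Set
    Occurs e m = ∃[ w ] length w modulo d ≡ e × eval M h 0 w M.≈ m × L w

    unique : ∀ w → Occurs (length w modulo d) (eval M h 0 w) → L w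
    -- `disjoint` only refutes that u and w are inequivalent; decidability of the syntactic
    -- congruence removes the double negation.
    unique w (u , l , e , p) = to (sub (decidable-stable (syntactic? u w) λ u≁w →
        disjoint {x = u , trans (modulo-shift 0 (length u)) l} {w , modulo-shift 0 (length w)} u≁w
        ( τ-resp-≈ (L.refl {u}) e (subst (λ k → (q : (toℕ (0 modulo d) + length u) modulo d ≡ k) →
            τ {0 modulo d} {k} (u , q) (eval M h 0 u)) l
            (ev∈τ 0 u) (trans (modulo-shift 0 (length u)) l))
        , ev∈τ 0 w (modulo-shift 0 (length w))))) p
      where
      sub : SyntacticCongruence L u w → L u ⇔ L w
      sub s = subst₂ (λ a b → L a ⇔ L b) (++-identityʳ u) (++-identityʳ w) (s [] [])

    -- Acceptance must be Boolean. `state` records all that `Occurs` asks of a word and is right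
    -- invariant, so the search can be limited to short words.
    state : List (Fin n) → Fin (tables * d * card)
    state u = combine (tableMod L d D L⇔D u) (Enum.to (eval M h 0 u))

    state⇒ : ∀ u v → state u ≡ state v → tableMod L d D L⇔D u ≡ tableMod L d D L⇔D v × Enum.to
        (eval M h 0 u) ≡ Enum.to (eval M h 0 v)
    state⇒ u v e = combine-injective (tableMod L d D L⇔D u) (Enum.to
        (eval M h 0 u)) (tableMod L d D L⇔D v) (Enum.to (eval M h 0 v)) e

    enum-injective : ∀ {x y} → Enum.to x ≡ Enum.to y → x M.≈ y
    enum-injective e = M.trans (M.sym (Enum.inverseʳ refl)) (Enum.inverseʳ e)

    state-right : RightInvariant state
    state-right u v e w with state⇒ u v e
    ... | p , q with tableMod⇒ L d D L⇔D {u} {v} p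
    ... | _ , l = cong₂ combine (tableMod-right L d D L⇔D u v p w) (Enum.to-cong (M.trans (eval-++ M h 0 u w)
      (M.trans (M.∙-cong (enum-injective {eval M h 0 u} {eval M h 0 v} q) (M.reflexive (eval-mod M h
          (to (mod⇔% (length u) (length v)) l) w))) (M.sym (eval-++ M h 0 v w)))))

    _≟ᴹ_ : ∀ x y → Dec (x M.≈ y)
    _≟ᴹ_ = via-injection (Inverse⇒Injection (FiniteSetoid.enum (IsVariety.finite isVariety M∈𝐕))) _≟ᶠ_

    occurs? : ∀ e m → Dec (Occurs e m)
    occurs? e m = map′ (λ p → let u , _ , q = find p in u , q)
      (λ (u , l , q , p) → let v , v∈ , s = short state state-right u
                               s₁ , s₂ = state⇒ v u s
                               t , l′ = tableMod⇒ L d D L⇔D {v} {u} s₁ in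
         lose v∈ (trans l′ l , M.trans (enum-injective {eval M h 0 v} {eval M h 0 u} s₂) q , from (table⇒L {v} {u} t) p))
      (Any.any? (λ u → (length u modulo d ≟ᶠ e) ×-dec ((eval M h 0 u ≟ᴹ m) ×-dec L? u))
        (words≤ (tables * d * card)))

-- Lifting path equations from modulus d to modulus k * s

private
  ∣-∣-< : ∀ {a b m n} → a < m → m < b → a < n → n < b → ∣ m - n ∣ < b ∸ a
  ∣-∣-< {a} {b} {m} {n} a<m m<b a<n n<b with ≤-total m n
  ... | inj₁ m≤n = subst (_< b ∸ a) (sym (m≤n⇒∣m-n∣≡n∸m m≤n))
                     (≤-<-trans (∸-monoʳ-≤ n (<⇒≤ a<m)) (∸-monoˡ-< n<b (<⇒≤ a<n)))
  ... | inj₂ n≤m = subst (_< b ∸ a) (trans (sym (m≤n⇒∣m-n∣≡n∸m n≤m)) (∣-∣-comm n m))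
                     (≤-<-trans (∸-monoʳ-≤ m (<⇒≤ a<n)) (∸-monoˡ-< m<b (<⇒≤ a<m)))

%-reduce : ∀ {d e m n} .{{_ : NonZero d}} .{{_ : NonZero e}} → d ∣ e → m % e ≡ n % e → m % d ≡ n % d
%-reduce {d} {e} {m} {n} d∣e p =
  trans (sym (m∣n⇒o%n%m≡o%m d e m d∣e)) (trans (cong (_% d) p) (m∣n⇒o%n%m≡o%m d e n d∣e))

-- Solves a + ℓ ≡ b modulo d without subtraction: `a * predⁿ d` stands for -a, and `m * d` makes the
-- solution as large as desired.
wrap : ∀ d .{{_ : NonZero d}} a b m → (a + (b + (a * predⁿ d + m * d))) % d ≡ b % d
wrap d a b m = trans (cong (_% d) (begin
  a + (b + (a * predⁿ d + m * d))      ≡⟨ sym (+-assoc a b _) ⟩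
  a + b + (a * predⁿ d + m * d)        ≡⟨ cong (_+ (a * predⁿ d + m * d)) (+-comm a b) ⟩
  b + a + (a * predⁿ d + m * d)        ≡⟨ +-assoc b a _ ⟩
  b + (a + (a * predⁿ d + m * d))      ≡⟨ cong (b +_) (sym (+-assoc a _ _)) ⟩
  b + (a + a * predⁿ d + m * d)        ≡⟨ cong (λ z → b + (z + m * d)) (sym (*-suc a (predⁿ d))) ⟩
  b + (a * suc (predⁿ d) + m * d)      ≡⟨ cong (λ z → b + (a * z + m * d)) (suc-pred d) ⟩
  b + (a * d + m * d)                 ≡⟨ cong (b +_) (sym (*-distribʳ-+ d a m)) ⟩
  b + (a + m) * d                     ∎)) ([m+kn]%n≡m%n b (a + m) d)
  where open ≡-Reasoning

module _ (k s : ℕ) .{{_ : NonZero k}} .{{_ : NonZero s}} .{{_ : NonZero (k * s)}} where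

  private
    K = k * s

    s≤K : s ≤ K
    s≤K = m≤n*m s k

    -- Only s - 1 numbers lie strictly between K - s and K, so distinct ones are incongruent modulo
    -- s.
    near-top : ∀ {m n} → m % s ≡ n % s → K ∸ s < m → m < K → K ∸ s < n → n < K → m ≡ n
    near-top {m} {n} e a b c d = ∣m-n∣≡0⇒m≡n (trans
      (sym (m<n⇒m%n≡m (subst (∣ m - n ∣ <_) (m∸[m∸n]≡n s≤K) (∣-∣-< a b c d)))) (n∣m⇒m%n≡0 _ s (from (∣∣-∣⇔% m n) e)))

    multiple<K : (j : Fin k) → toℕ j * s < K
    multiple<K j = *-monoˡ-< s (toℕ<n j)

    multiple≤ : (j : Fin k) → toℕ j * s ≤ K ∸ s
    multiple≤ j = subst (_≤ K ∸ s) (m+n∸m≡n s (toℕ j * s)) (∸-monoˡ-≤ s (*-monoˡ-≤ s (toℕ<n j)))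

  -- Rotate x₀ to 0 and then by j * s, for j < k.  If every j moved some residue
  -- into the interval (K - s , K), then different j would do this with different
  -- residues, none of them x₀.

  gap : ∀ {v} → v ≤ k → (p : Fin v → Fin K) → Fin v → ∃[ c ] (∀ x → (toℕ (p x) + c) % K ≤ K ∸ s)
  gap {v} v≤k p x₀ with anyᶠ? (λ j → allᶠ? (λ x → (toℕ (p x) + (K ∸ toℕ (p x₀) + toℕ j * s)) % K ≤? K ∸ s))
  ... | yes (j , good) = K ∸ toℕ (p x₀) + toℕ j * s , good
  ... | no none = ⊥-elim impossible
    where
    t = K ∸ toℕ (p x₀)
    pos : Fin k → Fin v → ℕ
    pos j x = (toℕ (p x) + (t + toℕ j * s)) % K
    bad : ∀ j → ∃[ x ] ¬ (pos j x ≤ K ∸ s)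
    bad j = ¬∀⟶∃¬ v _ (λ x → pos j x ≤? K ∸ s) (λ good → none (j , good))
    -- The extra slot `zero` reserves `x₀`, which no rotation by j * s moves into the gap; k + 1
    -- slots must collide in `Fin v`.
    g : Fin (suc k) → Fin v
    g zero    = x₀
    g (suc j) = proj₁ (bad j)
    pos-x₀ : ∀ j → pos j x₀ ≡ toℕ j * s
    pos-x₀ j = trans (cong (_% K) (trans (sym (+-assoc (toℕ (p x₀)) t _))
      (trans (cong (_+ toℕ j * s) (m+[n∸m]≡n (<⇒≤ (toℕ<n (p x₀))))) (+-comm K (toℕ j * s)))))
      (trans ([m+n]%n≡m%n (toℕ j * s) K) (m<n⇒m%n≡m (multiple<K j)))
    pos-%s : ∀ j x → pos j x % s ≡ (toℕ (p x) + t) % s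
    pos-%s j x = trans (m∣n⇒o%n%m≡o%m s K _ (n∣m*n k)) (trans (cong (_% s) (sym (+-assoc (toℕ (p x)) t _)))
      ([m+kn]%n≡m%n (toℕ (p x) + t) (toℕ j) s))
    -- Rotation by a multiple of s preserves the residue modulo s, so x can enter the gap in one
    -- place only, and that place determines j.
    pos-injective : ∀ x j j′ → ¬ (pos j x ≤ K ∸ s) → ¬ (pos j′ x ≤ K ∸ s) → j ≡ j′
    pos-injective x j j′ b b′ = toℕ-injective (*-cancelʳ-≡ (toℕ j) (toℕ j′) s (trans (sym (m<n⇒m%n≡m (multiple<K j)))
      (trans (%-+-cancelˡ t (%-+-cancelˡ (toℕ (p x)) (near-top (trans (pos-%s j x) (sym (pos-%s j′ x)))
        (≰⇒> b) (m%n<n _ K) (≰⇒> b′) (m%n<n _ K)))) (m<n⇒m%n≡m (multiple<K j′)))))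
    impossible : ⊥
    impossible with pigeonhole (s≤s v≤k) g
    ... | zero  , suc j  , _   , e = proj₂ (bad j) (subst (λ x → pos j x ≤ K ∸ s) e (subst (_≤ K ∸ s)
        (sym (pos-x₀ j)) (multiple≤ j)))
    ... | suc j , suc j′ , j<j′ , e = <-irrefl (cong toℕ (pos-injective (g (suc j)) j j′ (proj₂ (bad j))
            (subst (λ x → ¬ (pos j′ x ≤ K ∸ s)) (sym e) (proj₂ (bad j′))))) (s≤s⁻¹ j<j′)

-- Changing the length of a word within its syntactic class

module _ {n : ℕ} (L : Language n) (s : ℕ) (isStable : IsStable L s) where

  private
    module L = Monoid (syntacticMonoid L)
    instance
      s≢0 : NonZero s
      s≢0 = >-nonZero (proj₁ isStable)

    resize-prefix : ∀ a b → (∀ u → length u ≡ a → ∃[ v ] length v ≡ b × v L.≈ u) →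
                    ∀ m u → length u ≡ a + m → ∃[ v ] length v ≡ b + m × v L.≈ u
    resize-prefix a b r m u l with r (take a u) (trans (length-take a u) (m≤n⇒m⊓n≡m (subst (a ≤_)
        (sym l) (m≤m+n a m))))
    ... | v , l′ , e = v ++ drop a u
      , trans (length-++ v) (cong₂ _+_ l′ (trans (length-drop a u) (trans (cong (_∸ a) l) (m+n∸m≡n a m))))
      , subst (v ++ drop a u L.≈_) (take++drop≡id a u) (L.∙-cong {v} {take a u} {drop a u} {drop a u} e (L.refl {drop a u}))

    2*s : 2 * s ≡ s + s
    2*s = cong (s +_) (+-identityʳ s)

    longer : ∀ m u → length u ≡ s + m → ∃[ v ] length v ≡ s + s + m × v L.≈ u
    longer = resize-prefix s (s + s) (λ u l → let v , l′ , e = proj₁ (proj₂ isStable) (u , l , L.refl {u}) in v , trans l′ 2*s , e)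

    shorter : ∀ m u → length u ≡ s + s + m → ∃[ v ] length v ≡ s + m × v L.≈ u
    shorter = resize-prefix (s + s) s (λ u l → proj₂ (proj₂ isStable) (u , trans l (sym 2*s) , L.refl {u}))

    longer* : ∀ q m u → length u ≡ s + m → ∃[ v ] length v ≡ s + (m + q * s) × v L.≈ u
    longer* zero    m u l = u , trans l (cong (s +_) (sym (+-identityʳ m))) , L.refl {u}
    longer* (suc q) m u l with longer m u l
    ... | v , l′ , e with longer* q (s + m) v (trans l′ (+-assoc s s m))
    ... | w , l″ , e′ = w , trans l″ (cong (s +_) (trans
        (cong (_+ q * s) (+-comm s m)) (+-assoc m s (q * s)))) , L.trans {w} {v} {u} e′ e

    shorter* : ∀ q m u → length u ≡ s + (m + q * s) → ∃[ v ] length v ≡ s + m × v L.≈ u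
    shorter* zero    m u l = u , trans l (cong (s +_) (+-identityʳ m)) , L.refl {u}
    shorter* (suc q) m u l with shorter (m + q * s) u (trans l (trans (cong (s +_) (trans (sym (+-assoc m s (q * s)))
                                  (trans (cong (_+ q * s) (+-comm m s)) (+-assoc s m (q * s)))))
                                      (sym (+-assoc s s _))))
    ... | v , l′ , e with shorter* q m v l′
    ... | w , l″ , e′ = w , l″ , L.trans {w} {v} {u} e′ e

  -- Stability trades a prefix of length s for one of length 2s and back. The word is first
  -- shortened by multiples of s to a length below 2s, and then lengthened to ℓ.
  resize : ∀ u ℓ → s ≤ length u → s ≤ ℓ → length u % s ≡ ℓ % s → ∃[ v ] length v ≡ ℓ × v L.≈ u
  resize u ℓ s≤u s≤ℓ e with shorter* (a / s) (a % s) u (trans (sym (m+[n∸m]≡n s≤u)) (cong (s +_) (m≡m%n+[m/n]*n a s)))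
    where a = length u ∸ s
  ... | v , l , p with longer* (b / s) (a % s) v l
    where a = length u ∸ s
          b = ℓ ∸ s
  ... | w , l′ , q = w , trans l′ (trans (cong (s +_) (trans (cong (_+ b / s * s) residue)
      (sym (m≡m%n+[m/n]*n b s)))) (m+[n∸m]≡n s≤ℓ))
                   , L.trans {w} {v} {u} q p
    where
    a = length u ∸ s
    b = ℓ ∸ s
    residue : a % s ≡ b % s
    residue = %-+-cancelˡ s (trans (cong (_% s) (m+[n∸m]≡n s≤u)) (trans e (cong (_% s) (sym (m+[n∸m]≡n s≤ℓ)))))

module _ {n : ℕ} {L : Language n} (D : DFA n) (L⇔D : ∀ w → L w ⇔ DFA.Accepts D w)
         (s : ℕ) (isStable : IsStable L s) (k : ℕ) .{{_ : NonZero k}} .{{_ : NonZero (k * s)}}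
         (d : ℕ) .{{_ : NonZero d}} (K∣d : k * s ∣ d) where

  private
    module L = Monoid (syntacticMonoid L)
    K = k * s
    instance
      s≢0 : NonZero s
      s≢0 = >-nonZero (proj₁ isStable)
    C_K = wordFiniteCategory L K D L⇔D
    C_d = wordFiniteCategory L d D L⇔D

  module _ (X : Graph) (v≤k : Graph.vertices X ≤ k) (x₀ : Graph.Vertex X)
           (φ : Functor (Graph.free X) (wordCategory L K)) where
    open Graph X
    private
      module φ = Functor φ
      c = proj₁ (gap k s v≤k φ.F₀ x₀)

      rotated : Vertex → ℕ
      rotated x = (toℕ (φ.F₀ x) + c) % K

      rotated≤ : ∀ x → rotated x ≤ K ∸ s
      rotated≤ = proj₂ (gap k s v≤k φ.F₀ x₀)

      -- Undoes the rotation, as `c * predⁿ K` is -c modulo K. The positions thus represent the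
      -- given residues, yet all lie in one interval of length K - s.
      position : Vertex → ℕ
      position x = rotated x + c * predⁿ K

      position-% : ∀ x → position x % K ≡ toℕ (φ.F₀ x) % K
      position-% x = trans (%-+-cong {m = rotated x} {toℕ (φ.F₀ x) + c} {c * predⁿ K} (m%n%n≡m%n _ K) refl)
        (trans (cong (_% K) (trans (+-assoc (toℕ (φ.F₀ x)) c _) (cong (toℕ (φ.F₀ x) +_) (trans
            (sym (*-suc c (predⁿ K))) (cong (c *_) (suc-pred K))))))
          ([m+kn]%n≡m%n (toℕ (φ.F₀ x)) c K))

      -- For a word shorter than s, `rotated x + length u` stays below K, so the congruence modulo K
      -- is an equality of numbers and holds modulo d. A longer word is replaced by a congruent one
      -- of suitable length.
      lift : ∀ {x y} (u : List (Fin n)) → (toℕ (φ.F₀ x) + length u) modulo K ≡ φ.F₀ y →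
             Σ[ v ∈ List (Fin n) ] v L.≈ u × (position x + length v) % d ≡ position y % d
      lift {x} {y} u p with length u <? s
      -- a short arrow cannot cross the gap
      ... | yes u<s = u , L.refl {u} , cong (_% d) (trans (trans (+-assoc (rotated x) (c * predⁿ K) (length u))
              (trans (cong (rotated x +_) (+-comm (c * predⁿ K) (length u)))
                  (sym (+-assoc (rotated x) (length u) (c * predⁿ K)))))
              (cong (_+ c * predⁿ K) unrotated))
        where
        residue : (rotated x + length u) % K ≡ rotated y % K
        residue = trans (%-+-cong {m = rotated x} {toℕ (φ.F₀ x) + c} {length u} (m%n%n≡m%n _ K) refl)
          (trans (cong (_% K) (trans (+-assoc _ c (length u)) (trans (cong
              (toℕ (φ.F₀ x) +_) (+-comm c (length u))) (sym (+-assoc _ (length u) c)))))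
          (trans (%-+-cong {m = toℕ (φ.F₀ x) + length u} {toℕ (φ.F₀ y)} {c} {c}
                   (to (mod⇔% (toℕ (φ.F₀ x) + length u) (toℕ (φ.F₀ y))) (trans p (sym (toℕ-mod-id (φ.F₀ y))))) refl)
            (sym (m%n%n≡m%n _ K))))
        unrotated : rotated x + length u ≡ rotated y
        unrotated = trans (sym (m<n⇒m%n≡m
            (subst (rotated x + length u <_) (m∸n+n≡m (m≤n*m s k)) (+-mono-≤-< (rotated≤ x) u<s))))
          (trans residue (m<n⇒m%n≡m (m%n<n _ K)))
      ... | no u≮s with resize L s isStable u ℓ (≮⇒≥ u≮s) s≤ℓ residue
        where
        -- The solution of `position x + ℓ ≡ position y` modulo d given by `wrap`; the summand s * d
        -- ensures s ≤ ℓ. Since s divides both K and d, ℓ and `length u` agree modulo s.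
        ℓ = position y + (position x * predⁿ d + s * d)
        s≤ℓ : s ≤ ℓ
        s≤ℓ = ≤-trans (m≤m*n s d) (≤-trans (m≤n+m (s * d) (position x * predⁿ d)) (m≤n+m _ (position y)))
        start : (position x + length u) % K ≡ position y % K
        start = trans (%-+-cong {m = position x} {toℕ (φ.F₀ x)} {length u} (position-% x) refl)
          (trans (to (mod⇔% (toℕ (φ.F₀ x) + length u) (toℕ (φ.F₀ y))) (trans p (sym (toℕ-mod-id (φ.F₀ y)))))
              (sym (position-% y)))
        residue : length u % s ≡ ℓ % s
        residue = %-+-cancelˡ {s} (position x) {length u} {ℓ} (trans (%-reduce (n∣m*n k) start)
            (sym (%-reduce (∣-trans (n∣m*n k) K∣d) (wrap d (position x) (position y) s))))
      ... | v , l , e = v , e , trans (cong (λ m → (position x + m) % d) l) (wrap d (position x) (position y) s)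

      lift-arrow : ∀ {x y} → _⟶_ L K (φ.F₀ x) (φ.F₀ y) → _⟶_ L d (position x modulo d) (position y modulo d)
      lift-arrow {x} {y} (u , p) = let v , _ , e = lift {x} {y} u p in
        v , trans (modulo-shift (position x) (length v)) (from (mod⇔% (position x + length v) (position y)) e)

      -- The ends `position x modulo d` are fixed in advance for all vertices, so edges can be
      -- lifted independently and the lifts compose.
      lift-path : ∀ {x y} → Path x y → _⟶_ L d (position x modulo d) (position y modulo d)
      lift-path {x} ε       = Category.1# (wordCategory L d) (position x modulo d)
      lift-path     (e ◅ p) = compose L d (lift-arrow (φ.F₁ (e ◅ ε))) (lift-path p)

    lifted : Functor (Graph.free X) (wordCategory L d)
    lifted = record
      { F₀       = λ x → position x modulo d
      ; F₁       = lift-path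
      ; F-resp-≈ = λ { {x = p} refl → L.refl {proj₁ (lift-path p)} }
      ; F-1      = λ e → L.refl {[]}
      ; F-∙      = λ p q → L.reflexive (homo p q)
      }
      where
      homo : ∀ {x y z} (p : Path x y) (q : Path y z) →
          proj₁ (lift-path (p ◅◅ q)) ≡ proj₁ (lift-path p) ++ proj₁ (lift-path q)
      homo ε       q = refl
      homo (e ◅ p) q = trans (cong (proj₁ (lift-arrow (φ.F₁ (e ◅ ε))) ++_) (homo p q))
          (sym (++-assoc (proj₁ (lift-arrow (φ.F₁ (e ◅ ε)))) _ _))

    lifted-≈ : ∀ {x y} (p : Path x y) → proj₁ (lift-path p) L.≈ proj₁ (φ.F₁ p)
    lifted-≈ {x} ε = L.sym {proj₁ (φ.F₁ {x} ε)} {[]} (φ.F-1 x)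
    lifted-≈ (_◅_ {x} {y} e p) = L.trans {proj₁ (lift-path (e ◅ p))} {proj₁ (φ.F₁ (e ◅ ε)) ++ proj₁ (φ.F₁ p)} {proj₁ (φ.F₁ (e ◅ p))}
      (L.∙-cong {proj₁ (lift-arrow (φ.F₁ (e ◅ ε)))} {proj₁ (φ.F₁ (e ◅ ε))} {proj₁ (lift-path p)} {proj₁ (φ.F₁ p)}
        (proj₁ (proj₂ (lift {x} {y} (proj₁ (φ.F₁ (e ◅ ε))) (proj₂ (φ.F₁ (e ◅ ε)))))) (lifted-≈ p))
      (L.sym {proj₁ (φ.F₁ (e ◅ p))} {proj₁ (φ.F₁ (e ◅ ε)) ++ proj₁ (φ.F₁ p)} (φ.F-∙ (e ◅ ε) p))

    -- Both extensions are eventually attained along the same sequence of paths; at a common index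
    -- `lifted-≈` compares them.
    extend-lifted : ∀ {x y} (u : ProfinitePath X x y) → proj₁ (extend X C_d lifted u) L.≈ proj₁ (extend X C_K φ u)
    extend-lifted u = approximate _ _ (extend-limit X C_d lifted u) (extend-limit X C_K φ u)
      where
      open ProfinitePath u using (path)
      approximate : ∀ a b → ∃[ N ] (∀ i → i ≥ N → proj₁ (lift-path (path i)) L.≈ a) →
                    ∃[ N ] (∀ i → i ≥ N → proj₁ (φ.F₁ (path i)) L.≈ b) → a L.≈ b
      approximate a b (N , p) (N′ , q) = L.trans {a} {proj₁ (lift-path (path i))} {b}
        (L.sym {proj₁ (lift-path (path i))} {a} (p i (m≤m+n N N′)))
        (L.trans {proj₁ (lift-path (path i))} {proj₁ (φ.F₁ (path i))} {b} (lifted-≈ (path i)) (q i (m≤n+m N′ N)))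
        where i = N + N′

  satisfies-lift : ∀ eq → Graph.vertices (PathEquation.graph eq) ≤ k → C_d Satisfies eq → C_K Satisfies eq
  -- The source of the equation supplies the vertex which the gap argument rotates to 0.
  satisfies-lift eq v≤k sat φ = L.trans {a} {a′} {b} (L.sym {a′} {a} (extend-lifted X v≤k source φ lhs))
    (L.trans {a′} {b′} {b} (sat ψ) (extend-lifted X v≤k source φ rhs))
    where
    open PathEquation eq renaming (graph to X)
    ψ = lifted X v≤k source φ
    a = proj₁ (extend X C_K φ lhs)
    b = proj₁ (extend X C_K φ rhs)
    a′ = proj₁ (extend X C_d ψ lhs)
    b′ = proj₁ (extend X C_d ψ rhs)

  -- The rank enters here: it bounds the graphs of the defining equations by the k vertices that
  -- leave a gap.
  divides-lift : ∀ {ℓ ℓ′} {𝐕 : Pred (Monoid 0ℓ 0ℓ) ℓ} → HasRank ℓ′ 𝐕 k → 𝐠 𝐕 C_d → 𝐠 𝐕 C_K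
  divides-lift rank C_d∈ = from (defines C_K) λ eq eq∈ → satisfies-lift eq (bounded eq eq∈)
      (to (defines C_d) C_d∈ eq eq∈)
    where open HasRank rank

-- Letters of concatenated, shortened and constant words

at-++ : ∀ {A : Set} (u : List A) {v k} → k < length u → at (u ++ v) k ≡ at u k
at-++ (a ∷ u) {k = zero}  _       = refl
at-++ (a ∷ u) {k = suc k} (s≤s l) = at-++ u l

at-drop : ∀ {A : Set} (v : List A) i k → at (drop i v) k ≡ at v (i + k)
at-drop v i k = cong head (drop-drop i k v)

at-replicate : ∀ {A : Set} {x : A} {m k} → k < m → at (replicate m x) k ≡ just x
at-replicate {k = zero}  (s≤s _) = refl
at-replicate {k = suc k} (s≤s l) = at-replicate l

replicate-∷ʳ : ∀ {A : Set} m (x : A) → replicate m x ++ x ∷ [] ≡ replicate (suc m) x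
replicate-∷ʳ zero    x = refl
replicate-∷ʳ (suc m) x = cong (x ∷_) (replicate-∷ʳ m x)

reverse-replicate : ∀ {A : Set} m (x : A) → reverse (replicate m x) ≡ replicate m x
reverse-replicate zero    x = refl
reverse-replicate (suc m) x = trans (unfold-reverse x (replicate m x)) (trans
    (cong (_++ x ∷ []) (reverse-replicate m x)) (replicate-∷ʳ m x))

-- Local predicates

-- The letter at a position x of the enriched word codes the letters of the
-- original word at the positions x, …, x + t; 0 means that there is none.

module Windows (B t : ℕ) where

  Γ : ℕ
  Γ = suc B ^ suc t

  code : Maybe (Fin B) → Fin (suc B)
  code nothing  = zero
  code (just b) = suc b

  code-injective : ∀ {x y} → code x ≡ code y → x ≡ y
  code-injective {nothing} {nothing} _    = refl
  code-injective {just _}  {just _}  refl = refl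

  decode : Fin (suc B) → Maybe ℕ
  decode zero    = nothing
  decode (suc b) = just (toℕ b)

  decode-code : ∀ x → decode (code x) ≡ Maybe.map toℕ x
  decode-code nothing  = refl
  decode-code (just b) = refl

  window : List (Fin B) → Fin Γ
  window v = funToFin (λ (k : Fin (suc t)) → code (at v (toℕ k)))

  windows : List (Fin B) → List (Fin Γ)
  windows []      = []
  windows (b ∷ v) = window (b ∷ v) ∷ windows v

  length-windows : ∀ v → length (windows v) ≡ length v
  length-windows []      = refl
  length-windows (b ∷ v) = cong suc (length-windows v)

  at-windows : ∀ v i {b} → at v i ≡ just b → at (windows v) i ≡ just (window (drop i v))
  at-windows []      zero    ()
  at-windows []      (suc i) ()
  at-windows (b ∷ v) zero    e = refl
  at-windows (b ∷ v) (suc i) e = at-windows v i e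

  entry : Fin Γ → Fin (suc t) → Fin (suc B)
  entry = finToFun

  entry-window : ∀ v i k → entry (window (drop i v)) k ≡ code (at v (i + toℕ k))
  entry-window v i k = trans (finToFun-funToFin (λ (k : Fin (suc t)) → code (at (drop i v) (toℕ k))) k)
                             (cong code (at-drop v i (toℕ k)))

  view : Fin Γ → Fin (suc t) → Maybe ℕ
  view γ k = decode (entry γ k)

  view-window : ∀ v i k → view (window (drop i v)) k ≡ letterAt (map toℕ v) (i + toℕ k)
  view-window v i k = trans (cong decode (entry-window v i k))
    (trans (decode-code (at v (i + toℕ k))) (sym (at-map toℕ v (i + toℕ k))))

  window-cong : ∀ {u v} → (∀ k → k ≤ t → at u k ≡ at v k) → window u ≡ window v
  window-cong e = funToFin-cong (λ k → cong code (e (toℕ k) (s≤s⁻¹ (toℕ<n k))))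

  -- A window that starts in x reaches at most t letters beyond x, hence never past y.
  windows-++ : ∀ x {y z} → t ≤ length y →
      windows (x ++ y ++ z) ≡ take (length x) (windows (x ++ y)) ++ windows (y ++ z)
  windows-++ []      t≤y = refl
  windows-++ (b ∷ x) {y} {z} t≤y = cong₂ _∷_
    (window-cong λ k k≤t → trans (cong (λ v → at (b ∷ v) k) (sym (++-assoc x y z)))
      (at-++ (b ∷ x ++ y) (s≤s (≤-trans k≤t (≤-trans t≤y (subst (length y ≤_)
          (sym (length-++ x)) (m≤n+m (length y) (length x))))))))
    (windows-++ x t≤y)

module _ (σ : Signature) where

  private
    V = numerical σ

  offset : LocalSym → ℕ
  offset (atPlus a k)   = k
  offset (minPlus a k)  = k
  offset (maxMinus a k) = k

  Bounded : ℕ → Vocabulary.Sym (V ∪ⱽ local) → Set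
  Bounded t (inj₁ P) = ⊤
  Bounded t (inj₂ P) = offset P ≤ t

  bound : ∀ (Ps : List (Vocabulary.Sym (V ∪ⱽ local))) → ∃[ t ] (∀ P → P ∈ Ps → Bounded t P)
  bound []            = 0 , λ _ ()
  bound (inj₁ P ∷ Ps) with bound Ps
  ... | t , bounded = t , λ { _ (here refl) → tt ; P (there P∈) → bounded P P∈ }
  bound (inj₂ P ∷ Ps) with bound Ps
  ... | t , bounded = offset P + t , λ { _ (here refl) → m≤m+n (offset P) t ; Q (there Q∈) → larger Q (bounded Q Q∈) }
    where
    larger : ∀ Q → Bounded t Q → Bounded (offset P + t) Q
    larger (inj₁ Q) _ = tt
    larger (inj₂ Q) b = ≤-trans b (m≤n+m t (offset P))

  module _ (B t : ℕ) where
    open Windows B t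

    -- Local predicates are read off the windows of a word in which the first
    -- t + 1 letters are lo and the last t + 1 letters are hi.

    module _ (lo hi : ℕ) where

      private
        shows : ℕ → Fin (suc t) → Fin Γ → Bool
        shows a k γ = does (≡-decᵐ _≟_ (view γ k) (just a))

        predᵗ : ∀ {m p} (P : Vocabulary.Sym (V ∪ⱽ local)) → Vec (Fin m) (Vocabulary.arity (V ∪ⱽ local) P) →
            Formula V m p
        predᵗ (inj₁ P)              xs       = pred P xs
        -- For k ≤ t the remainder is k itself; larger offsets get an arbitrary translation and are
        -- excluded by `Bounded`.
        predᵗ (inj₂ (atPlus a k))   (x ∷ []) = letterIn (shows a (k modulo suc t)) x
        predᵗ (inj₂ (minPlus a k))  []       = constant (does (≡-decᵐ _≟_ (just lo) (just a)))
        predᵗ (inj₂ (maxMinus a k)) []       = constant (does (≡-decᵐ _≟_ (just hi) (just a)))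

        predᵗ-basic : ∀ {m p} P xs → Basic (_∈ⱽ xs) (predᵗ {m} {p} P xs)
        predᵗ-basic (inj₁ P)              xs       = pred-basic P xs
        predᵗ-basic (inj₂ (atPlus a k))   (x ∷ []) = resp-basic ≡≐∈ (letterIn-basic (shows a (k modulo suc t)) x)
        predᵗ-basic (inj₂ (minPlus a k))  []       = constant-basic _
        predᵗ-basic (inj₂ (maxMinus a k)) []       = constant-basic _

      withoutLocal : Translation (V ∪ⱽ local) V
      withoutLocal = record
        { letterᵗ = λ a → letterIn (shows a zero) ; letterᵗ-basic = λ a → letterIn-basic (shows a zero)
        ; predᵗ = predᵗ ; predᵗ-basic = predᵗ-basic
        }

      module _ (v : List (Fin B)) (first : ∀ k → k ≤ t → letterAt (map toℕ v) k ≡ just lo)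
               (last : ∀ k → k ≤ t → letterAt (reverse (map toℕ v)) k ≡ just hi) where

        windows-length : length (map toℕ v) ≡ length (map toℕ (windows v))
        windows-length = trans (length-map toℕ v) (sym (trans (length-map toℕ (windows v)) (length-windows v)))

        private
          shows⇔ : ∀ a k {m p} (x : Fin m) {ρ : Vec (Fin (length (map toℕ v))) m}
                   {ρ′ : Vec (Fin (length (map toℕ (windows v)))) m} (X′ : Vec _ p) → Same¹ ρ ρ′ →
                   T (does (≡-decᵐ _≟_ (letterAt (map toℕ v) (toℕ (Vec.lookup ρ x) + toℕ k)) (just a))) ⇔
                   Sat V (map toℕ (windows v)) (letterIn (shows a k) x) ρ′ X′
          shows⇔ a k x {ρ} {ρ′} X′ r with lookup-map-toℕ v (Vec.lookup ρ x)
          ... | c , at≡ , _ =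
            ≡⇒⇔ (cong (λ y → T (does (≡-decᵐ _≟_ y (just a)))) (sym (view-window v (toℕ (Vec.lookup ρ x)) k))) ⇔∙
            ⇔-sym (letterIn-sat (shows a k) x (windows v) ρ′ X′
              (subst (λ y → at (windows v) y ≡ just (window (drop (toℕ (Vec.lookup ρ x)) v))) (r .value x)
                (at-windows v (toℕ (Vec.lookup ρ x)) at≡)))

        withoutLocal-correct : Correct withoutLocal (map toℕ v) (map toℕ (windows v)) windows-length (Bounded t)
        withoutLocal-correct .letter-correct a x {ρ} S S′ r =
          mk⇔ (cong just) just-injective ⇔∙
          ≡⇒⇔ (cong (_≡ just a) (sym (trans (cong (letterAt (map toℕ v)) (+-identityʳ (toℕ (Vec.lookup ρ x))))
              (at-lookup (map toℕ v) (Vec.lookup ρ x))))) ⇔∙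
          ⇔-sym (T-does (≡-decᵐ _≟_ (letterAt (map toℕ v) (toℕ (Vec.lookup ρ x) + 0)) (just a))) ⇔∙
          shows⇔ a zero x S′ r
        withoutLocal-correct .pred-correct (inj₁ P) _ xs S S′ r = holds-same σ P windows-length r xs
        withoutLocal-correct .pred-correct (inj₂ (atPlus a k)) k≤t (x ∷ []) {ρ} S S′ r =
          ≡⇒⇔ (cong (λ j → T (does (≡-decᵐ _≟_ (letterAt (map toℕ v) (toℕ (Vec.lookup ρ x) + j)) (just a))))
            (sym (trans (toℕ-mod k) (m<n⇒m%n≡m (s≤s k≤t))))) ⇔∙
          shows⇔ a (k modulo suc t) x S′ r
        withoutLocal-correct .pred-correct (inj₂ (minPlus a k)) k≤t [] S S′ r =
          ≡⇒⇔ (cong (λ y → T (does (≡-decᵐ _≟_ y (just a)))) (first k k≤t)) ⇔∙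
          ⇔-sym (constant-sat {V} (does (≡-decᵐ _≟_ (just lo) (just a))) {S = S′})
        withoutLocal-correct .pred-correct (inj₂ (maxMinus a k)) k≤t [] S S′ r =
          ≡⇒⇔ (cong (λ y → T (does (≡-decᵐ _≟_ y (just a)))) (last k k≤t)) ⇔∙
          ⇔-sym (constant-sat {V} (does (≡-decᵐ _≟_ (just hi) (just a))) {S = S′})

    private
      W = V ∪ⱽ local

      atᶠ : ∀ {m p} → Fin m → Fin (suc t) → Fin B → Formula W m p
      atᶠ x k b = pred (inj₂ (atPlus (toℕ b) (toℕ k))) (x ∷ [])

      -- Entry `zero` means that the position x + k does not exist, which is expressed by the
      -- failure of every letter there.
      entryᶠ : ∀ {m p} → Fin m → Fin (suc t) → Fin (suc B) → Formula W m p
      entryᶠ x k zero    = ¬ᶠ ⋁ x (map (atᶠ x k) (allFin B))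
      entryᶠ x k (suc b) = atᶠ x k b

      windowᶠ : ∀ {m p} → Fin m → Fin Γ → Formula W m p
      windowᶠ x γ = ⋀ x (map (λ k → entryᶠ x k (entry γ k)) (allFin (suc t)))

      atᶠ-basic : ∀ {m p} x k b → Basic (_≡ x) (atᶠ {m} {p} x k b)
      atᶠ-basic x k b = resp-basic (proj₂ ≡≐∈ , proj₁ ≡≐∈) (pred-basic _ _)

      entryᶠ-basic : ∀ {m p} x k c → Basic (_≡ x) (entryᶠ {m} {p} x k c)
      entryᶠ-basic x k zero    = ¬-basic (⋁-basic x (All.map⁺ (All.tabulate {xs = allFin B} (λ {b} _ → atᶠ-basic x k b))))
      entryᶠ-basic x k (suc b) = atᶠ-basic x k b

    letterᵂ : ∀ {m p} → ℕ → Fin m → Formula W m p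
    letterᵂ c x with c <? Γ
    ... | yes c< = windowᶠ x (fromℕ< c<)
    ... | no _   = false¹ x

    letterᵂ-basic : ∀ {m p} c x → Basic (_≡ x) (letterᵂ {m} {p} c x)
    letterᵂ-basic c x with c <? Γ
    ... | yes c< = ⋀-basic x (All.map⁺ (All.tabulate {xs = allFin (suc t)} (λ {k} _ → entryᶠ-basic x k _)))
    ... | no _   = false¹-basic x

    module _ (v : List (Fin B)) {m p : ℕ} (x : Fin m) (ρ : Vec (Fin (length (map toℕ v))) m) (S : Vec (Subset (length (map toℕ v))) p) where

      private
        y = toℕ (Vec.lookup ρ x)

        atᶠ-sat : ∀ k b → Sat W (map toℕ v) (atᶠ x k b) ρ S ⇔ at v (y + toℕ k) ≡ just b
        atᶠ-sat k b = T-does (≡-decᵐ _≟_ (letterAt (map toℕ v) (y + toℕ k)) (just (toℕ b))) ⇔∙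
          mk⇔ (λ e → map-injectiveᵐ toℕ-injective (trans (sym (at-map toℕ v (y + toℕ k))) e))
              (λ e → trans (at-map toℕ v (y + toℕ k)) (cong (Maybe.map toℕ) e))

        entryᶠ-sat : ∀ k c → Sat W (map toℕ v) (entryᶠ x k c) ρ S ⇔ c ≡ code (at v (y + toℕ k))
        entryᶠ-sat k (suc b) = atᶠ-sat k b ⇔∙ mk⇔ (λ e → sym (cong code e)) (λ e → sym (code-injective {just b} e))
        entryᶠ-sat k zero    = mk⇔ ⇒ ⇐
          where
          ⇒ : Sat W (map toℕ v) (entryᶠ x k zero) ρ S → zero ≡ code (at v (y + toℕ k))
          ⇒ none with at v (y + toℕ k) in e
          ... | nothing = refl
          ... | just b  = contradiction (from (⋁-sat x (map toℕ v) ρ S (map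
              (atᶠ x k) (allFin B))) (Any.map⁺ (lose (∈-allFin b) (from (atᶠ-sat k b) e)))) none
          ⇐ : zero ≡ code (at v (y + toℕ k)) → Sat W (map toℕ v) (entryᶠ x k zero) ρ S
          ⇐ e s with find (Any.map⁻ (to (⋁-sat x (map toℕ v) ρ S (map (atᶠ x k) (allFin B))) s))
          ... | b , _ , q with trans e (cong code (to (atᶠ-sat k b) q))
          ... | ()

      windowᶠ-sat : ∀ γ → Sat W (map toℕ v) (windowᶠ x γ) ρ S ⇔ γ ≡ window (drop y v)
      windowᶠ-sat γ = ⋀-sat x (map toℕ v) ρ S (map (λ k → entryᶠ x k (entry γ k)) (allFin (suc t))) ⇔∙ mk⇔ ⇒ ⇐
        where
        Holds = λ φ → Sat W (map toℕ v) φ ρ S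
        ⇒ : All Holds (map (λ k → entryᶠ x k (entry γ k)) (allFin (suc t))) → γ ≡ window (drop y v)
        ⇒ a = trans (sym (funToFin-finToFin {suc t} {suc B} γ)) (funToFin-cong {f = entry γ} λ k →
          trans (to (entryᶠ-sat k (entry γ k)) (All.lookup (All.map⁻ a) (∈-allFin k))) (cong code (sym
              (at-drop v y (toℕ k)))))

        ⇐ : γ ≡ window (drop y v) → All Holds (map (λ k → entryᶠ x k (entry γ k)) (allFin (suc t)))
        ⇐ e = All.map⁺ (All.tabulate {xs = allFin (suc t)} λ {k} _ → from (entryᶠ-sat k (entry γ k)) (trans (cong (λ g → entry g k) e) (entry-window v y k)))

    letterᵂ-sat : ∀ v {m p} a (x : Fin m) {ρ ρ′} (S : Vec _ p) (S′ : Vec _ p) → Same¹ ρ ρ′ →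
                  Sat V (map toℕ (windows v)) (letter a x) ρ S ⇔ Sat W (map toℕ v) (letterᵂ a x) ρ′ S′
    letterᵂ-sat v c x {ρ} {ρ′} S S′ r with lookup-map-toℕ v (Vec.lookup ρ′ x) | lookup-map-toℕ (windows v) (Vec.lookup ρ x)
    ... | a , at≡ , l | γ , at≡′ , l₀ with just-injective (trans (sym at≡′) (trans (cong
        (at (windows v)) (r .value x)) (at-windows v (toℕ (Vec.lookup ρ′ x)) at≡)))
    ... | γ≡ with c <? Γ
    ... | no c≮  = mk⇔ (λ e → contradiction (subst (_< Γ) (trans (sym l₀) e) (toℕ<n γ)) c≮) (λ (p , ¬p) →
        contradiction p ¬p)
    ... | yes c< = mk⇔ (λ e → trans (toℕ-injective (trans (toℕ-fromℕ< c<) (trans (sym e) l₀))) γ≡)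
                       (λ e → trans l₀ (trans (cong toℕ (trans γ≡ (sym e))) (toℕ-fromℕ< c<)))
                   ⇔∙ ⇔-sym (windowᶠ-sat v x ρ′ S′ (fromℕ< c<))

-- A letter of the alphabet Fin (suc n * d) is a pair of a residue i and
-- either a letter a, an arrow from i to i + 1, or the loop at i.  Every word
-- decodes to a word over Fin n: consecutive arrows which do not fit together
-- are connected by a power of a₀.

module Paths {n : ℕ} (a₀ : Fin n) (d : ℕ) .{{_ : NonZero d}} where

  B : ℕ
  B = suc n * d

  loop : Fin d → Fin B
  loop i = combine {suc n} zero i

  arrow : Fin d → Fin n → Fin B
  arrow i a = combine (suc a) i

  source : Fin B → Fin d
  source b = proj₂ (remQuot {suc n} d b)

  emitted : Fin (suc n) → List (Fin n)
  emitted zero    = []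
  emitted (suc a) = a ∷ []

  emit : Fin B → List (Fin n)
  emit b = emitted (proj₁ (remQuot {suc n} d b))

  target : Fin B → Fin d
  target b = (toℕ (source b) + length (emit b)) modulo d

  -- The exponent is i - p modulo d, so the filler leads from residue p to residue i and is empty
  -- when they coincide.
  fill : Fin d → Fin d → List (Fin n)
  fill p i = replicate ((toℕ i + (d ∸ toℕ p)) % d) a₀

  -- Decoding is total thanks to the fillers, so the language of paths involves no condition that
  -- consecutive arrows fit together.
  decodePath : Fin d → List (Fin B) → List (Fin n)
  decodePath p []      = []
  decodePath p (b ∷ w) = fill p (source b) ++ emit b ++ decodePath (target b) w

  start : Fin d
  start = 0 modulo d

  PathLanguage : Language n → Language B
  PathLanguage L w = L (decodePath start w)

  fill-% : ∀ p i → (toℕ p + length (fill p i)) % d ≡ toℕ i % d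
  fill-% p i rewrite length-replicate ((toℕ i + (d ∸ toℕ p)) % d) {a₀} =
    trans (%-+-cong {m = toℕ p} {toℕ p} refl (m%n%n≡m%n (toℕ i + (d ∸ toℕ p)) d))
      (trans (cong (_% d) (trans (+-comm (toℕ p) _) (trans (+-assoc (toℕ i) _ (toℕ p)) (cong
          (toℕ i +_) (m∸n+n≡m (<⇒≤ (toℕ<n p)))))))
        (%-remove-+ʳ (toℕ i) ∣-refl))

  fill-self : ∀ p → fill p p ≡ []
  fill-self p = cong (λ m → replicate m a₀) (trans (cong (_% d) (m+[n∸m]≡n (<⇒≤ (toℕ<n p)))) (n%n≡0 d))

  source-loop : ∀ i → source (loop i) ≡ i
  source-loop i = cong proj₂ (remQuot-combine {suc n} zero i)

  source-arrow : ∀ i a → source (arrow i a) ≡ i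
  source-arrow i a = cong proj₂ (remQuot-combine {suc n} (suc a) i)

  emit-loop : ∀ i → emit (loop i) ≡ []
  emit-loop i = cong (emitted ∘ proj₁) (remQuot-combine {suc n} zero i)

  emit-arrow : ∀ i a → emit (arrow i a) ≡ a ∷ []
  emit-arrow i a = cong (emitted ∘ proj₁) (remQuot-combine {suc n} (suc a) i)

  decode-loop : ∀ i w → decodePath i (loop i ∷ w) ≡ decodePath i w
  decode-loop i w rewrite source-loop i | emit-loop i | fill-self i | +-identityʳ (toℕ i) | toℕ-mod-id i = refl

  decode-arrow : ∀ i a w → decodePath i (arrow i a ∷ w) ≡ a ∷ decodePath ((toℕ i + 1) modulo d) w
  decode-arrow i a w rewrite source-arrow i a | emit-arrow i a | fill-self i = refl

  decode-loops : ∀ m i w → decodePath i (replicate m (loop i) ++ w) ≡ decodePath i w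
  decode-loops zero    i w = refl
  decode-loops (suc m) i w = trans (decode-loop i (replicate m (loop i) ++ w)) (decode-loops m i w)

  final : Fin d → List (Fin B) → Fin d
  final p []      = p
  final p (b ∷ w) = final (target b) w

  length-fill-emit : ∀ p b → (toℕ p + length (fill p (source b)) + length (emit b)) % d ≡ toℕ (target b) % d
  length-fill-emit p b = trans (%-+-cong {m = toℕ p + length (fill p (source b))} {toℕ (source b)} {length (emit b)} (fill-% p (source b)) refl)
    (sym (toℕ-mod-% (toℕ (source b) + length (emit b))))

  length-decode : ∀ p w → (toℕ p + length (decodePath p w)) % d ≡ toℕ (final p w) % d
  length-decode p []      = cong (_% d) (+-identityʳ (toℕ p))
  length-decode p (b ∷ w) = trans (cong (_% d) (trans (cong (toℕ p +_) (trans (length-++ (fill p (source b)))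
      (cong (length (fill p (source b)) +_) (length-++ (emit b)))))
    (trans (sym (+-assoc (toℕ p) _ _)) (sym (+-assoc (toℕ p + length (fill p (source b))) (length (emit b)) _)))))
    (trans (%-+-cong {m = toℕ p + length (fill p (source b)) + length (emit b)} {toℕ (target b)} {length (decodePath (target b) w)} (length-fill-emit p b) refl)
      (length-decode (target b) w))

  length-decode-start : ∀ w → length (decodePath start w) modulo d ≡ final start w
  length-decode-start w = toℕ-injective (trans (toℕ-mod _) (trans (trans
      (sym (%-+-cong {m = toℕ start} {0} {length (decodePath start w)}
          (toℕ-mod-% 0) refl)) (length-decode start w)) (toℕ-% (final start w))))

  -- Through this the length of the decoded word modulo d is visible in one letter, which a
  -- predicate at `max` can read.
  final-last : ∀ p w {b} → at (reverse w) 0 ≡ just b → final p w ≡ target b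
  final-last p w e with reverse w in r
  final-last p w refl | b ∷ v = trans (cong (final p) (trans (sym (reverse-involutive w)) (trans
      (cong reverse r) (unfold-reverse b v)))) (go p (reverse v))
    where
    go : ∀ p v → final p (v ++ b ∷ []) ≡ target b
    go p []      = refl
    go p (c ∷ v) = go (target c) v

  -- The automaton pairs a state of D with the current residue, and runs D on the filler and the
  -- emitted letter.
  pathRegular : ∀ {L : Language n} → Regular L → Regular (PathLanguage L)
  pathRegular {L} (D , L⇔D) = record
    { states = states * d ; start = combine (DFA.start D) start ; δ = δ′ ; final = λ c →
        DFA.final D (proj₁ (remQuot d c)) }
    , λ w → L⇔D (decodePath start w) ⇔∙ ≡⇒⇔ (cong (T ∘ DFA.final D) (sym (run (DFA.start D) start w)))
    where
    open DFA D using (states; δ)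
    δ″ : Fin states × Fin d → Fin B → Fin (states * d)
    δ″ (q , p) b = combine (foldl δ q (fill p (source b) ++ emit b)) (target b)
    δ′ : Fin (states * d) → Fin B → Fin (states * d)
    δ′ c = δ″ (remQuot d c)
    run : ∀ q p w → proj₁ (remQuot {states} d (foldl δ′ (combine q p) w)) ≡ foldl δ q (decodePath p w)
    run q p []      = cong proj₁ (remQuot-combine {states} q p)
    run q p (b ∷ w) = trans (cong (λ z →
        proj₁ (remQuot {states} d (foldl δ′ (δ″ z b) w))) (remQuot-combine {states} q p))
      (trans (run (foldl δ q (fill p (source b) ++ emit b)) (target b) w)
        (trans (sym (foldl-++ δ q (fill p (source b) ++ emit b) (decodePath (target b) w)))
            (cong (foldl δ q) (++-assoc (fill p (source b)) (emit b) _))))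

  module _ (M : Monoid 0ℓ 0ℓ) (h : Fin d → Fin n → Monoid.Carrier M) where
    open Monoid M using (Carrier; _≈_; _∙_) renaming (ε to 1ᴹ)
    private module M = Monoid M
    open Windows B 1

    connect : Fin d → Fin (suc B) → Carrier
    connect p zero    = 1ᴹ
    connect p (suc b) = eval M h (toℕ p) (fill p (source b))

    -- A filler depends on two consecutive letters, so it is charged to the window of length two at
    -- the first of them. Only the filler before the first letter of the word remains, as the factor
    -- `connect` in `eval-decode`.
    pairValue : Fin (suc B) → Fin (suc B) → Carrier
    pairValue zero    c = 1ᴹ
    pairValue (suc b) c = eval M h (toℕ (source b)) (emit b) ∙ connect (target b) c

    windowValue : Fin Γ → Carrier
    windowValue γ = pairValue (entry γ zero) (entry γ (suc zero))

    eval-decode : ∀ p w → eval M h (toℕ p) (decodePath p w) ≈ connect p (code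
        (at w 0)) ∙ extension M windowValue (windows w)
    eval-decode p []      = M.sym (M.identityˡ _)
    eval-decode p (b ∷ w) = begin
      eval M h (toℕ p) (fill p (source b) ++ emit b ++ decodePath (target b) w)
        ≈⟨ M.trans (eval-++ M h (toℕ p) (fill p (source b)) _) (M.∙-cong M.refl (eval-++ M h _ (emit b) _)) ⟩
      eval M h (toℕ p) (fill p (source b)) ∙ (eval M h (toℕ p + length (fill p (source b))) (emit b)
        ∙ eval M h (toℕ p + length (fill p (source b)) + length (emit b)) (decodePath (target b) w))
        ≡⟨ cong₂ (λ x y → eval M h (toℕ p) (fill p (source b)) ∙ (x ∙ y))
             (eval-mod M h (fill-% p (source b)) (emit b))
                 (eval-mod M h (length-fill-emit p b) (decodePath (target b) w)) ⟩
      eval M h (toℕ p) (fill p (source b)) ∙ (eval M h (toℕ (source b)) (emit b) ∙ eval M h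
          (toℕ (target b)) (decodePath (target b) w))
        ≈⟨ M.∙-cong M.refl (M.trans (M.∙-cong M.refl (eval-decode (target b) w)) (M.sym (M.assoc _ _ _))) ⟩
      eval M h (toℕ p) (fill p (source b)) ∙ (pairValue (suc b) (code (at w 0)) ∙ extension M windowValue (windows w))
        ≡⟨ cong (λ x → eval M h (toℕ p) (fill p (source b)) ∙ (x ∙ extension M windowValue (windows w)))
             (sym (cong₂ pairValue (entry-window (b ∷ w) 0 zero) (entry-window (b ∷ w) 0 (suc zero)))) ⟩
      eval M h (toℕ p) (fill p (source b)) ∙ (windowValue (window (b ∷ w)) ∙ extension M windowValue (windows w)) ∎
      where open import Relation.Binary.Reasoning.Setoid M.setoid

  module _ {ℓ₁ ℓ₂ : Level} {σ : Signature} {F : Pred (Sentence (numerical σ)) ℓ₁} (isFragment : IsFragment σ F)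
           {𝐕 : Pred (Monoid 0ℓ 0ℓ) ℓ₂} (isVariety : IsVariety 𝐕) (equivalent : F EquivalentTo 𝐕)
           {L : Language n} where

    private
      V = numerical σ
      W = V ∪ⱽ local
    open Enrichment isFragment isVariety equivalent

    -- The guards fix the first and the last letter, or emptiness by `nothing`. The first letter
    -- determines the filler from `start`, the last one the acceptance set; the rest of the value is
    -- a product over the windows.
    recognized⇒path-definable : ModRecognized 𝐕 d L → Definable (F [ local ]) (PathLanguage L)
    recognized⇒path-definable R = guarded-definable (letterᵂ σ B 1) (letterᵂ-basic σ B 1)
      (PathLanguage L) Guarded guarded (nothing ∷ map just (cartesianProduct (allFin B) (allFin B)))
      guard guard-qf windows length-windows (letterᵂ-sat σ B 1) correct some
      where
      open Windows B 1
      module R = ModRecognized R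
      module M = Monoid R.M

      Ends : Set
      Ends = Maybe (Fin B × Fin B)

      f : Fin Γ → M.Carrier
      f = windowValue R.M R.h

      accepts : Ends → M.Carrier → Bool
      accepts nothing         m = R.accept start M.ε
      accepts (just (b , b′)) m = R.accept (target b′) (connect R.M R.h start (suc b) M.∙ m)

      accepts-cong : ∀ e → Congruent M._≈_ _≡_ (accepts e)
      accepts-cong nothing         p = refl
      accepts-cong (just (b , b′)) p = R.accept-cong (target b′) (M.∙-cong M.refl p)

      Guarded : Ends → Language Γ
      Guarded e v = T (accepts e (extension R.M f v))

      guarded : ∀ e → Definable F (Guarded e)
      guarded e = recognized⇒definable R.M R.M∈𝐕 f (accepts e) (accepts-cong e) (λ _ → ⇔-refl)

      firstᶠ lastᶠ : Fin B → Sentence W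
      firstᶠ b = pred (inj₂ (minPlus (toℕ b) 0)) []
      lastᶠ  b = pred (inj₂ (maxMinus (toℕ b) 0)) []

      someFirst : List (Fin B) → Sentence W
      someFirst = foldr (λ b φ → firstᶠ b ∨ᶠ φ) ⊥ᶠ

      guard : Ends → Sentence W
      guard nothing         = ¬ᶠ someFirst (allFin B)
      guard (just (b , b′)) = firstᶠ b ∧ᶠ lastᶠ b′

      guard-qf : ∀ e → QuantifierFree (guard e)
      guard-qf nothing         = ¬ᶠ go (allFin B)
        where
        go : ∀ bs → QuantifierFree (someFirst bs)
        go []       = ⊥ᶠ
        go (b ∷ bs) = pred _ _ ∨ᶠ go bs
      guard-qf (just (b , b′)) = pred _ _ ∧ᶠ pred _ _

      letterAt⇔ : ∀ v (b : Fin B) → T (does (≡-decᵐ _≟_ (letterAt (map toℕ v) 0) (just (toℕ b)))) ⇔ at v 0 ≡ just b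
      letterAt⇔ v b = T-does (≡-decᵐ _≟_ (letterAt (map toℕ v) 0) (just (toℕ b))) ⇔∙
        mk⇔ (λ e → map-injectiveᵐ toℕ-injective (trans (sym (at-map toℕ v 0)) e))
            (λ e → trans (at-map toℕ v 0) (cong (Maybe.map toℕ) e))

      first⇔ : ∀ w b → (w ⊨ firstᶠ b) ⇔ at w 0 ≡ just b
      first⇔ = letterAt⇔

      last⇔ : ∀ w b → (w ⊨ lastᶠ b) ⇔ at (reverse w) 0 ≡ just b
      last⇔ w b = ≡⇒⇔ (cong (λ v → T (does (≡-decᵐ _≟_ (letterAt v 0) (just (toℕ b)))))
          (sym (reverse-map toℕ w))) ⇔∙ letterAt⇔ (reverse w) b

      someFirst⇔ : ∀ w → (w ⊨ someFirst (allFin B)) ⇔ (∃[ b ] at w 0 ≡ just b)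
      someFirst⇔ w = mk⇔ (⇒ (allFin B)) (λ (b , e) → ⇐ (∈-allFin b) e)
        where
        ⇒ : ∀ bs → w ⊨ someFirst bs → ∃[ b ] at w 0 ≡ just b
        ⇒ (b ∷ bs) (inj₁ s) = b , to (first⇔ w b) s
        ⇒ (b ∷ bs) (inj₂ s) = ⇒ bs s
        ⇐ : ∀ {b bs} → b ∈ bs → at w 0 ≡ just b → w ⊨ someFirst bs
        ⇐ {b} (here refl) e = inj₁ (from (first⇔ w b) e)
        ⇐ (there b∈)      e = inj₂ (⇐ b∈ e)

      start≡ : ∀ w → eval R.M R.h 0 (decodePath start w) M.≈ connect R.M R.h start (code
          (at w 0)) M.∙ extension R.M f (windows w)
      start≡ w = M.trans (M.reflexive (eval-mod R.M R.h (sym (toℕ-mod-% 0)) (decodePath start w)))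
          (eval-decode R.M R.h start w)

      correct : ∀ w e → w ⊨ guard e → PathLanguage L w ⇔ Guarded e (windows w)
      correct []      nothing g = R.correct []
      correct (b ∷ w) nothing g = contradiction (from (someFirst⇔ (b ∷ w)) (b , refl)) g
      correct w (just (b , b′)) (g , g′) = R.correct (decodePath start w) ⇔∙ ≡⇒⇔ (cong T (trans
        (R.accept-cong _ (M.trans (start≡ w) (M.∙-cong (M.reflexive (cong (connect R.M R.h start ∘ code)
            (to (first⇔ w b) g))) M.refl)))
        (cong (λ e → R.accept e (connect R.M R.h start (suc b) M.∙ extension R.M f (windows w)))
          (trans (length-decode-start w) (final-last start w (to (last⇔ w b′) g′))))))

      some : ∀ w → ∃[ e ] e ∈ (nothing ∷ map just (cartesianProduct (allFin B) (allFin B))) × w ⊨ guard e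
      some [] = nothing , here refl , λ s → case (to (someFirst⇔ []) s)
        where
        case : ¬ (∃[ b ] at {Fin B} [] 0 ≡ just b)
        case (_ , ())
      some w@(b ∷ v) = ends (last-letter (reverse v) (unfold-reverse b v))
        where
        last-letter : ∀ u → reverse w ≡ u ++ b ∷ [] → ∃[ b′ ] at (reverse w) 0 ≡ just b′
        last-letter []      e = b , cong (λ v → at v 0) e
        last-letter (c ∷ u) e = c , cong (λ v → at v 0) e
        ends : ∃[ b′ ] at (reverse w) 0 ≡ just b′ →
            ∃[ e ] e ∈ (nothing ∷ map just (cartesianProduct (allFin B) (allFin B))) × w ⊨ guard e
        ends (b′ , e) = just (b , b′) , there (∈-map⁺ just (∈-cartesianProduct⁺ (∈-allFin b) (∈-allFin b′)))
                      , from (first⇔ w b) refl , from (last⇔ w b′) e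

-- Every letter of a word is preceded by t loops, so that the windows of
-- length t + 1 in its block only depend on the letter and its residue.

module Padding {n : ℕ} (a₀ : Fin n) (d : ℕ) .{{_ : NonZero d}} (t : ℕ) where
  open Paths a₀ d
  open Windows B t

  loops : ℕ → ℕ → List (Fin B)
  loops m i = replicate m (loop (i modulo d))

  block : ℕ → Fin n → List (Fin B)
  block i a = loops t i ++ arrow (i modulo d) a ∷ []

  pad : ℕ → List (Fin n) → List (Fin B)
  pad i []      = loops t i ++ loop (i modulo d) ∷ []
  pad i (a ∷ u) = block i a ++ pad (suc i) u

  -- There are t + 1 equal loops at either end, so that predicates at `min` and `max` with offsets
  -- up to t see a single known letter.
  encode : List (Fin n) → List (Fin B)
  encode u = loops (suc t) 0 ++ pad 0 u

  decode-pad : ∀ i u → decodePath (i modulo d) (pad i u) ≡ u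
  decode-pad i []      = trans (decode-loops t (i modulo d) (loop (i modulo d) ∷ [])) (decode-loop (i modulo d) [])
  decode-pad i (a ∷ u) = begin
    decodePath (i modulo d) ((loops t i ++ arrow (i modulo d) a ∷ []) ++ pad (suc i) u)  ≡⟨ cong (decodePath (i modulo d)) (++-assoc (loops t i) _ _) ⟩
    decodePath (i modulo d) (loops t i ++ arrow (i modulo d) a ∷ pad (suc i) u)          ≡⟨ decode-loops t (i modulo d) _ ⟩
    decodePath (i modulo d) (arrow (i modulo d) a ∷ pad (suc i) u)                       ≡⟨ decode-arrow (i modulo d) a (pad (suc i) u) ⟩
    a ∷ decodePath ((toℕ (i modulo d) + 1) modulo d) (pad (suc i) u)                     ≡⟨ cong (λ j →
        a ∷ decodePath j (pad (suc i) u)) (trans (modulo-shift i 1) (cong (_modulo d) (+-comm i 1))) ⟩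
    a ∷ decodePath (suc i modulo d) (pad (suc i) u)                                      ≡⟨ cong (a ∷_) (decode-pad (suc i) u) ⟩
    a ∷ u                                                                                ∎
    where open ≡-Reasoning

  decode-encode : ∀ u → decodePath start (encode u) ≡ u
  decode-encode u = trans (decode-loops (suc t) start (pad 0 u)) (decode-pad 0 u)

  pad-prefix : ∀ i u → ∃[ v ] pad i u ≡ loops t i ++ v
  pad-prefix i []      = _ , refl
  pad-prefix i (a ∷ u) = _ , ++-assoc (loops t i) _ _

  -- The final loops sit at the residue reached by the word; the case distinction on the last letter
  -- is thus one on the length modulo d.
  pad-suffix : ∀ i u → ∃[ v ] pad i u ≡ v ++ loops (suc t) (i + length u)
  pad-suffix i []      = [] , trans (replicate-∷ʳ t _) (cong (loops (suc t)) (sym (+-identityʳ i)))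
  pad-suffix i (a ∷ u) with pad-suffix (suc i) u
  ... | v , e = block i a ++ v , trans (cong (block i a ++_) (trans e (cong (λ j → v ++ loops (suc t) j)
      (sym (+-suc i (length u))))))
                                       (sym (++-assoc (block i a) v _))

  encode-first : ∀ u k → k ≤ t → letterAt (map toℕ (encode u)) k ≡ just (toℕ (loop start))
  encode-first u k k≤t = trans (at-map toℕ (encode u) k) (cong (Maybe.map toℕ)
    (trans (at-++ (loops (suc t) 0) (subst (k <_) (sym (length-replicate (suc t))) (s≤s k≤t)))
        (at-replicate (s≤s k≤t))))

  encode-last : ∀ u k → k ≤ t → letterAt (reverse (map toℕ (encode u))) k ≡ just (toℕ (loop (length u modulo d)))
  encode-last u k k≤t with pad-suffix 0 u
  ... | v , e = begin
    at (reverse (map toℕ (encode u))) k        ≡⟨ cong (λ w → at w k) (sym (reverse-map toℕ (encode u))) ⟩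
    at (map toℕ (reverse (encode u))) k        ≡⟨ at-map toℕ (reverse (encode u)) k ⟩
    Maybe.map toℕ (at (reverse (encode u)) k)  ≡⟨ cong (Maybe.map toℕ) last ⟩
    just (toℕ (loop (length u modulo d)))      ∎
    where
    open ≡-Reasoning
    ends = loops (suc t) (length u)
    reversed : reverse (encode u) ≡ ends ++ reverse (loops (suc t) 0 ++ v)
    reversed = trans (cong reverse (trans (cong (loops (suc t) 0 ++_) e) (sym (++-assoc (loops (suc t) 0) v ends))))
      (trans (reverse-++ (loops (suc t) 0 ++ v) ends)
          (cong (_++ reverse (loops (suc t) 0 ++ v)) (reverse-replicate (suc t) _)))
    last : at (reverse (encode u)) k ≡ just (loop (length u modulo d))
    last = trans (cong (λ w → at w k) reversed)
      (trans (at-++ ends (subst (k <_) (sym (length-replicate (suc t))) (s≤s k≤t))) (at-replicate (s≤s k≤t)))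

  -- The word which follows only matters through its first t letters.

  blockWindows : ℕ → Fin n → List (Fin Γ)
  blockWindows i a = take (length (block i a)) (windows (block i a ++ loops t (suc i)))

  initialWindows : List (Fin Γ)
  initialWindows = take (length (loops (suc t) 0)) (windows (loops (suc t) 0 ++ loops t 0))

  windows-pad : ∀ i x u → windows (x ++ pad i u) ≡ take (length x) (windows (x ++ loops t i)) ++ windows (pad i u)
  windows-pad i x u with pad-prefix i u
  ... | v , e = trans (cong (λ w → windows (x ++ w)) e) (trans (windows-++ x (≤-reflexive (sym (length-replicate t))))
                  (cong (λ w → take (length x) (windows (x ++ loops t i)) ++ windows w) (sym e)))

  block-mod : ∀ i a → blockWindows (toℕ (i modulo d)) a ≡ blockWindows i a
  block-mod i a = cong₂ (λ j k → let x = replicate t (loop j) ++ arrow j a ∷ [] in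
                                 take (length x) (windows (x ++ replicate t (loop k)))) (toℕ-mod-id (i modulo d))
    (trans (cong (_modulo d) (+-comm 1 (toℕ (i modulo d)))) (trans (modulo-shift i 1)
        (cong (_modulo d) (+-comm i 1))))

  module _ (M : Monoid 0ℓ 0ℓ) (η : List (Fin Γ) → Monoid.Carrier M) (η-hom : IsHom (++-monoid (Fin Γ)) M η) where
    open Monoid M using (Carrier; _≈_; _∙_)
    private
      module M = Monoid M
      module η = IsMonoidHomomorphism η-hom

    blockValue : Fin d → Fin n → Carrier
    blockValue i a = η (blockWindows (toℕ i) a)

    finalValue : Fin d → Carrier
    finalValue e = η (windows (replicate t (loop e) ++ loop e ∷ []))

    -- The windows starting in a block see that block and the t loops after it, whose residue is the
    -- next one; their value is a function of a residue and a letter, as `eval` requires.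
    windows-value : ∀ i u → η (windows (pad i u)) ≈ eval M blockValue i u ∙ finalValue ((i + length u) modulo d)
    windows-value i []      = M.trans (M.reflexive (cong (λ j → finalValue (j modulo d)) (sym (+-identityʳ i))))
        (M.sym (M.identityˡ _))
    windows-value i (a ∷ u) = begin
      η (windows (block i a ++ pad (suc i) u))                                       ≡⟨ cong η (windows-pad (suc i) (block i a) u) ⟩
      η (blockWindows i a ++ windows (pad (suc i) u))                                ≈⟨ η.homo _ _ ⟩
      η (blockWindows i a) ∙ η (windows (pad (suc i) u))                             ≈⟨ M.∙-cong (M.reflexive
          (cong η (sym (block-mod i a)))) (windows-value (suc i) u) ⟩
      blockValue (i modulo d) a ∙ (eval M blockValue (suc i) u ∙ finalValue ((suc i + length u) modulo d))
        ≈⟨ M.sym (M.assoc _ _ _) ⟩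
      eval M blockValue i (a ∷ u) ∙ finalValue ((suc i + length u) modulo d)         ≡⟨ cong (λ j →
          eval M blockValue i (a ∷ u) ∙ finalValue (j modulo d)) (sym (+-suc i (length u))) ⟩
      eval M blockValue i (a ∷ u) ∙ finalValue ((i + length (a ∷ u)) modulo d)       ∎
      where open import Relation.Binary.Reasoning.Setoid M.setoid

    encode-value : ∀ u → η (windows (encode u)) ≈ η initialWindows ∙
        (eval M blockValue 0 u ∙ finalValue (length u modulo d))
    encode-value u = M.trans (M.reflexive (cong η (windows-pad 0 (loops (suc t) 0) u)))
      (M.trans (η.homo initialWindows (windows (pad 0 u))) (M.∙-cong M.refl (windows-value 0 u)))

module _ {ℓ₁ ℓ₂ : Level} {σ : Signature} {F : Pred (Sentence (numerical σ)) ℓ₁} (isFragment : IsFragment σ F)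
         {𝐕 : Pred (Monoid 0ℓ 0ℓ) ℓ₂} (isVariety : IsVariety 𝐕) (equivalent : F EquivalentTo 𝐕)
         {n : ℕ} (a₀ : Fin n) (d : ℕ) .{{_ : NonZero d}} {L : Language n} where

  open Enrichment isFragment isVariety equivalent
  open Paths a₀ d using (PathLanguage; B; loop; start; decodePath)

  -- With t bounding the offsets of the sentence, its local predicates can be eliminated on encoded
  -- words, separately for each residue of the length. Decoding returns w, and the windows of its
  -- encoding have the value of the labelled w inside a context fixed by that residue.
  path-definable⇒recognized : Definable (F [ local ]) (PathLanguage L) → ModRecognized 𝐕 d L
  path-definable⇒recognized (φ , f , correct) = record
    { M = J.M ; M∈𝐕 = J.M∈𝐕 ; h = blockValue J.M J.η J.η-hom
    ; accept = λ e m → J.accept e (context e m)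
    ; accept-cong = λ e p → J.accept-cong e (M.∙-cong M.refl (M.∙-cong p M.refl))
    ; correct = λ w → ≡⇒⇔ (cong L (sym (decode-encode w))) ⇔∙ correct (encode w) ⇔∙
        translate-sat (θ (length w modulo d)) _ _ _ (Bounded σ t)
          (withoutLocal-correct σ B t (toℕ (loop start))
              (toℕ (loop (length w modulo d))) (encode w) (encode-first w) (encode-last w))
          φ (proj₂ (bound σ (symbols φ))) same-[] same²-[] ⇔∙
        J.correct (length w modulo d) (windows (encode w)) ⇔∙
        ≡⇒⇔ (cong T (J.accept-cong _ (encode-value J.M J.η J.η-hom w)))
    }
    where
    t = proj₁ (bound σ (symbols φ))
    open Windows B t using (Γ; windows)
    open Padding a₀ d t
    θ : Fin d → Translation (numerical σ ∪ⱽ local) (numerical σ)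
    θ e = withoutLocal σ B t (toℕ (loop start)) (toℕ (loop e))
    module J = JointlyRecognized (definable⇒jointlyRecognized (λ (e : Fin d) (v : List (Fin Γ)) →
        v ⊨ translate (θ e) φ)
                 (λ e → translate (θ e) φ , eliminate (θ e) f , λ _ → ⇔-refl))
    module M = Monoid J.M
    context : Fin d → M.Carrier → M.Carrier
    context e m = J.η initialWindows M.∙ (m M.∙ finalValue J.M J.η J.η-hom e)

-- Fragments of bounded rank

module _ {ℓ₁ ℓ₂ ℓ₃ : Level} {σ : Signature} {F : Pred (Sentence (numerical σ)) ℓ₁} (isFragment : IsFragment σ F)
         {𝐕 : Pred (Monoid 0ℓ 0ℓ) ℓ₂} (isVariety : IsVariety 𝐕) (equivalent : F EquivalentTo 𝐕) where

  open Enrichment isFragment isVariety equivalent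

  recognized-1⇒definable : ∀ {n} {L : Language n} → ModRecognized 𝐕 1 L → Definable F L
  recognized-1⇒definable R = recognized⇒definable R.M R.M∈𝐕 (R.h zero) (R.accept zero) (R.accept-cong zero) λ w →
    R.correct w ⇔∙ ≡⇒⇔ (cong₂ (λ e m → T (R.accept e m)) (only-zero (length w modulo 1)) (eval≡ 0 w))
    where
    module R = ModRecognized R
    only-zero : ∀ (e : Fin 1) → e ≡ zero
    only-zero zero = refl
    eval≡ : ∀ i w → eval R.M R.h i w ≡ extension R.M (R.h zero) w
    eval≡ i []      = refl
    eval≡ i (a ∷ w) = cong₂ (λ e m → Monoid._∙_ R.M (R.h e a) m) (only-zero (i modulo 1)) (eval≡ (suc i) w)

  -- There is no path equation on the empty graph.
  rank-0⇒definable : HasRank ℓ₃ 𝐕 0 → ∀ {n} {L : Language n} → Regular L → Definable F L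
  rank-0⇒definable rank {L = L} (D , L⇔D) = recognized-1⇒definable (divides⇒recognized isVariety D L⇔D 1
    (from (defines (wordFiniteCategory L 1 D L⇔D)) λ eq eq∈ →
        contradiction (PathEquation.source eq) (no-vertex (bounded eq eq∈))))
    where
    open HasRank rank
    no-vertex : ∀ {v} → v ≤ 0 → ¬ Fin v
    no-vertex z≤n ()

  -- Decoding needs a letter `a₀` for its fillers. Without letters the empty word is the only word,
  -- and a constant acceptance function suffices.
  empty-alphabet⇒definable : ∀ {L : Language 0} → Regular L → Definable F L
  empty-alphabet⇒definable {L} (D , L⇔D) = recognized⇒definable M (proj₂ nonempty) (λ _ → Monoid.ε M)
    (λ _ → DFA.final D (DFA.start D)) (λ _ → refl) λ { [] → L⇔D [] ; (() ∷ _) }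
    where
    open IsVariety isVariety
    M = proj₁ nonempty

  -- Recognition at a modulus d suited to the sentence becomes division of C_d, descends to C_(k *
  -- s), and turns back into recognition there.
  MOD-definable⇒recognized : ∀ {k} .{{_ : NonZero k}} → HasRank ℓ₃ 𝐕 k → ∀ {n} {L : Language n} → Regular L →
                             ∀ s .{{_ : NonZero (k * s)}} → IsStable L s →
                             Definable (F [ numerical MOD ]) L → ModRecognized 𝐕 (k * s) L
  MOD-definable⇒recognized {k} rank (D , L⇔D) s {{k*s≢0}} isStable definable
    with mod-definable⇒recognized isFragment isVariety equivalent (k * s) (recompute-nonZero (k * s)) definable
    where
    -- The instance is irrelevant, while a relevant proof is expected; matching on `m` rebuilds one.
    recompute-nonZero : ∀ m .{{_ : NonZero m}} → NonZero m
    recompute-nonZero (suc m) = _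
  ... | d , K∣d , d≢0 , R = divides⇒recognized isVariety D L⇔D (k * s)
    (divides-lift D L⇔D s isStable k d {{d≢0}} K∣d rank (recognized⇒divides isVariety D L⇔D d {{d≢0}} R))

  MOD-definable⇔ : ∀ k → HasRank ℓ₃ 𝐕 k → ∀ {n} {L : Language n} → Regular L → ∀ s → IsStable L s →
                   Definable (F [ numerical MOD ]) L ⇔ Definable (F [ numerical (MOD^ (k * s)) ]) L
  MOD-definable⇔ zero rank regular s isStable =
    mk⇔ (λ _ → embed-definable (rank-0⇒definable rank regular)) (λ _ →
        embed-definable (rank-0⇒definable rank regular))
  MOD-definable⇔ k@(suc _) rank regular s isStable = mk⇔
    (λ definable → recognized⇒MOD^-definable isFragment isVariety equivalent (k * s)
      (MOD-definable⇒recognized rank regular s isStable definable))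
    (MOD^-definable⇒MOD-definable isFragment isVariety equivalent (k * s))
    where instance k*s≢0 = m*n≢0 k s {{_}} {{>-nonZero (proj₁ isStable)}}

  -- With a stable s computed from the automaton, the question for L is equivalent to the question
  -- whether its language of paths at modulus k * s is definable with local predicates, and
  -- `pathRegular` supplies the automaton for `decide`.
  MOD-decidable : ∀ k → HasRank ℓ₃ 𝐕 k → DecidableFragment (F [ local ]) → DecidableFragment (F [ numerical MOD ])
  MOD-decidable k       rank decide {zero}  L regular = yes (embed-definable (empty-alphabet⇒definable regular))
  MOD-decidable zero    rank decide {suc n} L regular = yes (embed-definable (rank-0⇒definable rank regular))
  MOD-decidable k@(suc _) rank decide {suc n} L regular@(D , L⇔D) = map′
    (λ definable → MOD^-definable⇒MOD-definable isFragment isVariety equivalent (k * s)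
      (recognized⇒MOD^-definable isFragment isVariety equivalent (k * s)
        (path-definable⇒recognized isFragment isVariety equivalent zero (k * s) definable)))
    (λ definable → Paths.recognized⇒path-definable zero (k * s) isFragment isVariety equivalent
      (MOD-definable⇒recognized rank regular s isStable definable))
    (decide (Paths.PathLanguage zero (k * s) L) (Paths.pathRegular zero (k * s) regular))
    where
    s = proj₁ (Automaton.stable D L⇔D)
    isStable = proj₂ (Automaton.stable D L⇔D)
    instance k*s≢0 = m*n≢0 k s {{_}} {{>-nonZero (proj₁ isStable)}}
theorem8 : ∀ {ℓ₁ ℓ₂ ℓ₃ : Level}
    (σ : Signature) (F : Pred (Sentence (numerical σ)) ℓ₁) → IsFragment σ F →
    (𝐕 : Pred (Monoid 0ℓ 0ℓ) ℓ₂) → IsVariety 𝐕 → F EquivalentTo 𝐕 →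
    (k : ℕ) → HasRank ℓ₃ 𝐕 k →
    (∀ {n} (L : Language n) → Regular L → (s : ℕ) → IsStabilityIndex L s →
    Definable (F [ numerical MOD ]) L ⇔ Definable (F [ numerical (MOD^ (k * s)) ]) L)
    × (DecidableFragment (F [ local ]) → DecidableFragment (F [ numerical MOD ]))
theorem8 σ F isFragment 𝐕 isVariety equivalent k rank =
  (λ L regular s isIndex → MOD-definable⇔ isFragment isVariety equivalent k rank regular s (proj₁ isIndex)) ,
  MOD-decidable isFragment isVariety equivalent k rank
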